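{- Given a vector addition system with one zero-test $\mathcal V_z$ of dimension $d$, one can effectively compute the minimal basis of $\mathrm{Cover}(\mathcal V_z)$.
   Context: A vector addition system with one zero-test (VASZ) of dimension $d$ is a tuple $\mathcal V_z=\langle A,a_z,\delta,\vec x_{in}\rangle$ where $A$ is a finite alphabet, $a_z\notin A$ is the zero-test, $\delta:A\cup\{a_z\}\to\mathbb Z^d$ and $\vec x_{in}\in\mathbb N^d$. For $\vec x,\vec y\in\mathbb N^d$: $\vec x\xrightarrow{a}\vec y$ for $a\in A$ iff $\vec y-\vec x=\delta(a)$; and $\vec x\xrightarrow{a_z}\vec y$ iff $\vec y-\vec x=\delta(a_z)$ and $\vec x(1)=0$. This extends to words $u\in(A\cup\{a_z\})^*$ by composition. The reachability set is $\mathrm{Post}^*(\mathcal V_z)=\{\vec y\in\mathbb N^d\mid \exists u,\ \vec x_{in}\xrightarrow{u}\vec y\}$ and the cover is $\mathrm{Cover}(\mathcal V_z)=\downarrow\mathrm{Post}^*(\mathcal V_z)$, the downward closure w.r.t. the componentwise order on $\mathbb N^d$. Let $\mathbb N_\omega=\mathbb N\cup\{\omega\}$ with $n\le\omega$ for all $n$, ordered componentwise on $\mathbb N_\omega^d$. A sequence in $\mathbb N_\omega$ converges to $\ell$ if it is ultimately constant equal to $\ell$, or its integer-valued subsequence is infinite and tends to infinity and $\ell=\omega$; convergence in $\mathbb N_\omega^d$ is componentwise. For $\vec M\subseteq\mathbb N_\omega^d$, $\mathrm{Lim}\,\vec M$ is the set of limits of sequences of elements of $\vec M$. A basis of $\vec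 D\subseteq\mathbb N_\omega^d$ is a finite set $\vec B\subseteq\mathbb N_\omega^d$ with $\mathrm{Lim}\,\vec D=\downarrow\vec B$ (downward closure in $\mathbb N_\omega^d$); the set of maximal elements of any basis is a basis independent of the choice, called the minimal basis. -}

module Defs where

open import Data.Nat using (ℕ; zero; suc; _≤_)
open import Data.Integer using (ℤ; +_; _+_)
open import Data.Fin using (Fin)
open import Data.Vec using (Vec; lookup)
open import Data.List using (List)
open import Data.List.Membership.Propositional using (_∈_)
open import Data.Product using (Σ; ∃; ∃-syntax; _×_)
open import Data.Sum using (_⊎_)
open import Relation.Binary.PropositionalEquality using (_≡_)
open import Relation.Binary.Construct.Closure.ReflexiveTransitive using (Star)

-- Vector addition systems with one zero-test, dimension (suc d).
-- Coordinate "1" of the paper is Fin.zero.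

record VASZ (d : ℕ) : Set where
  field
    k    : ℕ
    δ    : Fin k → Vec ℤ (suc d)
    δz   : Vec ℤ (suc d)
    xin  : Vec ℕ (suc d)

Displ : ∀ {n} → Vec ℕ n → Vec ℤ n → Vec ℕ n → Set
Displ x v y = ∀ i → + lookup y i ≡ + lookup x i + lookup v i

data Step {d : ℕ} (V : VASZ d) (x y : Vec ℕ (suc d)) : Set where
  letter   : (a : Fin (VASZ.k V)) → Displ x (VASZ.δ V a) y → Step V x y
  zerotest : lookup x Fin.zero ≡ 0 → Displ x (VASZ.δz V) y → Step V x y

Reach : ∀ {d} → VASZ d → Vec ℕ (suc d) → Vec ℕ (suc d) → Set
Reach V = Star (Step V)

Post* : ∀ {d} → VASZ d → Vec ℕ (suc d) → Set
Post* V y = Reach V (VASZ.xin V) y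

_≤ᵛ_ : ∀ {n} → Vec ℕ n → Vec ℕ n → Set
x ≤ᵛ y = ∀ i → lookup x i ≤ lookup y i

Cover : ∀ {d} → VASZ d → Vec ℕ (suc d) → Set
Cover V x = ∃[ y ] (Post* V y × x ≤ᵛ y)

data ℕω : Set where
  fin : ℕ → ℕω
  ω   : ℕω

data _≤ω_ : ℕω → ℕω → Set where
  fin≤fin : ∀ {m n} → m ≤ n → fin m ≤ω fin n
  ≤ω-top  : ∀ {x} → x ≤ω ω

_≤ωᵛ_ : ∀ {n} → Vec ℕω n → Vec ℕω n → Set
x ≤ωᵛ y = ∀ i → lookup x i ≤ω lookup y i

Converges : (ℕ → ℕω) → ℕω → Set
Converges s ℓ =
  (∃[ M ] (∀ n → M ≤ n → s n ≡ ℓ))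
  ⊎ (ℓ ≡ ω
     × (∀ N → ∃[ n ] (N ≤ n × ∃[ m ] (s n ≡ fin m)))
     × (∀ N → ∃[ M ] (∀ n m → M ≤ n → s n ≡ fin m → N ≤ m)))

Convergesᵛ : ∀ {n} → (ℕ → Vec ℕω n) → Vec ℕω n → Set
Convergesᵛ s ℓ = ∀ i → Converges (λ j → lookup (s j) i) (lookup ℓ i)

Lim : ∀ {n} → (Vec ℕω n → Set) → Vec ℕω n → Set
Lim M ℓ = ∃[ s ] ((∀ j → M (s j)) × Convergesᵛ s ℓ)

embed : ∀ {n} → Vec ℕ n → Vec ℕω n
embed = Data.Vec.map fin

EmbedSet : ∀ {n} → (Vec ℕ n → Set) → Vec ℕω n → Set
EmbedSet D x = ∃[ y ] (D y × embed y ≡ x)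

IsBasis : ∀ {n} → (Vec ℕω n → Set) → List (Vec ℕω n) → Set
IsBasis D B = ∀ x → (Lim D x → ∃[ b ] (b ∈ B × x ≤ωᵛ b))
                  × (∃[ b ] (b ∈ B × x ≤ωᵛ b) → Lim D x)

MaxIn : ∀ {n} → List (Vec ℕω n) → Vec ℕω n → Set
MaxIn B x = x ∈ B × (∀ b → b ∈ B → x ≤ωᵛ b → x ≡ b)

IsMinimalBasis : ∀ {n} → (Vec ℕω n → Set) → List (Vec ℕω n) → Set
IsMinimalBasis D B = ∃[ B′ ] (IsBasis D B′ × (∀ x → (x ∈ B → MaxIn B′ x) × (MaxIn B′ x → x ∈ B)))

{-# OPTIONS --safe #-}
module Submission where

-- The reachability relation of a VASZ is "Good": a finite union of affine images of sets T ⊆ ℕⁿ that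
-- contain 0 and a final segment of every ray with strictly positive direction. The downward closure
-- of such an image is an ideal, with ω in the nonconstant coordinates, so these ideals form a basis.
--
-- Good sets, hereditarily with all their slices tₚ = k, are closed under union, product, image and
-- intersection with linear equations. The main point is that the set of runs of a Good set of moves
-- (fired in arbitrary contexts) is Good. This is the decomposition of Kosaraju and Lambert, by
-- induction on the dimension. The solutions (x , Ψ , y) of the flow equation x + Out Ψ = y + In Ψ,
-- where Ψ is a Parikh vector, are finitely many affine families. If a coordinate of Ψ is constant on
-- a family, then some of the moves are used boundedly often. If no run from x increases all constant
-- coordinates of x (or dually for y), then some counter stays bounded along every run and can be
-- eliminated. Otherwise all large members of the family are realized by pumping.
--
-- Zero-tests come for free: between two zero-tests a VASZ performs a Good relation on the remaining
-- counters, whose iteration is again a set of runs.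

open import Defs
open import Level using (0ℓ)
open import Algebra.Bundles using (CommutativeMonoid)
open import Algebra.Structures using (IsCommutativeMonoid)
import Algebra.Properties.CommutativeSemigroup as CommutativeSemigroupProperties
open import Data.Empty using (⊥; ⊥-elim)
open import Data.Fin as Fin using (Fin; zero; suc; punchIn; toℕ)
import Data.Fin.Properties as Finₚ
open import Data.Integer as ℤ using (ℤ; +_; -[1+_])
import Data.Integer.Properties as ℤₚ
import Data.Integer.Tactic.RingSolver as ℤ-Solver
open import Data.List using (List; []; _∷_; filter)
import Data.List as List
import Data.List.Membership.Propositional.Properties as Memₚ
open import Data.List.Membership.Propositional using (_∈_)
import Data.List.Relation.Unary.All as All
import Data.List.Relation.Unary.Any as Any
open import Data.Nat using (ℕ; zero; suc; _+_; _*_; _∸_; _≤_; _<_; z≤n; s≤s; _⊔_)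
import Data.Nat.DivMod as DivMod
import Data.Nat.Properties as ℕₚ
open import Data.Product using (Σ; Σ-syntax; ∃-syntax; _×_; _,_; proj₁; proj₂)
open import Data.Sum using (_⊎_; inj₁; inj₂; [_,_]′)
open import Data.Unit using (⊤; tt)
open import Data.Vec as Vec using (Vec; []; _∷_; lookup; map; zipWith; replicate; take; drop; _++_; insertAt; removeAt; tabulate; _[_]≔_)
import Data.Vec.Properties as Vecₚ
open import Function using (_∘_; id; case_of_)
open import Induction.WellFounded using (Acc; acc; WellFounded)
open import Relation.Binary.Construct.Closure.ReflexiveTransitive using (_◅_; _◅◅_) renaming (ε to ε★)
open import Relation.Binary.PropositionalEquality
open import Relation.Nullary using (¬_; Dec; yes; no)
open import Relation.Nullary.Decidable using (_→-dec_)

-- Moves have to form an infinite set from the outset: once a counter is bounded, the runs between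
-- two visits to a level become the moves of a system with one counter fewer, and this set is as
-- complicated as a reachability relation. Hence the induction is about Good relations throughout,
-- with an arbitrary label monoid, so that it also applies to moves labelled by their own Parikh
-- vectors. Semilinear sets would be too small a class, since reachability relations are not
-- semilinear in general; what pumping yields is a final segment of each positive ray, whose start
-- may depend on the ray. Fullness says nothing about a family on whose image some coordinate is
-- constant, because its directions are not strictly positive; such families are what the slices are
-- for. That 0 lies in each parameter set makes emptiness decidable, provides finitely many elements
-- below all others, and lets moves be used with parameter 0. All case distinctions are decided
-- constructively, so the list in the final Σ-type is the output of an algorithm.

-- Commutative monoids and their homomorphisms

record Mon : Set₁ where
  infixl 6 _∙_
  infixr 7 _·_
  field
    Car : Set
    _∙_ : Car → Car → Car
    ε   : Car
    isCommutativeMonoid : IsCommutativeMonoid _≡_ _∙_ ε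

  commutativeMonoid : CommutativeMonoid 0ℓ 0ℓ
  commutativeMonoid = record { isCommutativeMonoid = isCommutativeMonoid }

  open CommutativeMonoid commutativeMonoid public
    using (assoc; comm; identityˡ; identityʳ; commutativeSemigroup)
  open CommutativeSemigroupProperties commutativeSemigroup public
    using (interchange)

  _·_ : ℕ → Car → Car
  zero  · x = ε
  suc k · x = x ∙ k · x

  lin : ∀ {n} → Vec ℕ n → Vec Car n → Car
  lin []       []       = ε
  lin (t ∷ ts) (p ∷ ps) = t · p ∙ lin ts ps

  ·-zeroʳ : ∀ k → k · ε ≡ ε
  ·-zeroʳ zero    = refl
  ·-zeroʳ (suc k) = trans (identityˡ _) (·-zeroʳ k)

  ·-+ : ∀ k l x → (k + l) · x ≡ k · x ∙ l · x
  ·-+ zero    l x = sym (identityˡ _)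
  ·-+ (suc k) l x = trans (cong (x ∙_) (·-+ k l x)) (sym (assoc _ _ _))

  ·-∙ : ∀ k x y → k · (x ∙ y) ≡ k · x ∙ k · y
  ·-∙ zero    x y = sym (identityˡ _)
  ·-∙ (suc k) x y = trans (cong (x ∙ y ∙_) (·-∙ k x y)) (interchange x y _ _)

  ·-* : ∀ k l x → (k * l) · x ≡ k · (l · x)
  ·-* zero    l x = refl
  ·-* (suc k) l x = trans (·-+ l (k * l) x) (cong (l · x ∙_) (·-* k l x))

  lin-0 : ∀ {n} (p : Vec Car n) → lin (replicate n 0) p ≡ ε
  lin-0 []       = refl
  lin-0 (p ∷ ps) = trans (identityˡ _) (lin-0 ps)

  lin-+ : ∀ {n} (t u : Vec ℕ n) p → lin (zipWith _+_ t u) p ≡ lin t p ∙ lin u p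
  lin-+ []       []       []       = sym (identityˡ _)
  lin-+ (t ∷ ts) (u ∷ us) (p ∷ ps) =
    trans (cong₂ _∙_ (·-+ t u p) (lin-+ ts us ps)) (interchange _ _ _ _)

  lin-εs : ∀ {n} (t : Vec ℕ n) → lin t (replicate n ε) ≡ ε
  lin-εs []       = refl
  lin-εs (t ∷ ts) = trans (cong₂ _∙_ (·-zeroʳ t) (lin-εs ts)) (identityˡ _)

  lin-∙s : ∀ {n} (t : Vec ℕ n) p q → lin t (zipWith _∙_ p q) ≡ lin t p ∙ lin t q
  lin-∙s []       []       []       = sym (identityˡ _)
  lin-∙s (t ∷ ts) (p ∷ ps) (q ∷ qs) =
    trans (cong₂ _∙_ (·-∙ t p q) (lin-∙s ts ps qs)) (interchange _ _ _ _)

open Mon using (Car)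

ℕᴹ : Mon
ℕᴹ = record { Car = ℕ ; _∙_ = _+_ ; ε = 0 ; isCommutativeMonoid = ℕₚ.+-0-isCommutativeMonoid }

⊤ᴹ : Mon
⊤ᴹ = record
  { Car = ⊤ ; _∙_ = λ _ _ → tt ; ε = tt
  ; isCommutativeMonoid = record
    { isMonoid = record
      { isSemigroup = record
        { isMagma = record { isEquivalence = isEquivalence ; ∙-cong = λ _ _ → refl }
        ; assoc = λ _ _ _ → refl }
      ; identity = (λ _ → refl) , (λ _ → refl) }
    ; comm = λ _ _ → refl } }

infixr 4 _×ᴹ_
_×ᴹ_ : Mon → Mon → Mon
X ×ᴹ Y = record
  { Car = Car X × Car Y
  ; _∙_ = λ (x , y) (x′ , y′) → x X.∙ x′ , y Y.∙ y′
  ; ε = X.ε , Y.ε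
  ; isCommutativeMonoid = record
    { isMonoid = record
      { isSemigroup = record
        { isMagma = record { isEquivalence = isEquivalence ; ∙-cong = cong₂ _ }
        ; assoc = λ _ _ _ → cong₂ _,_ (X.assoc _ _ _) (Y.assoc _ _ _) }
      ; identity = (λ _ → cong₂ _,_ (X.identityˡ _) (Y.identityˡ _))
                 , (λ _ → cong₂ _,_ (X.identityʳ _) (Y.identityʳ _)) }
    ; comm = λ _ _ → cong₂ _,_ (X.comm _ _) (Y.comm _ _) } }
  where
  module X = Mon X
  module Y = Mon Y

infixl 6 _+ᵛ_
_+ᵛ_ : ∀ {n} → Vec ℕ n → Vec ℕ n → Vec ℕ n
_+ᵛ_ = zipWith _+_

0ᵛ 1ᵛ : ∀ {n} → Vec ℕ n
0ᵛ = replicate _ 0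
1ᵛ = replicate _ 1

Vecᴹ : ℕ → Mon
Vecᴹ n = record
  { Car = Vec ℕ n ; _∙_ = _+ᵛ_ ; ε = 0ᵛ
  ; isCommutativeMonoid = record
    { isMonoid = record
      { isSemigroup = record
        { isMagma = record { isEquivalence = isEquivalence ; ∙-cong = cong₂ _ }
        ; assoc = Vecₚ.zipWith-assoc ℕₚ.+-assoc }
      ; identity = Vecₚ.zipWith-identityˡ ℕₚ.+-identityˡ , Vecₚ.zipWith-identityʳ ℕₚ.+-identityʳ }
    ; comm = Vecₚ.zipWith-comm ℕₚ.+-comm } }

module V {n : ℕ} = Mon (Vecᴹ n)
open V using () renaming (_·_ to _·ᵛ_)

record Hom (X Y : Mon) (h : Car X → Car Y) : Set where
  private
    module X = Mon X
    module Y = Mon Y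
  field
    hom-ε : h X.ε ≡ Y.ε
    hom-∙ : ∀ x y → h (x X.∙ y) ≡ h x Y.∙ h y

  hom-· : ∀ k x → h (k X.· x) ≡ k Y.· h x
  hom-· zero    x = hom-ε
  hom-· (suc k) x = trans (hom-∙ _ _) (cong (h x Y.∙_) (hom-· k x))

  hom-lin : ∀ {n} (t : Vec ℕ n) p → h (X.lin t p) ≡ Y.lin t (map h p)
  hom-lin []       []       = hom-ε
  hom-lin (t ∷ ts) (p ∷ ps) = trans (hom-∙ _ _) (cong₂ Y._∙_ (hom-· t p) (hom-lin ts ps))

open Hom

id-hom : ∀ X → Hom X X id
id-hom X = record { hom-ε = refl ; hom-∙ = λ _ _ → refl }

∘-hom : ∀ {X Y Z g h} → Hom Y Z g → Hom X Y h → Hom X Z (g ∘ h)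
∘-hom {g = g} G H = record
  { hom-ε = trans (cong g (hom-ε H)) (hom-ε G)
  ; hom-∙ = λ x y → trans (cong g (hom-∙ H x y)) (hom-∙ G _ _) }

pair-hom : ∀ {X Y Z g h} → Hom X Y g → Hom X Z h → Hom X (Y ×ᴹ Z) (λ x → g x , h x)
pair-hom G H = record
  { hom-ε = cong₂ _,_ (hom-ε G) (hom-ε H)
  ; hom-∙ = λ x y → cong₂ _,_ (hom-∙ G x y) (hom-∙ H x y) }

proj₁-hom : ∀ X Y → Hom (X ×ᴹ Y) X proj₁
proj₁-hom X Y = record { hom-ε = refl ; hom-∙ = λ _ _ → refl }

proj₂-hom : ∀ X Y → Hom (X ×ᴹ Y) Y proj₂
proj₂-hom X Y = record { hom-ε = refl ; hom-∙ = λ _ _ → refl }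

∙-hom : ∀ X → Hom (X ×ᴹ X) X (λ (x , y) → Mon._∙_ X x y)
∙-hom X = record
  { hom-ε = Mon.identityˡ X _
  ; hom-∙ = λ (x , y) (x′ , y′) → Mon.interchange X x x′ y y′ }

const-hom : ∀ X Y → Hom X Y (λ _ → Mon.ε Y)
const-hom X Y = record { hom-ε = refl ; hom-∙ = λ _ _ → sym (Mon.identityˡ Y _) }

lin-hom : ∀ X {n} (p : Vec (Car X) n) → Hom (Vecᴹ n) X (λ t → Mon.lin X t p)
lin-hom X p = record { hom-ε = Mon.lin-0 X p ; hom-∙ = λ t u → Mon.lin-+ X t u p }

lookup-hom : ∀ {n} (i : Fin n) → Hom (Vecᴹ n) ℕᴹ (λ v → lookup v i)
lookup-hom i = record
  { hom-ε = Vecₚ.lookup-replicate i 0 ; hom-∙ = λ u v → Vecₚ.lookup-zipWith _+_ i u v }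

∷-hom : ∀ {n} → Hom (ℕᴹ ×ᴹ Vecᴹ n) (Vecᴹ (suc n)) (λ (x , v) → x ∷ v)
∷-hom = record { hom-ε = refl ; hom-∙ = λ _ _ → refl }

head-hom : ∀ {n} → Hom (Vecᴹ (suc n)) ℕᴹ Vec.head
head-hom = record { hom-ε = refl ; hom-∙ = λ { (_ ∷ _) (_ ∷ _) → refl } }

tail-hom : ∀ {n} → Hom (Vecᴹ (suc n)) (Vecᴹ n) Vec.tail
tail-hom = record { hom-ε = refl ; hom-∙ = λ { (_ ∷ _) (_ ∷ _) → refl } }

take-hom : ∀ m {n} → Hom (Vecᴹ (m + n)) (Vecᴹ m) (take m)
take-hom m {n} = record { hom-ε = e m ; hom-∙ = λ u v → a m u v }
  where
  e : ∀ m → take m (replicate (m + n) 0) ≡ replicate m 0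
  e zero    = refl
  e (suc m) = cong (0 ∷_) (e m)
  a : ∀ m (u v : Vec ℕ (m + n)) → take m (u +ᵛ v) ≡ take m u +ᵛ take m v
  a zero    u       v       = refl
  a (suc m) (x ∷ u) (y ∷ v) = cong (x + y ∷_) (a m u v)

drop-hom : ∀ m {n} → Hom (Vecᴹ (m + n)) (Vecᴹ n) (drop m)
drop-hom m {n} = record { hom-ε = e m ; hom-∙ = λ u v → a m u v }
  where
  e : ∀ m → drop m (replicate (m + n) 0) ≡ replicate n 0
  e zero    = refl
  e (suc m) = e m
  a : ∀ m (u v : Vec ℕ (m + n)) → drop m (u +ᵛ v) ≡ drop m u +ᵛ drop m v
  a zero    u       v       = refl
  a (suc m) (x ∷ u) (y ∷ v) = a m u v

insertAt-hom : ∀ {n} (i : Fin (suc n)) → Hom (ℕᴹ ×ᴹ Vecᴹ n) (Vecᴹ (suc n)) (λ (x , v) → insertAt v i x)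
insertAt-hom i = record { hom-ε = e i ; hom-∙ = λ (x , u) (y , v) → a i x y u v }
  where
  e : ∀ {n} (i : Fin (suc n)) → insertAt (replicate n 0) i 0 ≡ replicate (suc n) 0
  e zero            = refl
  e {suc n} (suc i) = cong (0 ∷_) (e i)
  a : ∀ {n} (i : Fin (suc n)) x y (u v : Vec ℕ n) →
      insertAt (u +ᵛ v) i (x + y) ≡ insertAt u i x +ᵛ insertAt v i y
  a zero    x y u       v       = refl
  a (suc i) x y (_ ∷ u) (_ ∷ v) = cong (_ ∷_) (a i x y u v)

removeAt-hom : ∀ {n} (i : Fin (suc n)) → Hom (Vecᴹ (suc n)) (Vecᴹ n) (λ v → removeAt v i)
removeAt-hom i = record { hom-ε = e i ; hom-∙ = λ u v → a i u v }
  where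
  e : ∀ {n} (i : Fin (suc n)) → removeAt (replicate (suc n) 0) i ≡ replicate n 0
  e zero            = refl
  e {suc n} (suc i) = cong (0 ∷_) (e i)
  a : ∀ {n} (i : Fin (suc n)) (u v : Vec ℕ (suc n)) →
      removeAt (u +ᵛ v) i ≡ removeAt u i +ᵛ removeAt v i
  a zero    (_ ∷ u) (_ ∷ v) = refl
  a {suc n} (suc i) (x ∷ u@(_ ∷ _)) (y ∷ v@(_ ∷ _)) = cong (x + y ∷_) (a i u v)

-- Affine maps

record Affine (X : Mon) {n : ℕ} (f : Vec ℕ n → Car X) : Set where
  private module X = Mon X
  field
    base    : Car X
    periods : Vec (Car X) n
    expand  : ∀ t → f t ≡ base X.∙ X.lin t periods

  base≡ : f 0ᵛ ≡ base
  base≡ = trans (expand _) (trans (cong (base X.∙_) (X.lin-0 periods)) (X.identityʳ _))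

  expand+ : ∀ t u → f (t +ᵛ u) ≡ f t X.∙ X.lin u periods
  expand+ t u = trans (expand _) (trans (cong (base X.∙_) (X.lin-+ t u periods))
    (trans (sym (X.assoc _ _ _)) (cong (X._∙ X.lin u periods) (sym (expand t)))))

open Affine

const-affine : ∀ X {n} (c : Car X) → Affine X {n} (λ _ → c)
const-affine X c = record
  { base = c ; periods = replicate _ X.ε
  ; expand = λ t → sym (trans (cong (c X.∙_) (X.lin-εs t)) (X.identityʳ c)) }
  where module X = Mon X

hom-affine : ∀ {X Y h n} {f : Vec ℕ n → Car X} → Hom X Y h → Affine X f → Affine Y (h ∘ f)
hom-affine {Y = Y} {h} H F = record
  { base = h (base F) ; periods = map h (periods F)
  ; expand = λ t → trans (cong h (expand F t))
      (trans (hom-∙ H _ _) (cong (Mon._∙_ Y _) (hom-lin H t (periods F)))) }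

∙-affine : ∀ X {n} {f g : Vec ℕ n → Car X} → Affine X f → Affine X g → Affine X (λ t → Mon._∙_ X (f t) (g t))
∙-affine X F G = record
  { base = base F X.∙ base G ; periods = zipWith X._∙_ (periods F) (periods G)
  ; expand = λ t → trans (cong₂ X._∙_ (expand F t) (expand G t))
      (trans (X.interchange _ _ _ _) (cong (X._∙_ _) (sym (X.lin-∙s t _ _)))) }
  where module X = Mon X

pair-affine : ∀ {X Y n} {f : Vec ℕ n → Car X} {g : Vec ℕ n → Car Y} →
              Affine X f → Affine Y g → Affine (X ×ᴹ Y) (λ t → f t , g t)
pair-affine {X} {Y} F G = record
  { base = base F , base G ; periods = zipWith _,_ (periods F) (periods G)
  ; expand = λ t → trans (cong₂ _,_ (expand F t) (expand G t))
      (cong₂ _,_ (cong (Mon._∙_ X _) (lin₁ t _ _)) (cong (Mon._∙_ Y _) (lin₂ t _ _))) }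
  where
  module X = Mon X
  module Y = Mon Y
  module XY = Mon (X ×ᴹ Y)
  lin₁ : ∀ {n} (t : Vec ℕ n) p q → X.lin t p ≡ proj₁ (XY.lin t (zipWith _,_ p q))
  lin₁ []      []      []      = refl
  lin₁ (t ∷ ts) (p ∷ ps) (q ∷ qs) =
    cong₂ X._∙_ (sym (hom-· (proj₁-hom X Y) t (p , q))) (lin₁ ts ps qs)
  lin₂ : ∀ {n} (t : Vec ℕ n) p q → Y.lin t q ≡ proj₂ (XY.lin t (zipWith _,_ p q))
  lin₂ []      []      []      = refl
  lin₂ (t ∷ ts) (p ∷ ps) (q ∷ qs) =
    cong₂ Y._∙_ (sym (hom-· (proj₂-hom X Y) t (p , q))) (lin₂ ts ps qs)

id-affine : ∀ {n} → Affine (Vecᴹ n) id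
id-affine {n} = record
  { base = 0ᵛ ; periods = units n
  ; expand = λ t → trans (unit-expansion t) (sym (V.identityˡ _)) }
  where
  units : ∀ n → Vec (Vec ℕ n) n
  units zero    = []
  units (suc n) = (1 ∷ 0ᵛ) ∷ map (0 ∷_) (units n)
  0∷-hom : ∀ {n} → Hom (Vecᴹ n) (Vecᴹ (suc n)) (0 ∷_)
  0∷-hom = record { hom-ε = refl ; hom-∙ = λ _ _ → refl }
  multiple : ∀ {n} t → t V.· (1 ∷ 0ᵛ) ≡ t ∷ 0ᵛ {n}
  multiple zero    = refl
  multiple (suc t) = trans (cong ((1 ∷ 0ᵛ) +ᵛ_) (multiple t)) (cong (suc t ∷_) (V.identityˡ _))
  unit-expansion : ∀ {n} (t : Vec ℕ n) → t ≡ V.lin t (units n)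
  unit-expansion []       = refl
  unit-expansion (t ∷ ts) = sym (trans (cong₂ _+ᵛ_ (multiple t) (sym (hom-lin 0∷-hom ts (units _))))
    (cong₂ _∷_ (ℕₚ.+-identityʳ t) (trans (V.identityˡ _) (sym (unit-expansion ts)))))

∘-affine : ∀ {X m n} {f : Vec ℕ n → Car X} {g : Vec ℕ m → Vec ℕ n} →
           Affine X f → Affine (Vecᴹ n) g → Affine X (f ∘ g)
∘-affine {X} {f = f} {g} F G = record
  { base = f (base G) ; periods = map (λ q → X.lin q (periods F)) (periods G)
  ; expand = λ t → trans (cong f (expand G t)) (trans (expand+ F _ _)
      (cong (f (base G) X.∙_) (hom-lin (lin-hom X (periods F)) t (periods G)))) }
  where module X = Mon X

lift-affine : ∀ {X n h} → Hom (Vecᴹ n) X h → Affine X h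
lift-affine H = hom-affine H id-affine

-- Preservation of affineness replaces `Hom` where a map may have a constant part, such as inserting
-- a fixed value into a coordinate.
Lin : (X Y : Mon) → (Car X → Car Y) → Set
Lin X Y h = ∀ {n} {f : Vec ℕ n → Car X} → Affine X f → Affine Y (h ∘ f)

-- Semilinear sets

data SL {n : ℕ} (φ : Vec ℕ n → Set) : Set₁ where
  none : (∀ t → ¬ φ t) → SL φ
  one  : ∀ {m} {g : Vec ℕ m → Vec ℕ n} → Affine (Vecᴹ n) g →
         (∀ s → φ (g s)) → (∀ t → φ t → ∃[ s ] g s ≡ t) → SL φ
  or   : ∀ {φ₁ φ₂ : Vec ℕ n → Set} → SL φ₁ → SL φ₂ →
         (∀ t → φ₁ t → φ t) → (∀ t → φ₂ t → φ t) → (∀ t → φ t → φ₁ t ⊎ φ₂ t) → SL φ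

SL-resp : ∀ {n} {φ ψ : Vec ℕ n → Set} → (∀ t → φ t → ψ t) → (∀ t → ψ t → φ t) → SL φ → SL ψ
SL-resp to from (none e)          = none (λ t → e t ∘ from t)
SL-resp to from (one G snd cmp)   = one G (λ s → to _ (snd s)) (λ t → cmp t ∘ from t)
SL-resp to from (or a b i₁ i₂ c)  = or a b (λ t → to t ∘ i₁ t) (λ t → to t ∘ i₂ t) (λ t → c t ∘ from t)

-- The continuation sees only affine parametrizations of `φ`, on which a further constraint is again
-- a statement about affine maps. In this way conditions are imposed one after the other.
SL-bind : ∀ {m n} {φ : Vec ℕ m → Set} (ψ : Vec ℕ m → Vec ℕ n → Set) → SL φ →
          (∀ {k} {g : Vec ℕ k → Vec ℕ m} → Affine (Vecᴹ m) g → (∀ s → φ (g s)) →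
             SL (λ u → ∃[ s ] ψ (g s) u)) →
          SL (λ u → ∃[ t ] (φ t × ψ t u))
SL-bind ψ (none e) k = none (λ { u (t , p , _) → e t p })
SL-bind ψ (one G snd cmp) k = SL-resp
  (λ { u (s , q) → _ , snd s , q })
  (λ { u (t , p , q) → case cmp t p of λ { (s , refl) → s , q } }) (k G snd)
SL-bind ψ (or a b i₁ i₂ c) k = or
  (SL-bind ψ a (λ G snd → k G (λ s → i₁ _ (snd s)))) (SL-bind ψ b (λ G snd → k G (λ s → i₂ _ (snd s))))
  (λ { u (t , p , q) → t , i₁ t p , q }) (λ { u (t , p , q) → t , i₂ t p , q })
  (λ { u (t , p , q) → case c t p of λ { (inj₁ p₁) → inj₁ (t , p₁ , q) ; (inj₂ p₂) → inj₂ (t , p₂ , q) } })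

SL-image : ∀ {m n} {φ : Vec ℕ m → Set} {γ : Vec ℕ m → Vec ℕ n} → Affine (Vecᴹ n) γ → SL φ →
           SL (λ u → ∃[ t ] (φ t × γ t ≡ u))
SL-image {γ = γ} Γ a = SL-bind (λ t u → γ t ≡ u) a
  (λ G snd → one (∘-affine Γ G) (λ s → s , refl) (λ u p → p))

SL-all : ∀ {n} {φ : Vec ℕ n → Set} → (∀ t → φ t) → SL φ
SL-all p = one id-affine p (λ t _ → t , refl)

SL-∃< : ∀ {n} {φ : ℕ → Vec ℕ n → Set} K → (∀ k → SL (φ k)) → SL (λ t → ∃[ k ] (k < K × φ k t))
SL-∃< zero    a = none (λ { t (k , () , _) })
SL-∃< (suc K) a = or (SL-∃< K a) (a K)
  (λ { t (k , k<K , p) → k , ℕₚ.m<n⇒m<1+n k<K , p }) (λ t p → K , ℕₚ.≤-refl , p)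
  (λ { t (k , s≤s k≤K , p) → case ℕₚ.m≤n⇒m<n∨m≡n k≤K of
         λ { (inj₁ k<K) → inj₁ (k , k<K , p) ; (inj₂ refl) → inj₂ p } })

-- With natural coefficients, a zero coefficient leaves its variable free and a positive one bounds
-- its variable by `k`, so finitely many values can be tried.
level-SL : ∀ {n} (p : Vec ℕ n) k → SL (λ t → Mon.lin ℕᴹ t p ≡ k)
level-SL [] zero    = SL-all (λ { [] → refl })
level-SL [] (suc k) = none (λ { [] () })
level-SL (zero ∷ p) k = SL-resp
  (λ { u (t , q , x , refl) → trans (cong (_+ _) (Mon.·-zeroʳ ℕᴹ x)) q })
  (λ { (x ∷ t) q → t , trans (cong (_+ _) (sym (Mon.·-zeroʳ ℕᴹ x))) q , x , refl })
  (SL-bind (λ t u → ∃[ x ] u ≡ x ∷ t) (level-SL p k)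
    (λ {_} {g} G snd → one (hom-affine ∷-hom (pair-affine (lift-affine head-hom) (∘-affine G (lift-affine tail-hom))))
      (λ s → Vec.tail s , Vec.head s , refl)
      (λ { u (s , x , refl) → x ∷ s , refl })))
level-SL (suc a ∷ p) k = SL-resp
  (λ { u (x , _ , t , (q , le) , refl) → trans (cong (_+_ (x ·ℕ suc a)) q) (ℕₚ.m+[n∸m]≡n le) })
  (λ { (x ∷ t) q → x , s≤s (≤k x t q) , t
                 , (trans (sym (ℕₚ.m+n∸m≡n (x ·ℕ suc a) _)) (cong (_∸ x ·ℕ suc a) q)
                   , ℕₚ.≤-trans (ℕₚ.m≤m+n _ _) (ℕₚ.≤-reflexive q)) , refl })
  (SL-∃< (suc k) slice)
  where
  infixr 7 _·ℕ_
  _·ℕ_ = Mon._·_ ℕᴹ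
  x≤x·suc : ∀ x → x ≤ x ·ℕ suc a
  x≤x·suc zero    = z≤n
  x≤x·suc (suc x) = s≤s (ℕₚ.≤-trans (x≤x·suc x) (ℕₚ.m≤n+m _ a))
  ≤k : ∀ x t → Mon.lin ℕᴹ (x ∷ t) (suc a ∷ p) ≡ k → x ≤ k
  ≤k x t q = ℕₚ.≤-trans (x≤x·suc x) (ℕₚ.≤-trans (ℕₚ.m≤m+n _ _) (ℕₚ.≤-reflexive q))
  -- The inequality is part of the slice because `k ∸ x ·ℕ suc a` truncates to 0 when `x` is too
  -- large.
  slice : ∀ x → SL (λ u → ∃[ t ] ((Mon.lin ℕᴹ t p ≡ k ∸ x ·ℕ suc a × x ·ℕ suc a ≤ k) × x ∷ t ≡ u))
  slice x with x ·ℕ suc a ℕₚ.≤? k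
  ... | no ¬le = none (λ { u (t , (_ , le) , _) → ¬le le })
  ... | yes le = SL-image (hom-affine ∷-hom (pair-affine (const-affine ℕᴹ x) id-affine))
                   (SL-resp (λ t q → q , le) (λ t → proj₁) (level-SL p (k ∸ x ·ℕ suc a)))

-- Elliott's algorithm for one linear Diophantine equation: for coefficients dᵢ = M > 0 and dⱼ < 0,
-- substitute tᵢ := tᵢ + tⱼ or tⱼ := tⱼ + tᵢ, which replaces dⱼ, resp. dᵢ, by dᵢ + dⱼ.

module Elliott where

  dot : ∀ {n} → Vec ℤ n → Vec ℕ n → ℤ
  dot []      []       = + 0
  dot (x ∷ d) (t ∷ ts) = + t ℤ.* x ℤ.+ dot d ts

  dot-+ : ∀ {n} (d : Vec ℤ n) t u → dot d (t +ᵛ u) ≡ dot d t ℤ.+ dot d u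
  dot-+ []      []       []       = refl
  dot-+ (x ∷ d) (t ∷ ts) (u ∷ us) rewrite dot-+ d ts us | ℤₚ.pos-+ t u =
    rearrange (+ t) (+ u) x (dot d ts) (dot d us)
    where
    rearrange : ∀ t u x a b → (t ℤ.+ u) ℤ.* x ℤ.+ (a ℤ.+ b) ≡ t ℤ.* x ℤ.+ a ℤ.+ (u ℤ.* x ℤ.+ b)
    rearrange = ℤ-Solver.solve-∀

  dot-0 : ∀ {n} (d : Vec ℤ n) → dot d 0ᵛ ≡ + 0
  dot-0 []      = refl
  dot-0 (x ∷ d) = trans (cong (ℤ._+ dot d 0ᵛ) (ℤₚ.*-zeroˡ x)) (trans (ℤₚ.+-identityˡ _) (dot-0 d))

  dot-neg : ∀ {n} (d : Vec ℤ n) t → dot (map ℤ.-_ d) t ≡ ℤ.- dot d t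
  dot-neg []      []       = refl
  dot-neg (x ∷ d) (t ∷ ts) = trans (cong (ℤ._+_ (+ t ℤ.* (ℤ.- x))) (dot-neg d ts)) (rearrange (+ t) x (dot d ts))
    where
    rearrange : ∀ t x a → t ℤ.* (ℤ.- x) ℤ.+ ℤ.- a ≡ ℤ.- (t ℤ.* x ℤ.+ a)
    rearrange = ℤ-Solver.solve-∀

  at : ∀ {n} → Fin n → ℕ → Vec ℕ n
  at i x = 0ᵛ [ i ]≔ x

  at-hom : ∀ {n} (i : Fin n) → Hom ℕᴹ (Vecᴹ n) (at i)
  at-hom i = record { hom-ε = e i ; hom-∙ = a i }
    where
    e : ∀ {n} (i : Fin n) → at i 0 ≡ 0ᵛ
    e zero    = refl
    e (suc i) = cong (0 ∷_) (e i)
    a : ∀ {n} (i : Fin n) x y → at i (x + y) ≡ at i x +ᵛ at i y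
    a zero    x y = cong (_ ∷_) (sym (V.identityˡ _))
    a (suc i) x y = cong (0 ∷_) (a i x y)

  dot-at : ∀ {n} (d : Vec ℤ n) i x → dot d (at i x) ≡ + x ℤ.* lookup d i
  dot-at (y ∷ d) zero    x = trans (cong (ℤ._+_ (+ x ℤ.* y)) (dot-0 d)) (ℤₚ.+-identityʳ _)
  dot-at (y ∷ d) (suc i) x =
    trans (cong (ℤ._+ dot d (at i x)) (ℤₚ.*-zeroˡ y)) (trans (ℤₚ.+-identityˡ _) (dot-at d i x))

  dot-update : ∀ {n} (d : Vec ℤ n) j x t →
               dot (d [ j ]≔ (x ℤ.+ lookup d j)) t ≡ dot d t ℤ.+ + lookup t j ℤ.* x
  dot-update (y ∷ d) zero x (t ∷ ts) = rearrange (+ t) x y (dot d ts)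
    where
    rearrange : ∀ t x y a → t ℤ.* (x ℤ.+ y) ℤ.+ a ≡ t ℤ.* y ℤ.+ a ℤ.+ t ℤ.* x
    rearrange = ℤ-Solver.solve-∀
  dot-update (y ∷ d) (suc j) x (t ∷ ts) =
    trans (cong (ℤ._+_ (+ t ℤ.* y)) (dot-update d j x ts)) (sym (ℤₚ.+-assoc (+ t ℤ.* y) (dot d ts) _))

  transfer : ∀ {n} → Fin n → Fin n → Vec ℕ n → Vec ℕ n
  transfer i j t = t +ᵛ at i (lookup t j)

  dot-transfer : ∀ {n} (d : Vec ℤ n) i j t →
                 dot d (transfer i j t) ≡ dot (d [ j ]≔ (lookup d i ℤ.+ lookup d j)) t
  dot-transfer d i j t = trans (dot-+ d t _) (trans (cong (ℤ._+_ (dot d t)) (dot-at d i (lookup t j)))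
    (sym (dot-update d j (lookup d i) t)))

  transfer-affine : ∀ {n} (i j : Fin n) → Affine (Vecᴹ n) (transfer i j)
  transfer-affine i j = ∙-affine (Vecᴹ _) id-affine (hom-affine (at-hom i) (lift-affine (lookup-hom j)))

  transfer-surjective : ∀ {n} (i j : Fin n) → i ≢ j → ∀ t → lookup t j ≤ lookup t i →
                        ∃[ u ] transfer i j u ≡ t
  transfer-surjective i j i≢j t le = u , trans (cong (λ y → u +ᵛ at i y) uⱼ) (restore i t (lookup t j) le)
    where
    u = t [ i ]≔ (lookup t i ∸ lookup t j)
    uⱼ : lookup u j ≡ lookup t j
    uⱼ = Vecₚ.lookup∘updateAt′ j i (i≢j ∘ sym) t
    restore : ∀ {n} (i : Fin n) t x → x ≤ lookup t i → (t [ i ]≔ (lookup t i ∸ x)) +ᵛ at i x ≡ t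
    restore zero    (y ∷ t) x le = cong₂ _∷_ (ℕₚ.m∸n+n≡m le) (V.identityʳ t)
    restore (suc i) (y ∷ t) x le = cong₂ _∷_ (ℕₚ.+-identityʳ y) (restore i t x le)

  -- The interval from -`L` to `M`: as `-[1+ n ]` denotes -(n + 1), the inequality for it is strict.
  Between : ℕ → ℕ → ℤ → Set
  Between L M (+ n)    = n ≤ M
  Between L M -[1+ n ] = n < L

  neg-between : ∀ {L M} x → Between L M x → Between M L (ℤ.- x)
  neg-between (+ zero)  b = z≤n
  neg-between (+ suc n) b = b
  neg-between -[1+ n ]  b = b

  -- Weight 1 marks the coefficients that a substitution step can eliminate.
  weight : ℕ → ℤ → ℕ
  weight M -[1+ n ] = 1
  weight M (+ n) with n ℕₚ.≟ M
  ... | yes _ = 1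
  ... | no  _ = 0

  weight-max : ∀ M → weight M (+ M) ≡ 1
  weight-max M with M ℕₚ.≟ M
  ... | yes _ = refl
  ... | no ¬p = ⊥-elim (¬p refl)

  weight-< : ∀ {n M} → n < M → weight M (+ n) ≡ 0
  weight-< {n} {M} n<M with n ℕₚ.≟ M
  ... | yes refl = ⊥-elim (ℕₚ.<-irrefl refl n<M)
  ... | no _     = refl

  total-weight : ∀ {n} → ℕ → Vec ℤ n → ℕ
  total-weight M []      = 0
  total-weight M (x ∷ d) = weight M x + total-weight M d

  total-weight-update : ∀ {n} M (d : Vec ℤ n) i x → weight M (lookup d i) ≡ 1 → weight M x ≡ 0 →
                 suc (total-weight M (d [ i ]≔ x)) ≡ total-weight M d
  total-weight-update M (y ∷ d) zero    x p q rewrite p | q = refl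
  total-weight-update M (y ∷ d) (suc i) x p q =
    trans (sym (ℕₚ.+-suc (weight M y) _)) (cong (_+_ (weight M y)) (total-weight-update M d i x p q))

  ≔-all : ∀ {n} (P : ℤ → Set) (d : Vec ℤ n) i x → (∀ k → P (lookup d k)) → P x → ∀ k → P (lookup (d [ i ]≔ x) k)
  ≔-all P d i x all px k with k Finₚ.≟ i
  ... | yes refl = subst P (sym (Vecₚ.lookup∘updateAt i d)) px
  ... | no k≢i   = subst P (sym (Vecₚ.lookup∘updateAt′ k i k≢i d)) (all k)

  IsNegative : ℤ → Set
  IsNegative x = ∃[ b ] x ≡ -[1+ b ]

  isNegative? : ∀ x → Dec (IsNegative x)
  isNegative? (+ n)    = no λ ()
  isNegative? -[1+ n ] = yes (n , refl)

  absolute : ∀ {n} (d : Vec ℤ n) → (∀ i → ¬ IsNegative (lookup d i)) → ∃[ p ] (∀ t → dot d t ≡ + Mon.lin ℕᴹ t p)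
  absolute [] h = [] , λ { [] → refl }
  absolute (-[1+ b ] ∷ d) h = ⊥-elim (h zero (b , refl))
  absolute (+ a ∷ d) h with absolute d (h ∘ suc)
  ... | p , eq = a ∷ p , λ { (t ∷ ts) → cong₂ ℤ._+_ (trans (sym (ℤₚ.pos-* t a)) (cong +_ (sym (multiple t)))) (eq ts) }
    where
    multiple : ∀ t → Mon._·_ ℕᴹ t a ≡ t * a
    multiple zero    = refl
    multiple (suc t) = cong (_+_ a) (multiple t)

  nonneg-SL : ∀ {n} (d : Vec ℤ n) e → (∀ i → ¬ IsNegative (lookup d i)) → SL (λ t → dot d t ≡ e)
  nonneg-SL d e h with absolute d h | e
  ... | p , eq | + k      = SL-resp (λ t q → trans (eq t) (cong +_ q))
                                    (λ t q → ℤₚ.+-injective (trans (sym (eq t)) q)) (level-SL p k)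
  ... | p , eq | -[1+ k ] = none (λ t q → case trans (sym (eq t)) q of λ ())

  -- Lexicographic induction on the bounds `s` for `L + M` and `c` for the total weight. Since
  -- `L ≤ M`, the sum of a coefficient `M` and a negative one lies between 0 and M - 1 and has
  -- weight 0, so each substitution lowers `c`; once no coefficient equals `M`, the bound `M` itself
  -- drops by one.
  elliott : ∀ s c {n} L M → L + M ≤ s → L ≤ M → (d : Vec ℤ n) → total-weight M d ≤ c →
            (∀ i → Between L M (lookup d i)) → ∀ e → SL (λ t → dot d t ≡ e)

  lower : ∀ s {n} L M → L + suc M ≤ s → L ≤ suc M → (d : Vec ℤ n) →
          (∀ i → Between L M (lookup d i)) → ∀ e → SL (λ t → dot d t ≡ e)
  lower zero L M bd L≤M d btw e = case subst (_≤ 0) (ℕₚ.+-suc L M) bd of λ ()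
  lower (suc s) L M bd L≤M d btw e with L ℕₚ.≤? M
  ... | yes L≤M′ = elliott s (total-weight M d) L M (ℕₚ.≤-pred (subst (_≤ suc s) (ℕₚ.+-suc L M) bd)) L≤M′ d ℕₚ.≤-refl btw e
  -- Only the case that `L` equals `suc M` is left. Negating the equation moves the larger bound to
  -- the positive side, which restores the invariant.
  ... | no L≰M = SL-resp
      (λ t q → ℤₚ.neg-injective (trans (sym (dot-neg d t)) q))
      (λ t q → trans (dot-neg d t) (cong ℤ.-_ q))
      (elliott s (total-weight L (map ℤ.-_ d)) M L bd′ (ℕₚ.<⇒≤ (ℕₚ.≰⇒> L≰M)) (map ℤ.-_ d) ℕₚ.≤-refl
        (λ i → subst (Between M L) (sym (Vecₚ.lookup-map i ℤ.-_ d)) (neg-between (lookup d i) (btw i))) (ℤ.- e))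
    where
    bd′ : M + L ≤ s
    bd′ = subst (_≤ s) (ℕₚ.+-comm L M) (ℕₚ.≤-pred (subst (_≤ suc s) (ℕₚ.+-suc L M) bd))

  elliott s c L M bd L≤M d tot btw e with Finₚ.any? (λ i → isNegative? (lookup d i))
  ... | no ¬neg = nonneg-SL d e (λ i p → ¬neg (i , p))
  elliott s c .zero zero bd z≤n d tot btw e | yes (j , b , eq) with subst (Between 0 0) eq (btw j)
  ... | ()
  elliott s c L (suc M) bd L≤M d tot btw e | yes (j , b , dⱼ)
    with Finₚ.any? (λ i → lookup d i ℤₚ.≟ + suc M)
  ... | no ¬max = lower s L M bd L≤M d (λ i → shrink (lookup d i) (btw i) (λ q → ¬max (i , q))) e
    where
    shrink : ∀ x → Between L (suc M) x → x ≢ + suc M → Between L M x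
    shrink (+ n)    p q = ℕₚ.≤-pred (ℕₚ.≤∧≢⇒< p (λ r → q (cong +_ r)))
    shrink -[1+ n ] p q = p
  elliott s zero L (suc M) bd L≤M d tot btw e | yes (j , b , dⱼ) | yes (i , dᵢ) =
    case ℕₚ.≤-trans (ℕₚ.≤-reflexive (total-weight-update (suc M) d i (+ 0)
      (trans (cong (weight (suc M)) dᵢ) (weight-max (suc M))) (weight-< {M = suc M} (s≤s z≤n)))) tot of λ ()
  elliott s (suc c) L (suc M) bd L≤M d tot btw e | yes (j , b , dⱼ) | yes (i , dᵢ) = or
    (SL-image (transfer-affine i j) (eliminate j weight-j))
    (SL-image (transfer-affine j i) (SL-resp
      (λ t q → trans (cong (λ x → dot (d [ i ]≔ x) t) (ℤₚ.+-comm (lookup d j) (lookup d i))) q)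
      (λ t q → trans (cong (λ x → dot (d [ i ]≔ x) t) (ℤₚ.+-comm (lookup d i) (lookup d j))) q) (eliminate i weight-i)))
    (λ { u (t , q , refl) → trans (dot-transfer d i j t) q })
    (λ { u (t , q , refl) → trans (dot-transfer d j i t) q })
    split
    where
    x = lookup d i ℤ.+ lookup d j
    x≡ : x ≡ + (M ∸ b)
    x≡ = trans (cong₂ ℤ._+_ dᵢ dⱼ) (trans (ℤₚ.[1+m]⊖[1+n]≡m⊖n M b) (ℤₚ.⊖-≥ b≤M))
      where
      b≤M : b ≤ M
      b≤M = ℕₚ.≤-pred (ℕₚ.≤-trans (subst (Between L (suc M)) dⱼ (btw j)) L≤M)
    btw-x : Between L (suc M) x
    btw-x = subst (Between L (suc M)) (sym x≡) (ℕₚ.m≤n⇒m≤1+n (ℕₚ.m∸n≤m M b))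
    weight-x : weight (suc M) x ≡ 0
    weight-x = trans (cong (weight (suc M)) x≡) (weight-< (s≤s (ℕₚ.m∸n≤m M b)))
    weight-i : weight (suc M) (lookup d i) ≡ 1
    weight-i = trans (cong (weight (suc M)) dᵢ) (weight-max (suc M))
    weight-j : weight (suc M) (lookup d j) ≡ 1
    weight-j = cong (weight (suc M)) dⱼ
    eliminate : ∀ k → weight (suc M) (lookup d k) ≡ 1 → SL (λ t → dot (d [ k ]≔ x) t ≡ e)
    eliminate k w = elliott s c L (suc M) bd L≤M (d [ k ]≔ x)
      (ℕₚ.≤-pred (ℕₚ.≤-trans (ℕₚ.≤-reflexive (total-weight-update (suc M) d k x w weight-x)) tot))
      (≔-all (Between L (suc M)) d k x btw btw-x) e
    i≢j : i ≢ j
    i≢j refl = case trans (sym dᵢ) dⱼ of λ ()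
    -- The larger of the two entries is the smaller one plus a remainder, so every solution lies in
    -- the image of one of the transfers.
    split : ∀ u → dot d u ≡ e → _
    split u q with ℕₚ.≤-total (lookup u j) (lookup u i)
    ... | inj₁ le = case transfer-surjective i j i≢j u le of
                      λ { (t , refl) → inj₁ (t , trans (sym (dot-transfer d i j t)) q , refl) }
    ... | inj₂ le = case transfer-surjective j i (i≢j ∘ sym) u le of
                      λ { (t , refl) → inj₂ (t , trans (sym (dot-transfer d j i t)) q , refl) }

-- Monoids in which linear equations have semilinear solution sets

record Space : Set₁ where
  field
    mon   : Mon
    solve : ∀ {n} {f g : Vec ℕ n → Car mon} → Affine mon f → Affine mon g → SL (λ t → f t ≡ g t)
  open Mon mon public

open Space using (mon; solve)

ℕˢ : Space
ℕˢ = record { mon = ℕᴹ ; solve = λ F G → solve-ℕ F G }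
  where
  open Elliott using (dot; Between; total-weight; elliott)
  differences : ∀ {n} (p q : Vec ℕ n) → ∃[ d ] (∀ t → dot d t ≡ + Mon.lin ℕᴹ t p ℤ.- + Mon.lin ℕᴹ t q)
  differences [] [] = [] , λ { [] → refl }
  differences (a ∷ p) (b ∷ q) with differences p q
  ... | d , eq = (+ a ℤ.- + b) ∷ d , λ { (t ∷ ts) → trans (cong (ℤ._+_ (+ t ℤ.* (+ a ℤ.- + b))) (eq ts)) (trans
      (rearrange (+ t) (+ a) (+ b) (+ Mon.lin ℕᴹ ts p) (+ Mon.lin ℕᴹ ts q))
      (cong₂ (λ x y → x ℤ.- y) (combine t a (Mon.lin ℕᴹ ts p)) (combine t b (Mon.lin ℕᴹ ts q)))) }
    where
    rearrange : ∀ t a b x y → t ℤ.* (a ℤ.- b) ℤ.+ (x ℤ.- y) ≡ (t ℤ.* a ℤ.+ x) ℤ.- (t ℤ.* b ℤ.+ y)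
    rearrange = ℤ-Solver.solve-∀
    multiple : ∀ t a → t * a ≡ Mon._·_ ℕᴹ t a
    multiple zero    a = refl
    multiple (suc t) a = cong (_+_ a) (multiple t a)
    combine : ∀ t a x → + t ℤ.* + a ℤ.+ + x ≡ + (Mon._·_ ℕᴹ t a + x)
    combine t a x = trans (cong (ℤ._+ + x) (trans (sym (ℤₚ.pos-* t a)) (cong +_ (multiple t a)))) (sym (ℤₚ.pos-+ _ x))

  bounds : ∀ {n} (d : Vec ℤ n) → ∃[ B ] (∀ i → Between B B (lookup d i))
  bounds [] = 0 , λ ()
  bounds (x ∷ d) with bounds d
  ... | B , btw = B + ℤ.∣ x ∣ , λ { zero → self x ; (suc i) → widen (lookup d i) (btw i) }
    where
    self : ∀ x → Between (B + ℤ.∣ x ∣) (B + ℤ.∣ x ∣) x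
    self (+ n)    = ℕₚ.m≤n+m n B
    self -[1+ n ] = ℕₚ.m≤n+m (suc n) B
    widen : ∀ y → Between B B y → Between (B + ℤ.∣ x ∣) (B + ℤ.∣ x ∣) y
    widen (+ n)    p = ℕₚ.≤-trans p (ℕₚ.m≤m+n _ _)
    widen -[1+ n ] p = ℕₚ.≤-trans p (ℕₚ.m≤m+n _ _)

  move : ∀ a b x y → a ℤ.+ x ≡ b ℤ.+ y → x ℤ.- y ≡ b ℤ.- a
  move a b x y eq = trans (lhs a x y) (trans (cong (λ z → z ℤ.- (a ℤ.+ y)) eq) (rhs a b y))
    where
    lhs : ∀ a x y → x ℤ.- y ≡ (a ℤ.+ x) ℤ.- (a ℤ.+ y)
    lhs = ℤ-Solver.solve-∀
    rhs : ∀ a b y → (b ℤ.+ y) ℤ.- (a ℤ.+ y) ≡ b ℤ.- a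
    rhs = ℤ-Solver.solve-∀

  unmove : ∀ a b x y → x ℤ.- y ≡ b ℤ.- a → a ℤ.+ x ≡ b ℤ.+ y
  unmove a b x y eq = trans (lhs a x y) (trans (cong (λ z → z ℤ.+ (a ℤ.+ y)) eq) (rhs a b y))
    where
    lhs : ∀ a x y → a ℤ.+ x ≡ (x ℤ.- y) ℤ.+ (a ℤ.+ y)
    lhs = ℤ-Solver.solve-∀
    rhs : ∀ a b y → (b ℤ.- a) ℤ.+ (a ℤ.+ y) ≡ b ℤ.+ y
    rhs = ℤ-Solver.solve-∀

  solve-ℕ : ∀ {n} {f g : Vec ℕ n → ℕ} → Affine ℕᴹ f → Affine ℕᴹ g → SL (λ t → f t ≡ g t)
  solve-ℕ {f = f} {g} F G with differences (Affine.periods F) (Affine.periods G)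
  ... | d , eq with bounds d
  ...   | B , btw = SL-resp
    (λ t q → trans (Affine.expand F t) (trans (ℤₚ.+-injective (trans (ℤₚ.pos-+ a (P t))
        (trans (unmove (+ a) (+ b) (+ P t) (+ Q t) (trans (sym (eq t)) q)) (sym (ℤₚ.pos-+ b (Q t))))))
      (sym (Affine.expand G t))))
    (λ t q → trans (eq t) (move (+ a) (+ b) (+ P t) (+ Q t) (trans (sym (ℤₚ.pos-+ a (P t)))
        (trans (cong +_ (trans (sym (Affine.expand F t)) (trans q (Affine.expand G t)))) (ℤₚ.pos-+ b _)))))
    (elliott (B + B) (total-weight B d) B B ℕₚ.≤-refl ℕₚ.≤-refl d ℕₚ.≤-refl btw (+ b ℤ.- + a))
    where
    a = Affine.base F
    b = Affine.base G
    P = λ t → Mon.lin ℕᴹ t (Affine.periods F)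
    Q = λ t → Mon.lin ℕᴹ t (Affine.periods G)

⊤ˢ : Space
⊤ˢ = record { mon = ⊤ᴹ ; solve = λ _ _ → SL-all (λ _ → refl) }

SL-∩-solve : ∀ (Y : Space) {n} {φ : Vec ℕ n → Set} {f g : Vec ℕ n → Car (mon Y)} → SL φ →
             Affine (mon Y) f → Affine (mon Y) g → SL (λ t → φ t × f t ≡ g t)
SL-∩-solve Y {φ = φ} {f} {g} a F G = SL-resp
  (λ { u (t , p , refl , q) → p , q }) (λ { u (p , q) → u , p , refl , q })
  (SL-bind (λ t u → t ≡ u × f u ≡ g u) a (λ H snd → SL-resp
    (λ { u (s , q , refl) → s , refl , q }) (λ { u (s , refl , q) → s , q , refl })
    (SL-image H (solve Y (∘-affine F H) (∘-affine G H)))))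

infixr 4 _×ˢ_
_×ˢ_ : Space → Space → Space
X ×ˢ Y = record
  { mon = mon X ×ᴹ mon Y
  ; solve = λ F G → SL-resp (λ t (p , q) → cong₂ _,_ p q) (λ t eq → cong proj₁ eq , cong proj₂ eq)
      (SL-∩-solve Y (solve X (hom-affine (proj₁-hom (mon X) (mon Y)) F) (hom-affine (proj₁-hom (mon X) (mon Y)) G))
        (hom-affine (proj₂-hom (mon X) (mon Y)) F) (hom-affine (proj₂-hom (mon X) (mon Y)) G)) }

Vecˢ : ℕ → Space
Vecˢ n = record { mon = Vecᴹ n ; solve = solve-Vec n }
  where
  η : ∀ {n} {u v : Vec ℕ (suc n)} → Vec.head u ≡ Vec.head v → Vec.tail u ≡ Vec.tail v → u ≡ v
  η {u = _ ∷ _} {_ ∷ _} p q = cong₂ _∷_ p q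
  solve-Vec : ∀ n {m} {f g : Vec ℕ m → Vec ℕ n} → Affine (Vecᴹ n) f → Affine (Vecᴹ n) g → SL (λ t → f t ≡ g t)
  solve-Vec zero    {f = f} {g} F G = SL-all (λ t → []≡)
    where
    []≡ : ∀ {u v : Vec ℕ 0} → u ≡ v
    []≡ {[]} {[]} = refl
  solve-Vec (suc n) F G = SL-resp (λ t (p , q) → η q p) (λ t eq → cong Vec.tail eq , cong Vec.head eq)
    (SL-∩-solve ℕˢ (solve-Vec n (hom-affine tail-hom F) (hom-affine tail-hom G))
      (hom-affine head-hom F) (hom-affine head-hom G))

-- Good sets

Positive : ∀ {n} → Vec ℕ n → Set
Positive w = ∀ i → 1 ≤ lookup w i

Eventually : (ℕ → Set) → Set
Eventually P = ∃[ K ] (∀ k → K ≤ k → P k)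

eventually-∧ : ∀ {P Q : ℕ → Set} → Eventually P → Eventually Q → Eventually (λ k → P k × Q k)
eventually-∧ (K , p) (L , q) =
  K ⊔ L , λ k le → p k (ℕₚ.≤-trans (ℕₚ.m≤m⊔n K L) le) , q k (ℕₚ.≤-trans (ℕₚ.m≤n⊔m K L) le)

-- Rays may start at any `x`, not only at 0; this makes the notion stable under translations and
-- under preimages along affine maps that keep directions positive.
Full : ∀ {n} → (Vec ℕ n → Set) → Set
Full T = ∀ x w → Positive w → Eventually (λ k → T (x +ᵛ k ·ᵛ w))

-- That the slices are Good again is part of the definition, to allow induction over the trees.
mutual
  data Tree (n : ℕ) (T : Vec ℕ n → Set) : Set₁ where
    node : T 0ᵛ → Full T → (∀ p k → Good (Vecᴹ n) (λ t → T t × lookup t p ≡ k)) → Tree n T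

  data Good (X : Mon) (R : Car X → Set) : Set₁ where
    empty : (∀ x → ¬ R x) → Good X R
    piece : ∀ {n} {T : Vec ℕ n → Set} {f : Vec ℕ n → Car X} → Tree n T → Affine X f →
            (∀ t → T t → R (f t)) → (∀ x → R x → ∃[ t ] (T t × f t ≡ x)) → Good X R
    union : ∀ {R₁ R₂ : Car X → Set} → Good X R₁ → Good X R₂ →
            (∀ x → R₁ x → R x) → (∀ x → R₂ x → R x) → (∀ x → R x → R₁ x ⊎ R₂ x) → Good X R

Good-resp : ∀ {X} {R S : Car X → Set} → (∀ x → R x → S x) → (∀ x → S x → R x) → Good X R → Good X S
Good-resp to from (empty e)         = empty (λ x → e x ∘ from x)
Good-resp to from (piece t F s c)   = piece t F (λ t p → to _ (s t p)) (λ x → c x ∘ from x)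
Good-resp to from (union a b i j c) = union a b (λ x → to x ∘ i x) (λ x → to x ∘ j x) (λ x → c x ∘ from x)

Good-image : ∀ {X Y h} {R : Car X → Set} → Lin X Y h → Good X R → Good Y (λ y → ∃[ x ] (R x × h x ≡ y))
Good-image H (empty e) = empty (λ { y (x , p , _) → e x p })
Good-image {h = h} H (piece t F s c) = piece t (H F) (λ t p → _ , s t p , refl)
  (λ { y (x , p , refl) → case c x p of λ { (t , q , refl) → t , q , refl } })
Good-image H (union a b i j c) = union (Good-image H a) (Good-image H b)
  (λ { y (x , p , q) → x , i x p , q }) (λ { y (x , p , q) → x , j x p , q })
  (λ { y (x , p , q) → case c x p of λ { (inj₁ p₁) → inj₁ (x , p₁ , q) ; (inj₂ p₂) → inj₂ (x , p₂ , q) } })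

Good-map : ∀ {X Y h} {R : Car X → Set} {S : Car Y → Set} → Lin X Y h → (∀ x → R x → S (h x)) →
           (∀ y → S y → ∃[ x ] (R x × h x ≡ y)) → Good X R → Good Y S
Good-map H to from a = Good-resp (λ { y (x , p , refl) → to x p }) from (Good-image H a)

Good-∪ : ∀ {X} {R S : Car X → Set} → Good X R → Good X S → Good X (λ x → R x ⊎ S x)
Good-∪ a b = union a b (λ _ → inj₁) (λ _ → inj₂) (λ _ p → p)

Good-∃< : ∀ {X} {R : ℕ → Car X → Set} K → (∀ k → Good X (R k)) → Good X (λ x → ∃[ k ] (k < K × R k x))
Good-∃< zero    a = empty (λ { x (k , () , _) })
Good-∃< (suc K) a = union (Good-∃< K a) (a K)
  (λ { x (k , k<K , p) → k , ℕₚ.m<n⇒m<1+n k<K , p }) (λ x p → K , ℕₚ.≤-refl , p)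
  (λ { x (k , s≤s k≤K , p) → case ℕₚ.m≤n⇒m<n∨m≡n k≤K of
         λ { (inj₁ k<K) → inj₁ (k , k<K , p) ; (inj₂ refl) → inj₂ p } })

Good-∃Fin : ∀ {X n} {R : Fin n → Car X → Set} → (∀ i → Good X (R i)) → Good X (λ x → ∃[ i ] R i x)
Good-∃Fin {n = zero}  a = empty (λ { x (() , _) })
Good-∃Fin {n = suc n} a = union (a zero) (Good-∃Fin (a ∘ suc))
  (λ x p → zero , p) (λ { x (i , p) → suc i , p })
  (λ { x (zero , p) → inj₁ p ; x (suc i , p) → inj₂ (i , p) })

-- Decidable because every piece contains its base point. The existence of a pump will be decided in
-- this way.
inhabited? : ∀ {X} {R : Car X → Set} → Good X R → (∃[ x ] R x) ⊎ (∀ x → ¬ R x)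
inhabited? (empty e)                     = inj₂ e
inhabited? (piece (node z _ _) F s c)    = inj₁ (_ , s _ z)
inhabited? (union a b i j c) with inhabited? a | inhabited? b
... | inj₁ (x , p) | _            = inj₁ (x , i x p)
... | inj₂ _       | inj₁ (x , p) = inj₁ (x , j x p)
... | inj₂ e       | inj₂ e′      = inj₂ (λ x p → [ e x , e′ x ]′ (c x p))

-- The base points of the pieces are minimal elements, so finitely many bounds suffice.
uniform-bound : ∀ {X} {R : Car X → Set} (P : Car X → ℕ → Set) →
  (∀ x {k l} → k ≤ l → P x k → P x l) → (∀ x y {k} → P x k → P (Mon._∙_ X x y) k) →
  (∀ x → R x → ∃[ k ] P x k) → Good X R → ∃[ k ] (∀ x → R x → P x k)
uniform-bound P mono up h (empty e) = 0 , λ x p → ⊥-elim (e x p)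
uniform-bound {X} P mono up h (piece {f = f} (node z _ _) F s c) with h _ (s _ z)
... | k , q = k , λ x p → case c x p of
  λ { (t , _ , refl) → subst (λ y → P y k)
        (sym (trans (expand F t) (cong (λ y → Mon._∙_ X y (Mon.lin X t (periods F))) (sym (base≡ F)))))
        (up (f 0ᵛ) (Mon.lin X t (periods F)) q) }
uniform-bound P mono up h (union a b i j c)
  with uniform-bound P mono up (λ x → h x ∘ i x) a | uniform-bound P mono up (λ x → h x ∘ j x) b
... | k , p | l , q = k ⊔ l , λ x r → [ (λ r₁ → mono x (ℕₚ.m≤m⊔n k l) (p x r₁))
                                     , (λ r₂ → mono x (ℕₚ.m≤n⊔m k l) (q x r₂)) ]′ (c x r)

ray : ∀ {X n} {f : Vec ℕ n → Car X} (F : Affine X f) x k w →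
      f (x +ᵛ k ·ᵛ w) ≡ Mon._∙_ X (f x) (Mon._·_ X k (Mon.lin X w (periods F)))
ray {X} F x k w = trans (expand+ F x _) (cong (Mon._∙_ X _) (hom-· (lin-hom X (periods F)) k w))

-- One nonzero period is enough for growth, since a strictly positive direction uses each period at
-- least once.
constant? : ∀ {n} {f : Vec ℕ n → ℕ} (F : Affine ℕᴹ f) →
            (∀ t → f t ≡ base F) ⊎ (∀ w → Positive w → 1 ≤ Mon.lin ℕᴹ w (periods F))
constant? F with zeros? (periods F)
  where
  zeros? : ∀ {n} (p : Vec ℕ n) → (∀ t → Mon.lin ℕᴹ t p ≡ 0) ⊎ (∀ w → Positive w → 1 ≤ Mon.lin ℕᴹ w p)
  zeros? [] = inj₁ λ { [] → refl }
  zeros? (suc a ∷ p) = inj₂ λ { (zero ∷ w) pos → case pos zero of λ () ; (suc x ∷ w) pos → s≤s z≤n }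
  zeros? (zero ∷ p) with zeros? p
  ... | inj₁ e = inj₁ λ { (x ∷ t) → cong₂ _+_ (Mon.·-zeroʳ ℕᴹ x) (e t) }
  ... | inj₂ e = inj₂ λ { (x ∷ w) pos → ℕₚ.≤-trans (e w (pos ∘ suc)) (ℕₚ.m≤n+m _ _) }
... | inj₁ e = inj₁ (λ t → trans (expand F t) (trans (cong (_+_ (base F)) (e t)) (ℕₚ.+-identityʳ _)))
... | inj₂ e = inj₂ e

lookup-lin : ∀ {m n} (t : Vec ℕ m) (p : Vec (Vec ℕ n) m) i →
             lookup (V.lin t p) i ≡ Mon.lin ℕᴹ t (map (λ q → lookup q i) p)
lookup-lin t p i = hom-lin (lookup-hom i) t p

AllPositive : ∀ {m n} {g : Vec ℕ m → Vec ℕ n} → Affine (Vecᴹ n) g → Set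
AllPositive G = ∀ w → Positive w → Positive (V.lin w (periods G))

ConstantOrPositive : ∀ {m n} {g : Vec ℕ m → Vec ℕ n} → Affine (Vecᴹ n) g → Set
ConstantOrPositive {g = g} G = (∃[ p ] ∃[ k ] (∀ t → lookup (g t) p ≡ k)) ⊎ AllPositive G

constant-coordinate? : ∀ {m n} {g : Vec ℕ m → Vec ℕ n} (G : Affine (Vecᴹ n) g) → ConstantOrPositive G
constant-coordinate? {g = g} G = collect (λ i → constant? (hom-affine (lookup-hom i) G))
  where
  collect : (∀ i → (∀ t → lookup (g t) i ≡ lookup (base G) i)
               ⊎ (∀ w → Positive w → 1 ≤ Mon.lin ℕᴹ w (map (λ q → lookup q i) (periods G)))) → ConstantOrPositive G
  collect d with Finₚ.any? (λ i → isConstant (d i))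
    where
    isConstant : ∀ {A B : Set} (x : A ⊎ B) → Dec (∃[ a ] x ≡ inj₁ a)
    isConstant (inj₁ a) = yes (a , refl)
    isConstant (inj₂ b) = no λ ()
  ... | yes (i , a , _) = inj₁ (i , _ , a)
  ... | no ¬c = inj₂ (λ w pos i → subst (1 ≤_) (sym (lookup-lin w (periods G) i)) (nonconstant i (d i) refl w pos))
    where
    nonconstant : ∀ i x → d i ≡ x → ∀ w → Positive w → 1 ≤ Mon.lin ℕᴹ w (map (λ q → lookup q i) (periods G))
    nonconstant i (inj₁ a) eq = ⊥-elim (¬c (i , a , eq))
    nonconstant i (inj₂ b) eq = b

positive-1ᵛ : ∀ {n} → Positive (1ᵛ {n})
positive-1ᵛ i = ℕₚ.≤-reflexive (sym (Vecₚ.lookup-replicate i 1))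

insertAt-affine : ∀ {n} (q : Fin (suc n)) k → Affine (Vecᴹ (suc n)) (λ v → insertAt v q k)
insertAt-affine q k = hom-affine (insertAt-hom q) (pair-affine (const-affine ℕᴹ k) id-affine)

shift-affine : ∀ {n} (c : Vec ℕ n) → Affine (Vecᴹ n) (c +ᵛ_)
shift-affine c = ∙-affine (Vecᴹ _) (const-affine (Vecᴹ _) c) id-affine

Good-slice : ∀ {h} {T : Vec ℕ (suc h) → Set} q k → Good (Vecᴹ h) (λ v → T (insertAt v q k)) →
             Good (Vecᴹ (suc h)) (λ t → T t × lookup t q ≡ k)
Good-slice {T = T} q k = Good-map (∘-affine (insertAt-affine q k))
  (λ v p → p , Vecₚ.insertAt-lookup v q k)
  (λ { t (p , refl) → removeAt t q , subst T (sym (Vecₚ.insertAt-removeAt t q)) p , Vecₚ.insertAt-removeAt t q })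

≤ᵛ? : ∀ {n} (u t : Vec ℕ n) → (∃[ v ] u +ᵛ v ≡ t) ⊎ (∃[ q ] lookup t q < lookup u q)
≤ᵛ? []      []      = inj₁ ([] , refl)
≤ᵛ? (x ∷ u) (y ∷ t) with x ℕₚ.≤? y | ≤ᵛ? u t
... | no x≰y  | _               = inj₂ (zero , ℕₚ.≰⇒> x≰y)
... | yes _   | inj₂ (q , lt)   = inj₂ (suc q , lt)
... | yes x≤y | inj₁ (v , refl) = inj₁ (y ∸ x ∷ v , cong (_∷ _) (ℕₚ.m+[n∸m]≡n x≤y))

Good-full₀ : {T : Vec ℕ 0 → Set} → Full T → Good (Vecᴹ 0) T
Good-full₀ {T} full with full [] [] (λ ())
... | K , h = piece (node p (λ _ _ _ → 0 , λ k _ → all _) (λ ())) id-affine (λ _ q → q) (λ t q → t , q , refl)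
  where
  all : ∀ t → T t
  all [] = subst T []≡ (h K ℕₚ.≤-refl)
    where
    []≡ : ∀ {v : Vec ℕ 0} → v ≡ []
    []≡ {[]} = refl
  p = all []

-- A translation makes 0 an element of T; what it cuts off is a finite union of slices.
Good-full : ∀ {h} {T : Vec ℕ (suc h) → Set} → Full T →
  (∀ {s : Vec ℕ h → Vec ℕ (suc h)} → Affine (Vecᴹ (suc h)) s → Good (Vecᴹ h) (T ∘ s)) → Good (Vecᴹ (suc h)) T
Good-full {h} {T} full rec with full 0ᵛ 1ᵛ positive-1ᵛ
... | K , T-end = union
  (Good-image (∘-affine (shift-affine c)) (piece tree id-affine (λ _ p → p) (λ t p → t , p , refl)))
  (Good-∃Fin (λ q → Good-∃< (lookup c q) (λ k → Good-slice q k (rec (insertAt-affine q k)))))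
  (λ { t (u , p , refl) → p }) (λ { t (q , k , _ , p , _) → p }) cover
  where
  c = 0ᵛ +ᵛ K ·ᵛ 1ᵛ
  T′ : Vec ℕ (suc h) → Set
  T′ t = T (c +ᵛ t)
  tree : Tree (suc h) T′
  tree = node (subst T (sym (V.identityʳ c)) (T-end K ℕₚ.≤-refl))
    (λ x w pos → case full (c +ᵛ x) w pos of λ { (L , p) → L , λ k le → subst T (V.assoc c x _) (p k le) })
    (λ q k → Good-slice q k (rec (∘-affine (shift-affine c) (insertAt-affine q k))))
  cover : ∀ t → T t → _
  cover t p with ≤ᵛ? c t
  ... | inj₁ (v , refl)  = inj₁ (v , p , refl)
  ... | inj₂ (q , lt)    = inj₂ (q , lookup t q , lt , p , refl)

-- A linear condition `φ` is solved first; then `R` has to be understood only on the affine families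
-- of its solutions.
SL-Good : ∀ {n Y} {φ R : Vec ℕ n → Set} {δ : Vec ℕ n → Car Y} → Affine Y δ → SL φ →
  (∀ {k} {γ : Vec ℕ k → Vec ℕ n} → Affine (Vecᴹ n) γ → (∀ s → φ (γ s)) → Good (Vecᴹ k) (R ∘ γ)) →
  Good Y (λ y → ∃[ t ] (φ t × R t × δ t ≡ y))
SL-Good D (none e) rec = empty (λ { y (t , p , _) → e t p })
SL-Good {R = R} D (one G s c) rec = Good-map (∘-affine (∘-affine D G))
  (λ u p → _ , s u , p , refl)
  (λ { y (t , p , q , refl) → case c t p of λ { (u , refl) → u , q , refl } }) (rec G s)
SL-Good {R = R} D (or a b i j c) rec = union
  (SL-Good {R = R} D a (λ G s → rec G (λ u → i _ (s u)))) (SL-Good {R = R} D b (λ G s → rec G (λ u → j _ (s u))))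
  (λ { y (t , p , q) → t , i t p , q }) (λ { y (t , p , q) → t , j t p , q })
  (λ { y (t , p , q) → case c t p of λ { (inj₁ p₁) → inj₁ (t , p₁ , q) ; (inj₂ p₂) → inj₂ (t , p₂ , q) } })

-- Preimages, products and linear restrictions of Good sets

take-++ : ∀ {m n} (u : Vec ℕ m) (v : Vec ℕ n) → take m (u ++ v) ≡ u
take-++ []      v = refl
take-++ (x ∷ u) v = cong (x ∷_) (take-++ u v)

drop-++ : ∀ {m n} (u : Vec ℕ m) (v : Vec ℕ n) → drop m (u ++ v) ≡ v
drop-++ []      v = refl
drop-++ (x ∷ u) v = drop-++ u v

take-affine : ∀ m {n} → Affine (Vecᴹ m) (take m {n})
take-affine m = lift-affine (take-hom m)

drop-affine : ∀ m {n} → Affine (Vecᴹ n) (drop m {n})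
drop-affine m = lift-affine (drop-hom m)

full-pull : ∀ {n₁ n₂ T₁ T₂} → Tree n₁ T₁ → Tree n₂ T₂ → ∀ {h} {g₁ : Vec ℕ h → _} {g₂ : Vec ℕ h → _} →
  (G₁ : Affine (Vecᴹ n₁) g₁) (G₂ : Affine (Vecᴹ n₂) g₂) →
  AllPositive G₁ → AllPositive G₂ → Full (λ η → T₁ (g₁ η) × T₂ (g₂ η))
full-pull {T₁ = T₁} {T₂} (node _ f₁ _) (node _ f₂ _) {g₁ = g₁} {g₂} G₁ G₂ pos₁ pos₂ x w pos
  with eventually-∧ (f₁ (g₁ x) (V.lin w (periods G₁)) (pos₁ w pos)) (f₂ (g₂ x) (V.lin w (periods G₂)) (pos₂ w pos))
... | K , p = K , λ k le → subst T₁ (sym (ray G₁ x k w)) (proj₁ (p k le))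
                         , subst T₂ (sym (ray G₂ x k w)) (proj₂ (p k le))

mutual
  -- If `g₁` or `g₂` has a constant coordinate, only one slice of its tree matters, and slices are
  -- smaller. Otherwise positive directions go to positive ones, so the preimage is full, and its
  -- slices have one parameter fewer. Treating two trees at once gives `Good-×`; the parameters that
  -- a slice of one tree introduces simply join the family on which the other condition is read.
  pull-trees : ∀ {n₁ n₂ T₁ T₂} → Tree n₁ T₁ → Tree n₂ T₂ → ∀ h {g₁ : Vec ℕ h → _} {g₂ : Vec ℕ h → _} →
               Affine (Vecᴹ n₁) g₁ → Affine (Vecᴹ n₂) g₂ → Good (Vecᴹ h) (λ η → T₁ (g₁ η) × T₂ (g₂ η))
  pull-trees t₁ t₂ h G₁ G₂ = pull-trees′ t₁ t₂ h G₁ G₂ (constant-coordinate? G₁) (constant-coordinate? G₂)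

  pull-trees′ : ∀ {n₁ n₂ T₁ T₂} → Tree n₁ T₁ → Tree n₂ T₂ → ∀ h {g₁ : Vec ℕ h → _} {g₂ : Vec ℕ h → _} →
    (G₁ : Affine (Vecᴹ n₁) g₁) (G₂ : Affine (Vecᴹ n₂) g₂) → ConstantOrPositive G₁ → ConstantOrPositive G₂ →
    Good (Vecᴹ h) (λ η → T₁ (g₁ η) × T₂ (g₂ η))
  pull-trees′ (node _ _ c) t₂ h G₁ G₂ (inj₁ (p , k , eq)) _ =
    Good-resp (λ { η ((a , _) , b) → a , b }) (λ { η (a , b) → (a , eq η) , b }) (pull-good (c p k) t₂ h G₁ G₂)
  pull-trees′ t₁ (node _ _ c) h G₁ G₂ (inj₂ _) (inj₁ (p , k , eq)) =
    Good-resp (λ { η ((b , _) , a) → a , b }) (λ { η (a , b) → (b , eq η) , a }) (pull-good (c p k) t₁ h G₂ G₁)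
  pull-trees′ {T₁ = T₁} {T₂} t₁ t₂ zero G₁ G₂ (inj₂ pos₁) (inj₂ pos₂) =
    Good-full₀ {T = λ η → T₁ _ × T₂ _} (full-pull t₁ t₂ G₁ G₂ pos₁ pos₂)
  pull-trees′ {T₁ = T₁} {T₂} t₁ t₂ (suc h) G₁ G₂ (inj₂ pos₁) (inj₂ pos₂) =
    Good-full {T = λ η → T₁ _ × T₂ _} (full-pull t₁ t₂ G₁ G₂ pos₁ pos₂)
      (λ S → pull-trees t₁ t₂ h (∘-affine G₁ S) (∘-affine G₂ S))

  pull-good : ∀ {n₁ n₂ R₁ T₂} → Good (Vecᴹ n₁) R₁ → Tree n₂ T₂ → ∀ h {g₁ : Vec ℕ h → _} {g₂ : Vec ℕ h → _} →
              Affine (Vecᴹ n₁) g₁ → Affine (Vecᴹ n₂) g₂ → Good (Vecᴹ h) (λ η → R₁ (g₁ η) × T₂ (g₂ η))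
  pull-good (empty e) t₂ h G₁ G₂ = empty (λ { η (p , _) → e _ p })
  pull-good (union a b i j c) t₂ h G₁ G₂ = union (pull-good a t₂ h G₁ G₂) (pull-good b t₂ h G₁ G₂)
    (λ { η (p , q) → i _ p , q }) (λ { η (p , q) → j _ p , q })
    (λ { η (p , q) → case c _ p of λ { (inj₁ p₁) → inj₁ (p₁ , q) ; (inj₂ p₂) → inj₂ (p₂ , q) } })
  pull-good {n₁} {R₁ = R₁} {T₂ = T₂} (piece {n} {T} {f} t₁ F s c) t₂ h {g₁} {g₂} G₁ G₂ = Good-resp
    (λ { η (u , eq , (p , q) , refl) → subst R₁ eq (s _ p) , q })
    (λ { η (p , q) → case c _ p of λ { (t , p′ , eq) →
         t ++ η , trans (cong f (take-++ t η)) (trans eq (cong g₁ (sym (drop-++ t η))))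
       , (subst T (sym (take-++ t η)) p′ , subst (T₂ ∘ g₂) (sym (drop-++ t η)) q) , drop-++ t η } })
    (SL-Good {R = λ u → T (take n u) × T₂ (g₂ (drop n u))} (drop-affine n)
      (solve (Vecˢ n₁) (∘-affine F (take-affine n)) (∘-affine G₁ (drop-affine n)))
      (λ Γ _ → pull-trees t₁ t₂ _ (∘-affine (take-affine n) Γ) (∘-affine G₂ (∘-affine (drop-affine n) Γ))))

full-space : ∀ n → Good (Vecᴹ n) (λ _ → ⊤)
full-space zero    = Good-full₀ (λ _ _ _ → 0 , λ _ _ → tt)
full-space (suc n) = Good-full (λ _ _ _ → 0 , λ _ _ → tt) (λ _ → full-space n)

⊤-tree : Tree 0 (λ _ → ⊤)
⊤-tree = node tt (λ _ _ _ → 0 , λ _ _ → tt) (λ ())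

pull-tree : ∀ {n T} → Tree n T → ∀ {h} {g : Vec ℕ h → Vec ℕ n} → Affine (Vecᴹ n) g → Good (Vecᴹ h) (T ∘ g)
pull-tree t G = Good-resp (λ _ → proj₁) (λ _ p → p , tt) (pull-trees t ⊤-tree _ G (const-affine (Vecᴹ 0) []))

Good-× : ∀ {X Y} {R : Car X → Set} {S : Car Y → Set} → Good X R → Good Y S →
         Good (X ×ᴹ Y) (λ (x , y) → R x × S y)
Good-× (empty e) b = empty (λ { _ (p , _) → e _ p })
Good-× (union a a′ i j c) b = union (Good-× a b) (Good-× a′ b)
  (λ { _ (p , q) → i _ p , q }) (λ { _ (p , q) → j _ p , q })
  (λ { _ (p , q) → case c _ p of λ { (inj₁ p₁) → inj₁ (p₁ , q) ; (inj₂ p₂) → inj₂ (p₂ , q) } })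
Good-× (piece _ _ _ _) (empty e) = empty (λ { _ (_ , q) → e _ q })
Good-× a@(piece _ _ _ _) (union b b′ i j c) = union (Good-× a b) (Good-× a b′)
  (λ { _ (p , q) → p , i _ q }) (λ { _ (p , q) → p , j _ q })
  (λ { _ (p , q) → case c _ q of λ { (inj₁ q₁) → inj₁ (p , q₁) ; (inj₂ q₂) → inj₂ (p , q₂) } })
Good-× (piece {n} {T} {f} t F s c) (piece {n′} {T′} {f′} t′ F′ s′ c′) = Good-map
  (∘-affine (pair-affine (∘-affine F (take-affine n)) (∘-affine F′ (drop-affine n))))
  (λ u (p , q) → s _ p , s′ _ q)
  (λ { (x , y) (p , q) → case c x p , c′ y q of
    λ { ((u , p′ , refl) , (v , q′ , refl)) → u ++ v
      , (subst T (sym (take-++ u v)) p′ , subst T′ (sym (drop-++ u v)) q′)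
      , cong₂ _,_ (cong f (take-++ u v)) (cong f′ (drop-++ u v)) } })
  (pull-trees t t′ _ (take-affine n) (drop-affine n))

Good-solve : ∀ {X} (Y : Space) {R : Car X → Set} {u v : Car X → Car (mon Y)} → Lin X (mon Y) u → Lin X (mon Y) v →
             Good X R → Good X (λ x → R x × u x ≡ v x)
Good-solve Y U W (empty e) = empty (λ { x (p , _) → e x p })
Good-solve Y U W (union a b i j c) = union (Good-solve Y U W a) (Good-solve Y U W b)
  (λ { x (p , q) → i x p , q }) (λ { x (p , q) → j x p , q })
  (λ { x (p , q) → case c x p of λ { (inj₁ p₁) → inj₁ (p₁ , q) ; (inj₂ p₂) → inj₂ (p₂ , q) } })
Good-solve Y U W (piece {T = T} t F s c) = Good-resp
  (λ { x (t , eq , p , refl) → s t p , eq })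
  (λ { x (p , eq) → case c x p of λ { (t , q , refl) → t , eq , q , refl } })
  (SL-Good {R = T} F (solve Y (U F) (W F)) (λ Γ _ → pull-tree t Γ))

-- Inside the product of `R` with the parameter space, the graph of `g` is cut out by an equation
-- and then projected to the parameters.
Good-pull : ∀ (X : Space) {R : Car (mon X) → Set} {h} {g : Vec ℕ h → Car (mon X)} →
            Affine (mon X) g → Good (mon X) R → Good (Vecᴹ h) (R ∘ g)
Good-pull X {R} {h} {g} G a = Good-map {X = mon X ×ᴹ Vecᴹ h} {h = proj₂} (hom-affine (proj₂-hom (mon X) (Vecᴹ h)))
  (λ { (x , η) ((p , _) , refl) → p }) (λ η p → (g η , η) , ((p , tt) , refl) , refl)
  (Good-solve X {u = proj₁} {v = g ∘ proj₂} (hom-affine (proj₁-hom (mon X) (Vecᴹ h)))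
    (λ F → ∘-affine G (hom-affine (proj₂-hom (mon X) (Vecᴹ h)) F)) (Good-× a (full-space h)))

-- Runs of weighted moves, fired in arbitrary contexts

Triple : ℕ → Mon → Mon
Triple d W = (Vecᴹ d ×ᴹ W) ×ᴹ Vecᴹ d

Rel : ℕ → Mon → Set₁
Rel d W = Vec ℕ d → Car W → Vec ℕ d → Set

GoodRel : ∀ {d} (W : Mon) → Rel d W → Set₁
GoodRel {d} W R = Good (Triple d W) (λ ((x , w) , y) → R x w y)

proj₁-affine : ∀ X Y → Lin (X ×ᴹ Y) X proj₁
proj₁-affine X Y = hom-affine (proj₁-hom X Y)

proj₂-affine : ∀ X Y → Lin (X ×ᴹ Y) Y proj₂
proj₂-affine X Y = hom-affine (proj₂-hom X Y)

source : {A B C : Set} → (A × B) × C → A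
source ((x , w) , y) = x

label : {A B C : Set} → (A × B) × C → B
label ((x , w) , y) = w

target : {A B C : Set} → (A × B) × C → C
target ((x , w) , y) = y

module _ (d : ℕ) (W : Mon) where

  source-affine : Lin (Triple d W) (Vecᴹ d) source
  source-affine F = proj₁-affine (Vecᴹ d) W (proj₁-affine (Vecᴹ d ×ᴹ W) (Vecᴹ d) F)

  label-affine : Lin (Triple d W) W label
  label-affine F = proj₂-affine (Vecᴹ d) W (proj₁-affine (Vecᴹ d ×ᴹ W) (Vecᴹ d) F)

  target-affine : Lin (Triple d W) (Vecᴹ d) target
  target-affine F = proj₂-affine (Vecᴹ d ×ᴹ W) (Vecᴹ d) F

data Comp {d : ℕ} (W : Mon) (R S : Rel d W) (x : Vec ℕ d) (w : Car W) (z : Vec ℕ d) : Set where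
  comp : ∀ {y v₁ v₂} → R x v₁ y → S y v₂ z → w ≡ Mon._∙_ W v₁ v₂ → Comp W R S x w z

data Firing {d : ℕ} (W : Mon) (M : Rel d W) (x : Vec ℕ d) (w : Car W) (y : Vec ℕ d) : Set where
  fire : ∀ {a b} z → M a w b → x ≡ a +ᵛ z → y ≡ b +ᵛ z → Firing W M x w y

Comp-good : ∀ {d W} {R S : Rel d W} → GoodRel W R → GoodRel W S → GoodRel W (Comp W R S)
Comp-good {d} {W} a b = Good-map {X = XX}
  {h = λ (r , s) → (source r , Mon._∙_ W (label r) (label s)) , target s}
  (λ F → pair-affine (pair-affine (source-affine d W (p₁ F)) (∙-affine W (label-affine d W (p₁ F)) (label-affine d W (p₂ F))))
           (target-affine d W (p₂ F)))
  (λ { (((x , v) , y) , ((_ , v′) , z)) ((p , q) , refl) → comp p q refl })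
  (λ { ((x , _) , z) (comp {y} {v} {v′} p q refl) → ((((x , v) , y) , ((y , v′) , z))) , ((p , q) , refl) , refl })
  (Good-solve {X = XX} (Vecˢ d) {u = target ∘ proj₁} {v = source ∘ proj₂}
    (λ F → target-affine d W (p₁ F)) (λ F → source-affine d W (p₂ F)) (Good-× a b))
  where
  XX = Triple d W ×ᴹ Triple d W
  p₁ = λ {n} {f} → proj₁-affine (Triple d W) (Triple d W) {n} {f}
  p₂ = λ {n} {f} → proj₂-affine (Triple d W) (Triple d W) {n} {f}

Firing-good : ∀ {d W} {M : Rel d W} → GoodRel W M → GoodRel W (Firing W M)
Firing-good {d} {W} a = Good-map {X = Triple d W ×ᴹ Vecᴹ d}
  {h = λ (m , z) → (source m +ᵛ z , label m) , target m +ᵛ z}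
  (λ F → pair-affine (pair-affine (∙-affine (Vecᴹ d) (source-affine d W (p₁ F)) (p₂ F)) (label-affine d W (p₁ F)))
           (∙-affine (Vecᴹ d) (target-affine d W (p₁ F)) (p₂ F)))
  (λ { (((a , w) , b) , z) (p , _) → fire z p refl refl })
  (λ { _ (fire {a} {b} z p refl refl) → (((a , _) , b) , z) , (p , tt) , refl })
  (Good-× a (full-space d))
  where
  p₁ = λ {n} {f} → proj₁-affine (Triple d W) (Vecᴹ d) {n} {f}
  p₂ = λ {n} {f} → proj₂-affine (Triple d W) (Vecᴹ d) {n} {f}

source-level-good : ∀ {d W} {R : Rel d W} i n → GoodRel W R → GoodRel W (λ x w y → R x w y × lookup x i ≡ n)
source-level-good {d} {W} i n = Good-solve ℕˢ {u = λ m → lookup (source m) i} {v = λ _ → n}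
  (λ F → hom-affine (lookup-hom i) (source-affine d W F)) (λ _ → const-affine ℕᴹ n)

target-level-good : ∀ {d W} {R : Rel d W} i n → GoodRel W R → GoodRel W (λ x w y → R x w y × lookup y i ≡ n)
target-level-good {d} {W} i n = Good-solve ℕˢ {u = λ m → lookup (target m) i} {v = λ _ → n}
  (λ F → hom-affine (lookup-hom i) (target-affine d W F)) (λ _ → const-affine ℕᴹ n)

Identity : ∀ {d} (W : Mon) → Rel d W
Identity W x w y = w ≡ Mon.ε W × x ≡ y

Identity-good : ∀ {d} W → GoodRel {d} W (Identity W)
Identity-good {d} W = Good-map {X = Vecᴹ d} {h = λ x → (x , Mon.ε W) , x}
  (λ F → pair-affine (pair-affine F (const-affine W (Mon.ε W))) F)
  (λ x _ → refl , refl) (λ { _ (refl , refl) → _ , tt , refl }) (full-space d)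

converse-good : ∀ {d W} {R : Rel d W} → GoodRel W R → GoodRel W (λ x w y → R y w x)
converse-good {d} {W} = Good-map {X = Triple d W} {h = λ m → (target m , label m) , source m}
  (λ F → pair-affine (pair-affine (target-affine d W F) (label-affine d W F)) (source-affine d W F))
  (λ _ p → p) (λ { ((x , w) , y) p → ((y , w) , x) , p , refl })

relabel-good : ∀ {d W W′} {h : Car W → Car W′} {R : Rel d W} → Hom W W′ h → GoodRel W R →
               GoodRel W′ (λ x w′ y → ∃[ w ] (R x w y × h w ≡ w′))
relabel-good {d} {W} {h = h} H = Good-map {X = Triple d W} {h = λ m → (source m , h (label m)) , target m}
  (λ F → pair-affine (pair-affine (source-affine d W F) (hom-affine H (label-affine d W F))) (target-affine d W F))
  (λ m p → label m , p , refl) (λ { _ (w , p , refl) → _ , p , refl })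

data Run {d : ℕ} (W : Mon) (M : Rel d W) : Rel d W where
  stop : ∀ {x} → Run W M x (Mon.ε W) x
  step : ∀ {x y z v w} → Firing W M x v y → Run W M y w z → Run W M x (Mon._∙_ W v w) z

Firing-shift : ∀ {d W} {M : Rel d W} {x w y} → Firing W M x w y → ∀ z → Firing W M (x +ᵛ z) w (y +ᵛ z)
Firing-shift (fire {a} {b} c m refl refl) z = fire (c +ᵛ z) m (V.assoc a c z) (V.assoc b c z)

module _ {d : ℕ} {W : Mon} {M : Rel d W} where
  private module W = Mon W

  Run-shift : ∀ {x w y} → Run W M x w y → ∀ z → Run W M (x +ᵛ z) w (y +ᵛ z)
  Run-shift stop       z = stop
  Run-shift (step s r) z = step (Firing-shift s z) (Run-shift r z)

  Run-trans : ∀ {x v y w z} → Run W M x v y → Run W M y w z → Run W M x (v W.∙ w) z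
  Run-trans stop       r′ = subst (λ u → Run W M _ u _) (sym (W.identityˡ _)) r′
  Run-trans (step s r) r′ = subst (λ u → Run W M _ u _) (sym (W.assoc _ _ _)) (step s (Run-trans r r′))

  Run-single : ∀ {x w y} → Firing W M x w y → Run W M x w y
  Run-single s = subst (λ u → Run W M _ u _) (W.identityʳ _) (step s stop)

Run-mono : ∀ {d W} {M M′ : Rel d W} → (∀ {x w y} → M x w y → M′ x w y) → ∀ {x w y} → Run W M x w y → Run W M′ x w y
Run-mono i stop = stop
Run-mono i (step (fire z m p q) r) = step (fire z (i m) p q) (Run-mono i r)

Run-converse : ∀ {d W} {M : Rel d W} {x w y} → Run W (λ a v b → M b v a) x w y → Run W M y w x
Run-converse stop = stop
Run-converse {W = W} (step (fire z m p q) r) = subst (λ u → Run W _ _ u _) (Mon.comm W _ _)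
  (Run-trans (Run-converse r) (Run-single (fire z m q p)))

StarGood : ℕ → Set₁
StarGood d = ∀ (W : Mon) (M : Rel d W) → GoodRel W M → GoodRel W (Run W M)

Forget : ∀ {d} {W : Mon} → Fin (suc d) → Rel (suc d) W → Rel d W
Forget i R x′ w y′ = ∃[ x ] ∃[ y ] (R x w y × x′ ≡ removeAt x i × y′ ≡ removeAt y i)

Forget-good : ∀ {d W} i {R : Rel (suc d) W} → GoodRel W R → GoodRel W (Forget {W = W} i R)
Forget-good {d} {W} i = Good-map {X = Triple (suc d) W} {h = λ m → (removeAt (source m) i , label m) , removeAt (target m) i}
  (λ F → pair-affine (pair-affine (hom-affine (removeAt-hom i) (source-affine (suc d) W F)) (label-affine (suc d) W F))
           (hom-affine (removeAt-hom i) (target-affine (suc d) W F)))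
  (λ { ((x , w) , y) p → x , y , p , refl , refl })
  (λ { _ (x , y , p , refl , refl) → _ , p , refl })

-- Iterating a relation that lives on the hyperplane xᵢ = n is a problem of one dimension less.

module Hyperplane {d : ℕ} (star : StarGood d) (W : Mon) (i : Fin (suc d)) (n : ℕ) (L : Rel (suc d) W)
  (L-good : GoodRel W L) (on-plane : ∀ {x w y} → L x w y → lookup x i ≡ n × lookup y i ≡ n)
  (L-shift : ∀ {x w y} z → lookup z i ≡ 0 → L x w y → L (x +ᵛ z) w (y +ᵛ z)) where
  private module W = Mon W

  Iter : Rel (suc d) W
  Iter x w y = ∃[ x′ ] ∃[ y′ ] (Run W (Forget {W = W} i L) x′ w y′ × x ≡ insertAt x′ i n × y ≡ insertAt y′ i n)

  Iter-good : GoodRel W Iter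
  Iter-good = Good-map {X = Triple d W} {h = λ m → (insertAt (source m) i n , label m) , insertAt (target m) i n}
    (λ F → pair-affine (pair-affine (∘-affine′ (source-affine d W F)) (label-affine d W F))
             (∘-affine′ (target-affine d W F)))
    (λ { ((x′ , w) , y′) p → x′ , y′ , p , refl , refl })
    (λ { _ (x′ , y′ , p , refl , refl) → _ , p , refl })
    (star W (Forget {W = W} i L) (Forget-good {W = W} i L-good))
    where
    ∘-affine′ : Lin (Vecᴹ d) (Vecᴹ (suc d)) (λ v → insertAt v i n)
    ∘-affine′ F = ∘-affine (insertAt-affine i n) F

  restore : ∀ {x} → lookup x i ≡ n → x ≡ insertAt (removeAt x i) i n
  restore {x} refl = sym (Vecₚ.insertAt-removeAt x i)

  Iter-stop : ∀ {x} → lookup x i ≡ n → Iter x W.ε x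
  Iter-stop p = _ , _ , stop , restore p , restore p

  Iter-step : ∀ {x v y w z} → L x v y → Iter y w z → Iter x (v W.∙ w) z
  Iter-step {x} {y = y} l (y′ , z′ , r , refl , q) = removeAt x i , z′
    , step (fire 0ᵛ (x , y , l , refl , sym (Vecₚ.removeAt-insertAt y′ i n))
           (sym (V.identityʳ _)) (sym (V.identityʳ _))) r
    , restore (proj₁ (on-plane l)) , q

  -- A context of the smaller system has no coordinate `i`. Reinserting it with the value 0 keeps
  -- the run on the hyperplane, and `L-shift` absorbs contexts of this kind into `L`.
  Iter-elim : (Q : Rel (suc d) W) → (∀ {x} → lookup x i ≡ n → Q x W.ε x) →
              (∀ {x v y w z} → L x v y → Q y w z → Q x (v W.∙ w) z) → ∀ {x w y} → Iter x w y → Q x w y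
  Iter-elim Q q₀ q₁ (x′ , y′ , r , refl , refl) = go r
    where
    lift : ∀ {x} z → lookup x i ≡ n → x +ᵛ insertAt z i 0 ≡ insertAt (removeAt x i +ᵛ z) i n
    lift {x} z p = trans (cong (_+ᵛ insertAt z i 0) (restore p))
      (trans (sym (hom-∙ (insertAt-hom i) (n , removeAt x i) (0 , z)))
        (cong (insertAt (removeAt x i +ᵛ z) i) (ℕₚ.+-identityʳ n)))
    go : ∀ {x′ w y′} → Run W (Forget {W = W} i L) x′ w y′ → Q (insertAt x′ i n) w (insertAt y′ i n)
    go stop = q₀ (Vecₚ.insertAt-lookup _ i n)
    go (step (fire z (a , b , l , refl , refl) refl refl) r) =
      q₁ (subst₂ (λ x y → L x _ y) (lift z (proj₁ (on-plane l))) (lift z (proj₂ (on-plane l)))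
           (L-shift (insertAt z i 0) (Vecₚ.insertAt-lookup z i 0) l)) (go r)

data Below {d : ℕ} (W : Mon) (M : Rel d W) (i : Fin d) (n : ℕ) : Rel d W where
  stop : ∀ {x} → lookup x i < n → Below W M i n x (Mon.ε W) x
  step : ∀ {x y z v w} → lookup x i < n → Firing W M x v y → Below W M i n y w z →
         Below W M i n x (Mon._∙_ W v w) z

Below⇒Run : ∀ {d W} {M : Rel d W} {i n x w y} → Below W M i n x w y → Run W M x w y
Below⇒Run (stop _)     = stop
Below⇒Run (step _ s r) = step s (Below⇒Run r)

-- Kleene's construction on the levels of coordinate i: a run below n + 1 is cut at its visits to level n.
module BelowGood {d : ℕ} (star : StarGood d) (W : Mon) (M : Rel (suc d) W) (M-good : GoodRel W M) (i : Fin (suc d)) where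
  private
    module W = Mon W
    S : Rel (suc d) W
    S = Firing W M
    B : ℕ → Rel (suc d) W
    B = Below W M i
    infixr 5 _⨾_
    _⨾_ : Rel (suc d) W → Rel (suc d) W → Rel (suc d) W
    _⨾_ = Comp W
    S-good : GoodRel W S
    S-good = Firing-good M-good

  -- The identity alternatives account for runs that start or end at level `n`. A loop returns to
  -- the level either by a single firing or after an excursion below it.
  Arrive Loop Leave : ℕ → Rel (suc d) W
  Arrive n x w y = (Identity W x w y ⊎ (B n ⨾ S) x w y) × lookup y i ≡ n
  Loop n x w y = ((S x w y ⊎ (S ⨾ B n ⨾ S) x w y) × lookup x i ≡ n) × lookup y i ≡ n
  Leave n x w y = (Identity W x w y ⊎ (S ⨾ B n) x w y) × lookup x i ≡ n

  Below-shift : ∀ {n x w y} z → lookup z i ≡ 0 → B n x w y → B n (x +ᵛ z) w (y +ᵛ z)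
  Below-shift {n} z p = go
    where
    low : ∀ x → lookup x i < n → lookup (x +ᵛ z) i < n
    low x = subst (_< n) (sym (trans (hom-∙ (lookup-hom i) x z) (trans (cong (_+_ (lookup x i)) p) (ℕₚ.+-identityʳ _))))
    go : ∀ {x w y} → B n x w y → B n (x +ᵛ z) w (y +ᵛ z)
    go (stop {x} b)     = stop (low x b)
    go (step {x} b s r) = step (low x b) (Firing-shift s z) (go r)

  Loop-shift : ∀ {n x w y} z → lookup z i ≡ 0 → Loop n x w y → Loop n (x +ᵛ z) w (y +ᵛ z)
  Loop-shift {n} {x} {_} {y} z p ((l , q) , q′) = (shift l , same x q) , same y q′
    where
    same : ∀ x → lookup x i ≡ n → lookup (x +ᵛ z) i ≡ n
    same x q = trans (hom-∙ (lookup-hom i) x z) (trans (cong₂ _+_ q p) (ℕₚ.+-identityʳ n))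
    shift : ∀ {x w y} → S x w y ⊎ (S ⨾ B n ⨾ S) x w y →
            S (x +ᵛ z) w (y +ᵛ z) ⊎ (S ⨾ B n ⨾ S) (x +ᵛ z) w (y +ᵛ z)
    shift (inj₁ s) = inj₁ (Firing-shift s z)
    shift (inj₂ (comp s (comp r s′ e′) e)) =
      inj₂ (comp (Firing-shift s z) (comp (Below-shift z p r) (Firing-shift s′ z) e′) e)

  Below-suc : ∀ {n x w y} → B n x w y → B (suc n) x w y
  Below-suc (stop b)     = stop (ℕₚ.m<n⇒m<1+n b)
  Below-suc (step b s r) = step (ℕₚ.m<n⇒m<1+n b) s (Below-suc r)

  Below-trans : ∀ {n x v y w z} → B n x v y → B n y w z → B n x (v W.∙ w) z
  Below-trans (stop b)     r′ = subst (λ u → B _ _ u _) (sym (W.identityˡ _)) r′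
  Below-trans (step b s r) r′ = subst (λ u → B _ _ u _) (sym (W.assoc _ _ _)) (step b s (Below-trans r r′))

  Below-single : ∀ {n x w y} → lookup x i < n → S x w y → lookup y i < n → B n x w y
  Below-single b s b′ = subst (λ u → B _ _ u _) (W.identityʳ _) (step b s (stop b′))

  target< : ∀ {n x w y} → B n x w y → lookup y i < n
  target< (stop b)     = b
  target< (step _ _ r) = target< r

  Below-good : ∀ n → GoodRel W (B n)
  Below-good zero = empty λ { _ (stop ()) ; _ (step () _ _) }
  Below-good (suc n) = Good-resp {S = λ ((x , w) , y) → B (suc n) x w y}
    (λ _ → [ Below-suc , sound ]′) (λ _ → complete)
    (Good-∪ B-good (Comp-good Arrive-good (Comp-good Iter-good Leave-good)))
    where
    B-good = Below-good n
    Arrive-good : GoodRel W (Arrive n)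
    Arrive-good = target-level-good {W = W} {R = λ x w y → Identity W x w y ⊎ (B n ⨾ S) x w y} i n
      (Good-∪ (Identity-good W) (Comp-good B-good S-good))
    Leave-good : GoodRel W (Leave n)
    Leave-good = source-level-good {W = W} {R = λ x w y → Identity W x w y ⊎ (S ⨾ B n) x w y} i n
      (Good-∪ (Identity-good W) (Comp-good S-good B-good))
    Loop-good : GoodRel W (Loop n)
    Loop-good = target-level-good {W = W} {R = λ x w y → (S x w y ⊎ (S ⨾ B n ⨾ S) x w y) × lookup x i ≡ n} i n
      (source-level-good {W = W} {R = λ x w y → S x w y ⊎ (S ⨾ B n ⨾ S) x w y} i n
        (Good-∪ S-good (Comp-good S-good (Comp-good B-good S-good))))
    open Hyperplane star W i n (Loop n) Loop-good (λ ((_ , p) , q) → p , q) Loop-shift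
    at< : ∀ x → lookup x i ≡ n → lookup x i < suc n
    at< x refl = ℕₚ.≤-refl

    Through : Rel (suc d) W
    Through = Arrive n ⨾ Iter ⨾ Leave n

    sound : ∀ {x w y} → Through x w y → B (suc n) x w y
    sound (comp arr (comp it lv refl) refl) =
      Below-trans (arrive arr) (Below-trans (Iter-elim (B (suc n)) (λ {x} p → stop (at< x p)) loop it) (leave lv))
      where
      arrive : ∀ {x w y} → Arrive n x w y → B (suc n) x w y
      arrive {x} (inj₁ (refl , refl) , p) = stop (at< x p)
      arrive {y = y} (inj₂ (comp r s refl) , p) =
        Below-trans (Below-suc r) (Below-single (ℕₚ.m<n⇒m<1+n (target< r)) s (at< y p))
      leave : ∀ {x w y} → Leave n x w y → B (suc n) x w y
      leave {x} (inj₁ (refl , refl) , p) = stop (at< x p)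
      leave {x} (inj₂ (comp s r refl) , p) = step (at< x p) s (Below-suc r)
      loop : ∀ {x v y w z} → Loop n x v y → B (suc n) y w z → B (suc n) x (v W.∙ w) z
      loop {x} ((inj₁ s , p) , q) r = step (at< x p) s r
      loop {x} {y = y} ((inj₂ (comp s (comp b s′ refl) refl) , p) , q) r =
        Below-trans (step (at< x p) s (Below-trans (Below-suc b)
          (Below-single (ℕₚ.m<n⇒m<1+n (target< b)) s′ (at< y q)))) r

    -- The decomposition grows from the end of the run. A firing from below level `n` extends the
    -- run below `n` or the arrival; one from level `n` starts the leaving part or turns the arrival
    -- into one more loop.
    prepend : ∀ {x v y w z} → lookup x i < suc n → S x v y → B n y w z ⊎ Through y w z →
              B n x (v W.∙ w) z ⊎ Through x (v W.∙ w) z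
    prepend (s≤s x≤n) s r with ℕₚ.m≤n⇒m<n∨m≡n x≤n
    prepend _ s (inj₁ r) | inj₁ x<n = inj₁ (step x<n s r)
    prepend _ s (inj₂ (comp (inj₁ (refl , refl) , p) tl refl)) | inj₁ x<n =
      inj₂ (comp (inj₂ (comp (stop x<n) s (sym (W.identityˡ _))) , p) tl (cong (W._∙_ _) (W.identityˡ _)))
    prepend _ s (inj₂ (comp (inj₂ (comp b s′ refl) , p) tl refl)) | inj₁ x<n =
      inj₂ (comp (inj₂ (comp (step x<n s b) s′ (sym (W.assoc _ _ _))) , p) tl (sym (W.assoc _ _ _)))
    prepend _ s (inj₁ r) | inj₂ x≡n =
      inj₂ (comp (inj₁ (refl , refl) , x≡n)
        (comp (Iter-stop x≡n) (inj₂ (comp s r refl) , x≡n) refl)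
        (sym (trans (W.identityˡ _) (W.identityˡ _))))
    prepend _ s (inj₂ (comp (inj₁ (refl , refl) , p) (comp it lv refl) refl)) | inj₂ x≡n =
      inj₂ (comp (inj₁ (refl , refl) , x≡n) (comp (Iter-step ((inj₁ s , x≡n) , p) it) lv refl)
        (trans (cong (W._∙_ _) (W.identityˡ _)) (sym (trans (W.identityˡ _) (W.assoc _ _ _)))))
    prepend _ s (inj₂ (comp (inj₂ (comp b s′ refl) , p) (comp it lv refl) refl)) | inj₂ x≡n =
      inj₂ (comp (inj₁ (refl , refl) , x≡n)
        (comp (Iter-step ((inj₂ (comp s (comp b s′ refl) refl) , x≡n) , p) it) lv refl)
        (sym (trans (W.identityˡ _) (trans (W.assoc _ _ _) (W.assoc _ _ _)))))

    complete : ∀ {x w y} → B (suc n) x w y → B n x w y ⊎ Through x w y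
    complete (step b s r) = prepend b s (complete r)
    complete (stop (s≤s x≤n)) with ℕₚ.m≤n⇒m<n∨m≡n x≤n
    ... | inj₁ x<n = inj₁ (stop x<n)
    ... | inj₂ x≡n = inj₂ (comp (inj₁ (refl , refl) , x≡n)
                       (comp (Iter-stop x≡n) (inj₁ (refl , refl) , x≡n) (sym (W.identityˡ _))) (sym (W.identityˡ _)))

-- Coverability

Covers : ∀ {d} (W : Mon) → Rel d W → Vec ℕ d → Vec ℕ d → Set
Covers W M t v = ∃[ w ] ∃[ c ] ∃[ z ] (Run W M v w c × c ≡ t +ᵛ z)

Covers-good : ∀ {d W} {M : Rel d W} t → GoodRel W (Run W M) → Good (Vecᴹ d) (Covers W M t)
Covers-good {d} {W} {M} t a = Good-map {X = XX} {h = λ (m , z) → source m}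
  (λ F → source-affine d W (p₁ F))
  (λ { (((v , w) , c) , z) ((r , _) , eq) → w , c , z , r , eq })
  (λ { v (w , c , z , r , eq) → (((v , w) , c) , z) , ((r , tt) , eq) , refl })
  (Good-solve {X = XX} (Vecˢ d) {u = λ (m , z) → target m} {v = λ (m , z) → t +ᵛ z}
    (λ F → target-affine d W (p₁ F)) (λ F → ∙-affine (Vecᴹ d) (const-affine (Vecᴹ d) t) (proj₂-affine (Triple d W) (Vecᴹ d) F))
    (Good-× a (full-space d)))
  where
  XX = Triple d W ×ᴹ Vecᴹ d
  p₁ = λ {n} {f} → proj₁-affine (Triple d W) (Vecᴹ d) {n} {f}

Covers-shift : ∀ {d W} {M : Rel d W} {t v} → Covers W M t v → ∀ z → Covers W M t (v +ᵛ z)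
Covers-shift {t = t} (w , _ , z , r , refl) z′ = w , _ , z +ᵛ z′ , Run-shift r z′ , V.assoc t z z′

StaysBelow : ∀ {d W} {M : Rel d W} (i : Fin d) (n : ℕ) {x w y} → Run W M x w y → Set
StaysBelow i n (stop {x})     = lookup x i < n
StaysBelow i n (step {x} s r) = lookup x i < n × StaysBelow i n r

StaysBelow⇒Below : ∀ {d W} {M : Rel d W} {i n x w y} (r : Run W M x w y) → StaysBelow i n r → Below W M i n x w y
StaysBelow⇒Below stop       b       = stop b
StaysBelow⇒Below (step s r) (b , p) = step b s (StaysBelow⇒Below r p)

StaysBelow-mono : ∀ {d W} {M : Rel d W} {i n n′ x w y} → n ≤ n′ → (r : Run W M x w y) → StaysBelow i n r → StaysBelow i n′ r
StaysBelow-mono le stop       b       = ℕₚ.≤-trans b le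
StaysBelow-mono le (step s r) (b , p) = ℕₚ.≤-trans b le , StaysBelow-mono le r p

lookup-removeAt : ∀ {n} (v : Vec ℕ (suc n)) i j → lookup (removeAt v i) j ≡ lookup v (punchIn i j)
lookup-removeAt (x ∷ v)         zero    j       = refl
lookup-removeAt (x ∷ v@(_ ∷ _)) (suc i) zero    = refl
lookup-removeAt (x ∷ v@(_ ∷ _)) (suc i) (suc j) = lookup-removeAt v i j

reassemble : ∀ {n} (t c : Vec ℕ (suc n)) z i → removeAt c i ≡ removeAt t i +ᵛ z → lookup t i ≤ lookup c i →
             c ≡ t +ᵛ insertAt z i (lookup c i ∸ lookup t i)
reassemble t c z i eq le = begin
  c                                                                  ≡⟨ Vecₚ.insertAt-removeAt c i ⟨
  insertAt (removeAt c i) i (lookup c i)                             ≡⟨ cong₂ (λ u x → insertAt u i x) eq (sym (ℕₚ.m+[n∸m]≡n le)) ⟩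
  insertAt (removeAt t i +ᵛ z) i (lookup t i + (lookup c i ∸ lookup t i)) ≡⟨ hom-∙ (insertAt-hom i) (lookup t i , removeAt t i) _ ⟩
  insertAt (removeAt t i) i (lookup t i) +ᵛ insertAt z i (lookup c i ∸ lookup t i) ≡⟨ cong (_+ᵛ insertAt z i (lookup c i ∸ lookup t i)) (Vecₚ.insertAt-removeAt t i) ⟩
  t +ᵛ insertAt z i (lookup c i ∸ lookup t i)                        ∎
  where open ≡-Reasoning

module _ {d : ℕ} {W : Mon} {M : Rel (suc d) W} (i : Fin (suc d)) where

  forget-run : ∀ {x w y} → Run W M x w y → Run W (Forget {W = W} i M) (removeAt x i) w (removeAt y i)
  forget-run stop = stop
  forget-run (step (fire {a} {b} z m refl refl) r) =
    step (fire (removeAt z i) (a , b , m , refl , refl) (hom-∙ (removeAt-hom i) a z) (hom-∙ (removeAt-hom i) b z))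
      (forget-run r)

  forget-stays : ∀ {j n x w y} (r : Run W M x w y) → StaysBelow j n (forget-run r) → StaysBelow (punchIn i j) n r
  forget-stays {j} {n} (stop {x}) b = subst (_< n) (lookup-removeAt x i j) b
  forget-stays {j} {n} (step {x} (fire {a} {b} z m refl refl) r) (b′ , p) =
    subst (_< n) (lookup-removeAt x i j) b′ , forget-stays r p

  -- A fixed run needs a bounded amount of counter `i`. The bound is collected from the end of the
  -- run, each firing adding what its move takes from that counter.
  lift-run : ∀ {u w c} → Run W (Forget {W = W} i M) u w c → ∀ L →
    ∃[ K ] (∀ v → removeAt v i ≡ u → K ≤ lookup v i →
      ∃[ c′ ] (Run W M v w c′ × removeAt c′ i ≡ c × L ≤ lookup c′ i))
  lift-run stop L = L , λ v eq le → v , stop , eq , le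
  lift-run (step (fire z (a , b , m , refl , refl) refl refl) r) L with lift-run r L
  ... | K , h = lookup a i + K , λ v eq le →
    let a≤v = ℕₚ.≤-trans (ℕₚ.m≤m+n _ K) le
        ζ = lookup v i ∸ lookup a i
        Z = insertAt z i ζ
        K≤ = ℕₚ.≤-trans (ℕₚ.m+n≤o⇒m≤o∸n K (subst (_≤ lookup v i) (ℕₚ.+-comm (lookup a i) K) le))
               (ℕₚ.≤-trans (ℕₚ.≤-reflexive (sym (Vecₚ.insertAt-lookup z i ζ)))
                 (ℕₚ.≤-trans (ℕₚ.m≤n+m _ (lookup b i)) (ℕₚ.≤-reflexive (sym (hom-∙ (lookup-hom i) b Z)))))
        (c′ , r′ , eq′ , le′) = h (b +ᵛ Z)
          (trans (hom-∙ (removeAt-hom i) b Z) (cong (_+ᵛ_ (removeAt b i)) (Vecₚ.removeAt-insertAt z i ζ))) K≤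
    in c′ , step (fire Z m (reassemble a v z i eq a≤v) refl) r′ , eq′ , le′

maximum : ∀ {n} (f : Fin n → ℕ) → ∃[ m ] (∀ i → f i ≤ m)
maximum {zero}  f = 0 , λ ()
maximum {suc n} f with maximum (f ∘ suc)
... | m , h = f zero ⊔ m , λ { zero → ℕₚ.m≤m⊔n _ m ; (suc i) → ℕₚ.≤-trans (h i) (ℕₚ.m≤n⊔m _ m) }

-- `lift-run` gives one bound for each `u`. It becomes uniform because the vectors that cover in the
-- smaller system form a Good set and a bound for `u` remains valid for all larger vectors, whose
-- surplus is added as a context.
covers-lift : ∀ {d W} {M : Rel (suc d) W} i t → GoodRel W (Run W (Forget {W = W} i M)) →
  ∃[ K ] (∀ v → Covers W (Forget {W = W} i M) (removeAt t i) (removeAt v i) → K ≤ lookup v i → Covers W M t v)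
covers-lift {d} {W} {M} i t a with uniform-bound P mono up witness (Covers-good (removeAt t i) a)
  where
  P : Vec ℕ d → ℕ → Set
  P u K = ∀ v → removeAt v i ≡ u → K ≤ lookup v i → Covers W M t v
  mono : ∀ u {k l} → k ≤ l → P u k → P u l
  mono u k≤l p v eq le = p v eq (ℕₚ.≤-trans k≤l le)
  up : ∀ u y {k} → P u k → P (u +ᵛ y) k
  up u y p v eq le = subst (Covers W M t) (sym split) (Covers-shift (p v₀ v₀-u
      (ℕₚ.≤-trans le (ℕₚ.≤-reflexive (sym (Vecₚ.insertAt-lookup u i (lookup v i)))))) (insertAt y i _))
    where
    v₀ = insertAt u i (lookup v i)
    v₀-u = Vecₚ.removeAt-insertAt u i (lookup v i)
    split = reassemble v₀ v y i (trans eq (cong (_+ᵛ y) (sym v₀-u)))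
              (ℕₚ.≤-reflexive (Vecₚ.insertAt-lookup u i (lookup v i)))
  witness : ∀ u → Covers W (Forget {W = W} i M) (removeAt t i) u → ∃[ k ] P u k
  witness u (w , c , z , r , eq) with lift-run i r (lookup t i)
  ... | K , h = K , λ v eq′ le → let (c′ , r′ , q , le′) = h v eq′ le in
    w , c′ , _ , r′ , reassemble t c′ z i (trans q eq) le′
... | K , h = K , λ v cv le → h (removeAt v i) cv v refl le

-- The bound is uniform in `v`, since it will be applied to a whole affine family of start
-- configurations; the coordinate may depend on the run.
Uncoverable : ℕ → Set₁
Uncoverable d = ∀ (W : Mon) (M : Rel d W) → GoodRel W M → ∀ t →
  ∃[ n ] (∀ {v w c} → ¬ Covers W M t v → (r : Run W M v w c) → ∃[ i ] StaysBelow i n r)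

uncoverable-zero : Uncoverable 0
uncoverable-zero W M a [] = 0 , λ { {[]} ¬c r → ⊥-elim (¬c (_ , _ , [] , stop , refl)) }

-- A value `n` of counter `i` has to suffice for lifting a covering run of the system without `i`,
-- and the same `n` has to bound a counter in each of these systems when they do not cover.
IsThreshold : ∀ {d} (W : Mon) (M : Rel (suc d) W) (t : Vec ℕ (suc d)) → ℕ → Set
IsThreshold W M t n = ∀ i →
  (∀ v → n ≤ lookup v i → Covers W (Forget {W = W} i M) (removeAt t i) (removeAt v i) → Covers W M t v) ×
  (∀ {v w c} → ¬ Covers W (Forget {W = W} i M) (removeAt t i) v → (r : Run W (Forget {W = W} i M) v w c) →
     ∃[ j ] StaysBelow j n r)

threshold : ∀ {d} → StarGood d → Uncoverable d → ∀ (W : Mon) (M : Rel (suc d) W) → GoodRel W M → ∀ t →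
            ∃[ n ] IsThreshold W M t n
threshold star uncov W M a t with maximum (λ i → proj₁ (lifts i) ⊔ proj₁ (stays i))
  where
  lifts = λ i → covers-lift {W = W} {M = M} i t (star W (Forget {W = W} i M) (Forget-good {W = W} i a))
  stays = λ i → uncov W (Forget {W = W} i M) (Forget-good {W = W} i a) (removeAt t i)
... | n , le = n , λ i →
    (λ v n≤ cv → proj₂ (covers-lift {W = W} {M = M} i t (star W (Forget {W = W} i M) (Forget-good {W = W} i a))) v cv
       (ℕₚ.≤-trans (ℕₚ.m≤m⊔n _ _) (ℕₚ.≤-trans (le i) n≤)))
  , (λ ¬c r → case proj₂ (uncov W (Forget {W = W} i M) (Forget-good {W = W} i a) (removeAt t i)) ¬c r of
       λ { (j , p) → j , StaysBelow-mono (ℕₚ.≤-trans (ℕₚ.m≤n⊔m _ _) (le i)) r p })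

-- Either some configuration has a large coordinate i, and then covering is decided by the system
-- without i; or all coordinates stay small.
module Threshold {d : ℕ} (star : StarGood d) (W : Mon) (M : Rel (suc d) W)
  (M-good : GoodRel W M) (t : Vec ℕ (suc d)) (n : ℕ) (n-threshold : IsThreshold W M t n) where

  private
    M⁻ : Fin (suc d) → Rel d W
    M⁻ i = Forget {W = W} i M
    M⁻-good : ∀ i → GoodRel W (M⁻ i)
    M⁻-good i = Forget-good {W = W} i M-good
    high = λ i → proj₁ (n-threshold i)

  high? : (v : Vec ℕ (suc d)) → (∃[ i ] n ≤ lookup v i) ⊎ (∀ i → lookup v i < n)
  high? v with Finₚ.any? (λ i → n ℕₚ.≤? lookup v i)
  ... | yes p = inj₁ p
  ... | no ¬p = inj₂ (λ i → ℕₚ.≰⇒> (λ le → ¬p (i , le)))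

  -- As long as all entries are below `n`, every coordinate is a candidate. At the first
  -- configuration with a large entry `i`, the system without `i` cannot cover either, and it names
  -- a coordinate that stays below `n` for the rest of the run.
  uncoverable : ∀ {v w c} → ¬ Covers W M t v → (r : Run W M v w c) → ∃[ i ] StaysBelow i n r
  uncoverable {v} ¬c r with high? v
  ... | inj₁ (i , le) with proj₂ (n-threshold i) (¬c ∘ high i v le) (forget-run i r)
  ...   | j , p = punchIn i j , forget-stays i r p
  uncoverable ¬c stop | inj₂ low = zero , low zero
  uncoverable ¬c (step s r) | inj₂ low
    with uncoverable (λ { (w , c , z , r′ , eq) → ¬c (_ , c , z , step s r′ , eq) }) r
  ... | j , p = j , low j , p

  Win : Vec ℕ (suc d) → Set
  Win c = (∃[ z ] c ≡ t +ᵛ z) ⊎ (∃[ i ] (Covers W (M⁻ i) (removeAt t i) (removeAt c i) × (∃[ ζ ] lookup c i ≡ n + ζ)))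

  -- Before the first large entry all coordinates are below `n`. Recording this for coordinate
  -- `zero` puts the prefix within reach of `Below-good`; the last firing is the one that may
  -- produce a large entry.
  Prefix : Rel (suc d) W
  Prefix v w c = Identity W v w c ⊎ Comp W (Below W M zero n) (Firing W M) v w c

  -- An equivalent of covering `t` that is Good by the results for dimension `d`. Applying
  -- `Covers-good` to `M` itself would presuppose `StarGood` in dimension `suc d`, which is still to
  -- be proved.
  Reaches : Vec ℕ (suc d) → Set
  Reaches v = ∃[ w ] ∃[ c ] (Prefix v w c × Win c)

  Win-good : Good (Vecᴹ (suc d)) Win
  Win-good = Good-∪ {R = λ c → ∃[ z ] c ≡ t +ᵛ z}
    (Good-map {X = Vecᴹ (suc d)} {h = t +ᵛ_} (∘-affine (shift-affine t)) (λ z _ → z , refl)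
      (λ { _ (z , refl) → z , tt , refl }) (full-space (suc d)))
    (Good-∃Fin {R = λ i c → Covers W (M⁻ i) (removeAt t i) (removeAt c i) × (∃[ ζ ] lookup c i ≡ n + ζ)}
      (λ i → Good-map {X = Vecᴹ d ×ᴹ Vecᴹ 1} {h = λ (u , ζ) → insertAt u i (n + Vec.head ζ)}
        (λ F → hom-affine (insertAt-hom i) (pair-affine
          (∙-affine ℕᴹ (const-affine ℕᴹ n) (hom-affine head-hom (proj₂-affine (Vecᴹ d) (Vecᴹ 1) F)))
          (proj₁-affine (Vecᴹ d) (Vecᴹ 1) F)))
        (λ { (u , ζ ∷ []) (cv , _) → subst (Covers W (M⁻ i) (removeAt t i)) (sym (Vecₚ.removeAt-insertAt u i (n + ζ))) cv
                                   , ζ , Vecₚ.insertAt-lookup u i (n + ζ) })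
        (λ { c (cv , ζ , eq) → (removeAt c i , ζ ∷ []) , (cv , tt)
                             , trans (cong (insertAt (removeAt c i) i) (sym eq)) (Vecₚ.insertAt-removeAt c i) })
        (Good-× (Covers-good (removeAt t i) (star W (M⁻ i) (M⁻-good i))) (full-space 1))))

  Reaches-good : Good (Vecᴹ (suc d)) Reaches
  Reaches-good = Good-map {X = XX} {h = λ (m , c) → source m} (λ F → source-affine (suc d) W (p₁ F))
    (λ { (((v , w) , c) , _) ((p , q) , refl) → w , c , p , q })
    (λ { v (w , c , p , q) → (((v , w) , c) , c) , ((p , q) , refl) , refl })
    (Good-solve {X = XX} (Vecˢ (suc d)) {u = λ (m , c) → target m} {v = proj₂}
      (λ F → target-affine (suc d) W (p₁ F)) (λ F → proj₂-affine (Triple (suc d) W) (Vecᴹ (suc d)) F)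
      (Good-× {R = λ m → Prefix (source m) (label m) (target m)}
        (Good-∪ (Identity-good W) (Comp-good (Below-good n) (Firing-good M-good))) Win-good))
    where
    open BelowGood star W M M-good zero using (Below-good)
    XX = Triple (suc d) W ×ᴹ Vecᴹ (suc d)
    p₁ = λ {n} {f} → proj₁-affine (Triple (suc d) W) (Vecᴹ (suc d)) {n} {f}

  reaches⇒covers : ∀ {v} → Reaches v → Covers W M t v
  reaches⇒covers (w , c , p , q) = let (w′ , c′ , z , r , eq) = win q in _ , c′ , z , Run-trans (prefix p) r , eq
    where
    prefix : ∀ {v w c} → Prefix v w c → Run W M v w c
    prefix (inj₁ (refl , refl)) = stop
    prefix (inj₂ (comp b s refl)) = Run-trans (Below⇒Run b) (Run-single s)
    win : ∀ {c} → Win c → Covers W M t c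
    win (inj₁ (z , eq)) = _ , _ , z , stop , eq
    win {c} (inj₂ (i , cv , ζ , eq)) = high i c (ℕₚ.≤-trans (ℕₚ.m≤m+n n ζ) (ℕₚ.≤-reflexive (sym eq))) cv

  covers⇒reaches : ∀ {v w c z} → Run W M v w c → c ≡ t +ᵛ z → Reaches v
  covers⇒reaches {v} {w} {c} {z} r eq with high? v
  ... | inj₁ (i , le) = _ , v , inj₁ (refl , refl) , inj₂ (i
        , (w , removeAt c i , removeAt z i , forget-run i r , trans (cong (λ u → removeAt u i) eq) (hom-∙ (removeAt-hom i) t z))
        , _ , sym (ℕₚ.m+[n∸m]≡n le))
  covers⇒reaches {v} {z = z} stop eq | inj₂ low = _ , v , inj₁ (refl , refl) , inj₁ (z , eq)
  covers⇒reaches (step s r) eq | inj₂ low with covers⇒reaches r eq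
  ... | _ , c , inj₁ (refl , refl) , q = _ , c , inj₂ (comp (stop (low zero)) s refl) , q
  ... | _ , c , inj₂ (comp b s′ refl) , q = _ , c , inj₂ (comp (step (low zero) s b) s′ refl) , q

uncoverable-suc : ∀ {d} → StarGood d → Uncoverable d → Uncoverable (suc d)
uncoverable-suc star uncov W M a t with threshold star uncov W M a t
... | n , thr = n , Threshold.uncoverable star W M a t n thr

-- The relation `Q` stands in for `Run`: it is sound everywhere and complete for runs that start in
-- the family `x`.
Dichotomy : ℕ → Set₁
Dichotomy d = ∀ (W : Mon) (M : Rel d W) → GoodRel W M → ∀ t {h} {x : Vec ℕ h → Vec ℕ d} → Affine (Vecᴹ d) x →
  (∃[ η ] Covers W M t (x η)) ⊎
  (Σ[ Q ∈ Rel d W ] (GoodRel W Q × (∀ {v w c} → Q v w c → Run W M v w c) ×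
     (∀ η {w c} → Run W M (x η) w c → Q (x η) w c)))

dichotomy-zero : Dichotomy 0
dichotomy-zero W M a [] {x = x} X = inj₁ (0ᵛ , _ , x 0ᵛ , [] , stop , []≡ (x 0ᵛ))
  where
  []≡ : ∀ (v : Vec ℕ 0) → v ≡ []
  []≡ [] = refl

dichotomy-suc : ∀ {d} → StarGood d → Uncoverable d → Dichotomy (suc d)
dichotomy-suc {d} star uncov W M a t {h} {x} X = main (threshold star uncov W M a t)
  where
  module _ (n : ℕ) (thr : IsThreshold W M t n) where
    open Threshold star W M a t n thr

    Result : Set₁
    Result = (∃[ η ] Covers W M t (x η)) ⊎
      (Σ[ Q ∈ Rel (suc d) W ] (GoodRel W Q × (∀ {v w c} → Q v w c → Run W M v w c) ×
         (∀ η {w c} → Run W M (x η) w c → Q (x η) w c)))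

    Low : Rel (suc d) W
    Low v w c = ∃[ i ] Below W M i n v w c

    Low-good : GoodRel W Low
    Low-good = Good-∃Fin (λ i → BelowGood.Below-good star W M a i n)

    low : (∀ η → ¬ Reaches (x η)) → ∀ η {w c} → Run W M (x η) w c → Low (x η) w c
    low ¬p η r = case uncoverable (λ { (_ , _ , _ , r′ , eq) → ¬p η (covers⇒reaches r′ eq) }) r of
      λ { (i , s) → i , StaysBelow⇒Below r s }

    decide : (∃[ η ] Reaches (x η)) ⊎ (∀ η → ¬ Reaches (x η)) → Result
    decide (inj₁ (η , p)) = inj₁ (η , reaches⇒covers p)
    decide (inj₂ ¬p)      = inj₂ (Low , Low-good , (λ { (i , b) → Below⇒Run b }) , low ¬p)

    result : Result
    result = decide (inhabited? (Good-pull (Vecˢ (suc d)) X Reaches-good))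

  main : ∃[ n ] IsThreshold W M t n → _
  main (n , thr) = result n thr

-- Parikh vectors: how often each piece of a Good set is used, and the total of its parameters.

Parikh : ∀ {X R} → Good X R → Space
Parikh (empty _)             = ⊤ˢ
Parikh (piece {n} _ _ _ _)   = ℕˢ ×ˢ Vecˢ n
Parikh (union a b _ _ _)     = Parikh a ×ˢ Parikh b

Parikhᴹ : ∀ {X R} → Good X R → Mon
Parikhᴹ G = mon (Parikh G)

·-hom : ∀ X (c : Car X) → Hom ℕᴹ X (λ k → Mon._·_ X k c)
·-hom X c = record { hom-ε = refl ; hom-∙ = λ k l → Mon.·-+ X k l c }

evaluate : ∀ {X R} (G : Good X R) → Car (Parikhᴹ G) → Car X
evaluate {X} (empty _) _               = Mon.ε X
evaluate {X} (piece _ F _ _) (m , N)   = Mon._∙_ X (Mon._·_ X m (base F)) (Mon.lin X N (periods F))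
evaluate {X} (union a b _ _ _) (u , v) = Mon._∙_ X (evaluate a u) (evaluate b v)

evaluate-hom : ∀ {X R} (G : Good X R) → Hom (Parikhᴹ G) X (evaluate G)
evaluate-hom {X} (empty _)         = const-hom ⊤ᴹ X
evaluate-hom {X} (piece {n} _ F _ _) = ∘-hom (∙-hom X)
  (pair-hom (∘-hom (·-hom X (base F)) (proj₁-hom ℕᴹ (Vecᴹ n))) (∘-hom (lin-hom X (periods F)) (proj₂-hom ℕᴹ (Vecᴹ n))))
evaluate-hom {X} (union a b _ _ _) = ∘-hom (∙-hom X)
  (pair-hom (∘-hom (evaluate-hom a) (proj₁-hom (Parikhᴹ a) (Parikhᴹ b)))
            (∘-hom (evaluate-hom b) (proj₂-hom (Parikhᴹ a) (Parikhᴹ b))))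

Generator : ∀ {X R} (G : Good X R) → Car (Parikhᴹ G) → Set
Generator (empty _)                   _       = ⊥
Generator (piece {T = T} _ _ _ _)     (m , N) = m ≡ 1 × T N
Generator (union a b _ _ _)           (u , v) =
  (Generator a u × v ≡ Mon.ε (Parikhᴹ b)) ⊎ (u ≡ Mon.ε (Parikhᴹ a) × Generator b v)

single : ∀ {X n} {f : Vec ℕ n → Car X} (F : Affine X f) N →
         Mon._∙_ X (Mon._·_ X 1 (base F)) (Mon.lin X N (periods F)) ≡ f N
single {X} F N = trans (cong (λ c → Mon._∙_ X c (Mon.lin X N (periods F))) (Mon.identityʳ X (base F))) (sym (expand F N))

generator-sound : ∀ {X R} (G : Good X R) u → Generator G u → R (evaluate G u)
generator-sound {R = R} (piece _ F s _) (_ , N) (refl , p) = subst R (sym (single F N)) (s N p)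
generator-sound {X} {R} (union a b i j _) (u , _) (inj₁ (p , refl)) =
  subst R (sym (trans (cong (Mon._∙_ X (evaluate a u)) (hom-ε (evaluate-hom b))) (Mon.identityʳ X _)))
    (i _ (generator-sound a u p))
generator-sound {X} {R} (union a b i j _) (_ , v) (inj₂ (refl , p)) =
  subst R (sym (trans (cong (λ c → Mon._∙_ X c (evaluate b v)) (hom-ε (evaluate-hom a))) (Mon.identityˡ X _)))
    (j _ (generator-sound b v p))

generator-complete : ∀ {X R} (G : Good X R) x → R x → ∃[ u ] (Generator G u × evaluate G u ≡ x)
generator-complete (empty e) x p = ⊥-elim (e x p)
generator-complete (piece _ F _ c) x p with c x p
... | t , q , eq = (1 , t) , (refl , q) , trans (single F t) eq
generator-complete {X} (union a b _ _ c) x p with c x p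
... | inj₁ p₁ = case generator-complete a x p₁ of λ { (u , q , eq) →
      (u , Mon.ε (Parikhᴹ b)) , inj₁ (q , refl)
    , trans (cong₂ (Mon._∙_ X) eq (hom-ε (evaluate-hom b))) (Mon.identityʳ X _) }
... | inj₂ p₂ = case generator-complete b x p₂ of λ { (v , q , eq) →
      (Mon.ε (Parikhᴹ a) , v) , inj₂ (refl , q)
    , trans (cong₂ (Mon._∙_ X) (hom-ε (evaluate-hom a)) eq) (Mon.identityˡ X _) }

record Parametrized (X : Mon) : Set where
  field
    {dim}       : ℕ
    {param}     : Vec ℕ dim → Car X
    affine      : Affine X param
    surjective  : ∀ x → ∃[ t ] param t ≡ x

open Parametrized

param-× : ∀ {X Y} → Parametrized X → Parametrized Y → Parametrized (X ×ᴹ Y)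
param-× A B = record
  { affine = pair-affine (∘-affine (affine A) (take-affine (dim A))) (∘-affine (affine B) (drop-affine (dim A)))
  ; surjective = λ (x , y) → case surjective A x , surjective B y of λ { ((u , refl) , (v , refl)) →
      u ++ v , cong₂ _,_ (cong (param A) (take-++ u v)) (cong (param B) (drop-++ u v)) } }

param-Vec : ∀ n → Parametrized (Vecᴹ n)
param-Vec n = record { affine = id-affine ; surjective = λ v → v , refl }

param-Parikh : ∀ {X R} (G : Good X R) → Parametrized (Parikhᴹ G)
param-Parikh (empty _)             = record { affine = const-affine ⊤ᴹ {0} tt ; surjective = λ _ → [] , refl }
param-Parikh (piece {n} _ _ _ _)   =
  param-× {ℕᴹ} {Vecᴹ n} (record { affine = lift-affine {ℕᴹ} {1} head-hom ; surjective = λ k → k ∷ [] , refl }) (param-Vec n)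
param-Parikh (union a b _ _ _)     = param-× (param-Parikh a) (param-Parikh b)

data Bag {P : Mon} (Gen : Car P → Set) : Car P → Set where
  nil  : Bag Gen (Mon.ε P)
  cons : ∀ {u v} → Gen u → Bag {P} Gen v → Bag Gen (Mon._∙_ P u v)

bag-++ : ∀ {P : Mon} {Gen : Car P → Set} {u v} → Bag {P} Gen u → Bag {P} Gen v → Bag {P} Gen (Mon._∙_ P u v)
bag-++ {P} {Gen} nil        c = subst (Bag {P} Gen) (sym (Mon.identityˡ P _)) c
bag-++ {P} {Gen} (cons g b) c = subst (Bag {P} Gen) (sym (Mon.assoc P _ _ _)) (cons g (bag-++ b c))

bag-hom : ∀ {P Q : Mon} {Gen : Car P → Set} {Gen′ : Car Q → Set} {h : Car P → Car Q} → Hom P Q h →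
          (∀ u → Gen u → Gen′ (h u)) → ∀ {u} → Bag {P} Gen u → Bag {Q} Gen′ (h u)
bag-hom {Q = Q} {Gen′ = Gen′} H f nil        = subst (Bag {Q} Gen′) (sym (hom-ε H)) nil
bag-hom {Q = Q} {Gen′ = Gen′} H f (cons g b) = subst (Bag {Q} Gen′) (sym (hom-∙ H _ _)) (cons (f _ g) (bag-hom H f b))

-- The condition on a direction that lets every piece be used more often, with growth in all
-- parameters, so that `Full` applies to the parameter totals.
AllUsed : ∀ {X R} (G : Good X R) → Car (Parikhᴹ G) → Set
AllUsed (empty _)             _       = ⊤
AllUsed (piece _ _ _ _)       (m , N) = 1 ≤ m × Positive N
AllUsed (union a b _ _ _)     (u , v) = AllUsed a u × AllUsed b v

pointwise-≤ : ∀ {n} (u v : Vec ℕ n) → (∀ i → lookup u i ≤ lookup v i) → ∃[ z ] v ≡ u +ᵛ z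
pointwise-≤ u v le with ≤ᵛ? u v
... | inj₁ (z , eq)  = z , sym eq
... | inj₂ (q , lt)  = ⊥-elim (ℕₚ.<-irrefl refl (ℕₚ.<-≤-trans lt (le q)))

·-lookup : ∀ {n} k (w : Vec ℕ n) i → lookup (k ·ᵛ w) i ≡ k * lookup w i
·-lookup zero    w i = Vecₚ.lookup-replicate i 0
·-lookup (suc k) w i = trans (hom-∙ (lookup-hom i) w (k ·ᵛ w)) (cong (_+_ (lookup w i)) (·-lookup k w i))

·-positive : ∀ {n} k (w : Vec ℕ n) → Positive w → ∀ i → k ≤ lookup (k ·ᵛ w) i
·-positive k w pos i = ℕₚ.≤-trans (ℕₚ.≤-reflexive (sym (ℕₚ.*-identityʳ k)))
  (ℕₚ.≤-trans (ℕₚ.*-monoʳ-≤ k (pos i)) (ℕₚ.≤-reflexive (sym (·-lookup k w i))))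

exceeds : ∀ {n} (v w : Vec ℕ n) → Positive w → Eventually (λ k → ∃[ z ] k ·ᵛ w ≡ v +ᵛ z)
exceeds v w pos with maximum (lookup v)
... | K , h = K , λ k le → pointwise-≤ v (k ·ᵛ w) (λ i → ℕₚ.≤-trans (h i) (ℕₚ.≤-trans le (·-positive k w pos i)))

-- Since 0 is a parameter of every piece, one generator carries the whole parameter total.
realize : ∀ {X R} (G : Good X R) Ψ₀ Ψ₁ Δ → AllUsed G Δ →
  Eventually (λ k → ∃[ Ψ ] (Mon._∙_ (Parikhᴹ G) Ψ Ψ₁ ≡ Mon._∙_ (Parikhᴹ G) Ψ₀ (Mon._·_ (Parikhᴹ G) k Δ)
                           × Bag {Parikhᴹ G} (Generator G) Ψ))
realize (empty _) _ _ _ _ = 0 , λ k _ → tt , refl , nil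
realize (piece {n} {T} (node z full _) F _ _) (m₀ , N₀) (m₁ , N₁) (dm , dN) (dm≥1 , dN≥1)
  with exceeds N₁ dN dN≥1
... | s , h with h s ℕₚ.≤-refl
...   | x , eq with full (N₀ +ᵛ x) dN dN≥1
...     | K , T-end = (K + s) ⊔ suc m₁ , λ k le →
  -- The wanted vector is Ψ₀ + kΔ - Ψ₁. From s dN = N₁ + x its parameter total becomes (N₀ + x) + (k
  -- - s) dN, a point of a ray on which `full` was invoked. Of the `suc m` uses, one carries this
  -- total `N` and the other `m` carry 0.
  let k₁ = k ∸ s
      s≤k = ℕₚ.≤-trans (ℕₚ.m≤n+m s K) (ℕₚ.≤-trans (ℕₚ.m≤m⊔n (K + s) (suc m₁)) le)
      K≤k₁ = ℕₚ.m+n≤o⇒m≤o∸n K (ℕₚ.≤-trans (ℕₚ.m≤m⊔n (K + s) (suc m₁)) le)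
      m₁<k = ℕₚ.≤-trans (ℕₚ.m≤n⊔m (K + s) (suc m₁)) le
      count = ℕₚ.≤-trans m₁<k (ℕₚ.≤-trans (·-positive′ k) (ℕₚ.m≤n+m _ m₀))
      m = m₀ + k ·ℕ dm ∸ suc m₁
      N = N₀ +ᵛ x +ᵛ k₁ ·ᵛ dN
  in (suc m , N)
   , cong₂ _,_
        (trans (sym (ℕₚ.+-suc m m₁)) (trans (ℕₚ.m∸n+n≡m count) (cong (_+_ m₀) (fst-· k))))
        (trans (total k₁) (cong (_+ᵛ_ N₀) (trans (sym (V.·-+ s k₁ dN)) (trans (cong (_·ᵛ dN) (ℕₚ.m+[n∸m]≡n s≤k)) (snd-· k)))))
   , subst (Bag {P} Gen) (cong₂ _,_ (cong suc (trans (cong (_+ 0) (fst-ones m)) (ℕₚ.+-identityʳ m)))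
       (trans (cong (N +ᵛ_) (trans (V.identityʳ _) (snd-ones m))) (V.identityʳ N)))
       (cons {u = 1 , N} (refl , T-end k₁ K≤k₁) (bag-++ (ones m) nil))
  where
  P = ℕᴹ ×ᴹ Vecᴹ n
  Gen : ℕ × Vec ℕ n → Set
  Gen (m , N) = m ≡ 1 × T N
  _·ℕ_ = Mon._·_ ℕᴹ
  _·ᴾ_ = Mon._·_ P
  fst-· : ∀ k → k ·ℕ dm ≡ proj₁ (k ·ᴾ (dm , dN))
  fst-· k = sym (hom-· (proj₁-hom ℕᴹ (Vecᴹ n)) k (dm , dN))
  snd-· : ∀ k → k ·ᵛ dN ≡ proj₂ (k ·ᴾ (dm , dN))
  snd-· k = sym (hom-· (proj₂-hom ℕᴹ (Vecᴹ n)) k (dm , dN))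
  ·-positive′ : ∀ k → k ≤ k ·ℕ dm
  ·-positive′ zero    = z≤n
  ·-positive′ (suc k) = ℕₚ.+-mono-≤ dm≥1 (·-positive′ k)
  total : ∀ k → N₀ +ᵛ x +ᵛ k ·ᵛ dN +ᵛ N₁ ≡ N₀ +ᵛ (s ·ᵛ dN +ᵛ k ·ᵛ dN)
  total k = begin
    N₀ +ᵛ x +ᵛ k ·ᵛ dN +ᵛ N₁     ≡⟨ V.assoc (N₀ +ᵛ x) _ N₁ ⟩
    N₀ +ᵛ x +ᵛ (k ·ᵛ dN +ᵛ N₁)   ≡⟨ V.assoc N₀ x _ ⟩
    N₀ +ᵛ (x +ᵛ (k ·ᵛ dN +ᵛ N₁)) ≡⟨ cong (N₀ +ᵛ_) (trans (cong (x +ᵛ_) (V.comm _ N₁)) (sym (V.assoc x N₁ _))) ⟩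
    N₀ +ᵛ (x +ᵛ N₁ +ᵛ k ·ᵛ dN)   ≡⟨ cong (λ y → N₀ +ᵛ (y +ᵛ k ·ᵛ dN)) (trans (V.comm x N₁) (sym eq)) ⟩
    N₀ +ᵛ (s ·ᵛ dN +ᵛ k ·ᵛ dN)   ∎
    where open ≡-Reasoning
  ones : ∀ m → Bag {P} Gen (m ·ᴾ (1 , 0ᵛ))
  ones zero    = nil
  ones (suc m) = cons (refl , z) (ones m)
  fst-ones : ∀ m → proj₁ (m ·ᴾ (1 , 0ᵛ)) ≡ m
  fst-ones zero    = refl
  fst-ones (suc m) = cong suc (fst-ones m)
  snd-ones : ∀ m → proj₂ (m ·ᴾ (1 , 0ᵛ)) ≡ 0ᵛ
  snd-ones zero    = refl
  snd-ones (suc m) = trans (V.identityˡ _) (snd-ones m)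
realize (union a b _ _ _) (u₀ , v₀) (u₁ , v₁) (du , dv) (pu , pv)
  with eventually-∧ (realize a u₀ u₁ du pu) (realize b v₀ v₁ dv pv)
... | K , h = K , λ k le → case h k le of λ { ((u , eq , bu) , (v , eq′ , bv)) →
    (u , v)
  , cong₂ _,_ (trans eq (cong (A._∙_ u₀) (sym (hom-· (proj₁-hom (Parikhᴹ a) (Parikhᴹ b)) k (du , dv)))))
              (trans eq′ (cong (B._∙_ v₀) (sym (hom-· (proj₂-hom (Parikhᴹ a) (Parikhᴹ b)) k (du , dv)))))
  , subst (Bag {Parikhᴹ a ×ᴹ Parikhᴹ b} _) (cong₂ _,_ (A.identityʳ u) (B.identityˡ v))
      (bag-++ (bag-hom (pair-hom (id-hom (Parikhᴹ a)) (const-hom (Parikhᴹ a) (Parikhᴹ b))) (λ _ g → inj₁ (g , refl)) bu)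
              (bag-hom (pair-hom (const-hom (Parikhᴹ b) (Parikhᴹ a)) (id-hom (Parikhᴹ b))) (λ _ g → inj₂ (refl , g)) bv)) }
  where
  module A = Mon (Parikhᴹ a)
  module B = Mon (Parikhᴹ b)

-- Pumping: σᵃ β πᵃ τᵃ, where σ and τ enlarge all coordinates and π has the Parikh vector needed to
-- compensate for σ and τ. Since the initial and final configurations of πᵃ both exceed a in all
-- coordinates, so do all configurations between the copies of π.

module Pumping {d : ℕ} {P : Mon} (Gen : Car P → Set) (In Out : Car P → Vec ℕ d)
  (In-hom : Hom P (Vecᴹ d) In) (Out-hom : Hom P (Vecᴹ d) Out) where
  private module P = Mon P

  Moves : Rel d P
  Moves x u y = Gen u × x ≡ In u × y ≡ Out u

  -- The start contains the inputs of all generators at once, so none of them has to wait for the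
  -- output of another.
  bag-run : ∀ {u} → Bag {P} Gen u → ∀ z → Run P Moves (In u +ᵛ z) u (Out u +ᵛ z)
  bag-run nil z rewrite hom-ε In-hom | hom-ε Out-hom = stop
  bag-run (cons {u} {v} g b) z = step
    (fire (In v +ᵛ z) (g , refl , refl)
      (trans (cong (_+ᵛ z) (hom-∙ In-hom u v)) (V.assoc (In u) (In v) z)) refl)
    (subst₂ (λ x y → Run P Moves x v y)
      (trans (sym (V.assoc (In v) (Out u) z)) (trans (cong (_+ᵛ z) (V.comm (In v) (Out u))) (V.assoc (Out u) (In v) z)))
      (trans (sym (V.assoc (Out v) (Out u) z))
        (cong (_+ᵛ z) (trans (V.comm (Out v) (Out u)) (sym (hom-∙ Out-hom u v)))))
      (bag-run b (Out u +ᵛ z)))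

  private
    open import Algebra.Solver.CommutativeMonoid (Mon.commutativeMonoid (Vecᴹ d)) as S using (_⊕_; _⊜_)
    module PS where
      open import Algebra.Solver.CommutativeMonoid (Mon.commutativeMonoid P) public

  cancelˡ : ∀ {n} (u : Vec ℕ n) {v w} → u +ᵛ v ≡ u +ᵛ w → v ≡ w
  cancelˡ []      {[]}    {[]}    _  = refl
  cancelˡ (x ∷ u) {y ∷ v} {z ∷ w} eq =
    cong₂ _∷_ (ℕₚ.+-cancelˡ-≡ x y z (cong Vec.head eq)) (cancelˡ u (cong Vec.tail eq))

  -- The state equation in subtraction-free form; each firing trades its input for its output.
  flow : ∀ {x u y} → Run P Moves x u y → x +ᵛ Out u ≡ y +ᵛ In u
  flow {x} stop = cong (x +ᵛ_) (trans (hom-ε Out-hom) (sym (hom-ε In-hom)))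
  flow {y = y} (step {v = u} {w = v} (fire z (g , refl , refl) refl refl) r) = begin
    In u +ᵛ z +ᵛ Out (u P.∙ v)      ≡⟨ cong (In u +ᵛ z +ᵛ_) (hom-∙ Out-hom u v) ⟩
    In u +ᵛ z +ᵛ (Out u +ᵛ Out v)   ≡⟨ S.solve 4 (λ a z b c → (a ⊕ z) ⊕ (b ⊕ c) ⊜ a ⊕ ((b ⊕ z) ⊕ c)) refl (In u) z (Out u) (Out v) ⟩
    In u +ᵛ (Out u +ᵛ z +ᵛ Out v)   ≡⟨ cong (In u +ᵛ_) (flow r) ⟩
    In u +ᵛ (y +ᵛ In v)             ≡⟨ S.solve 3 (λ a y b → a ⊕ (y ⊕ b) ⊜ y ⊕ (a ⊕ b)) refl (In u) y (In v) ⟩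
    y +ᵛ (In u +ᵛ In v)             ≡⟨ cong (y +ᵛ_) (hom-∙ In-hom u v) ⟨
    y +ᵛ In (u P.∙ v)               ∎
    where open ≡-Reasoning

  -- The hypothesis `D +ᵛ c ≡ p +ᵛ E` says E = D + (c - p) without subtraction: one run of the pump
  -- turns one `D` into one `E`. The other copies are context, so the losses of the pump are paid
  -- from its own `D`.
  iterate-up : ∀ {p c ψ D E x′} → Run P Moves p ψ c → D +ᵛ c ≡ p +ᵛ E → ∀ a {x} → x ≡ p +ᵛ x′ →
               Run P Moves (x +ᵛ a ·ᵛ D) (a P.· ψ) (x +ᵛ a ·ᵛ E)
  iterate-up σ eq zero q = stop
  iterate-up {p} {c} {ψ} {D} {E} {x′} σ eq (suc a) {x} q = Run-trans
    (subst₂ (λ u v → Run P Moves u ψ v) start mid (Run-shift σ (x′ +ᵛ D +ᵛ a ·ᵛ D)))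
    (subst (λ v → Run P Moves (x +ᵛ a ·ᵛ D +ᵛ E) (a P.· ψ) v) end (Run-shift (iterate-up σ eq a q) E))
    where
    open ≡-Reasoning
    start : p +ᵛ (x′ +ᵛ D +ᵛ a ·ᵛ D) ≡ x +ᵛ (D +ᵛ a ·ᵛ D)
    start = trans (S.solve 4 (λ p x D aD → p ⊕ ((x ⊕ D) ⊕ aD) ⊜ (p ⊕ x) ⊕ (D ⊕ aD)) refl p x′ D (a ·ᵛ D))
      (cong (_+ᵛ (D +ᵛ a ·ᵛ D)) (sym q))
    mid : c +ᵛ (x′ +ᵛ D +ᵛ a ·ᵛ D) ≡ x +ᵛ a ·ᵛ D +ᵛ E
    mid = begin
      c +ᵛ (x′ +ᵛ D +ᵛ a ·ᵛ D) ≡⟨ S.solve 4 (λ c x D aD → c ⊕ ((x ⊕ D) ⊕ aD) ⊜ (D ⊕ c) ⊕ (x ⊕ aD)) refl c x′ D (a ·ᵛ D) ⟩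
      D +ᵛ c +ᵛ (x′ +ᵛ a ·ᵛ D) ≡⟨ cong (_+ᵛ (x′ +ᵛ a ·ᵛ D)) eq ⟩
      p +ᵛ E +ᵛ (x′ +ᵛ a ·ᵛ D) ≡⟨ S.solve 4 (λ p E x aD → (p ⊕ E) ⊕ (x ⊕ aD) ⊜ ((p ⊕ x) ⊕ aD) ⊕ E) refl p E x′ (a ·ᵛ D) ⟩
      p +ᵛ x′ +ᵛ a ·ᵛ D +ᵛ E   ≡⟨ cong (λ y → y +ᵛ a ·ᵛ D +ᵛ E) q ⟨
      x +ᵛ a ·ᵛ D +ᵛ E         ∎
    end : x +ᵛ a ·ᵛ E +ᵛ E ≡ x +ᵛ (E +ᵛ a ·ᵛ E)
    end = S.solve 3 (λ x E aE → (x ⊕ aE) ⊕ E ⊜ x ⊕ (E ⊕ aE)) refl x E (a ·ᵛ E)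

  iterate-down : ∀ {c q ψ D E y′} → Run P Moves c ψ q → D +ᵛ c ≡ q +ᵛ E → ∀ a {y} → y ≡ q +ᵛ y′ →
                 Run P Moves (y +ᵛ a ·ᵛ E) (a P.· ψ) (y +ᵛ a ·ᵛ D)
  iterate-down τ eq zero q = stop
  iterate-down {c} {q} {ψ} {D} {E} {y′} τ eq (suc a) {y} r = subst (λ w → Run P Moves _ w _) (P.comm _ ψ) (Run-trans
    (subst₂ (λ u v → Run P Moves u (a P.· ψ) v) start mid (Run-shift (iterate-down τ eq a r) E))
    (subst (λ v → Run P Moves (c +ᵛ (y′ +ᵛ D +ᵛ a ·ᵛ D)) ψ v) end (Run-shift τ (y′ +ᵛ D +ᵛ a ·ᵛ D))))
    where
    open ≡-Reasoning
    start : y +ᵛ a ·ᵛ E +ᵛ E ≡ y +ᵛ (E +ᵛ a ·ᵛ E)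
    start = S.solve 3 (λ x E aE → (x ⊕ aE) ⊕ E ⊜ x ⊕ (E ⊕ aE)) refl y E (a ·ᵛ E)
    mid : y +ᵛ a ·ᵛ D +ᵛ E ≡ c +ᵛ (y′ +ᵛ D +ᵛ a ·ᵛ D)
    mid = begin
      y +ᵛ a ·ᵛ D +ᵛ E         ≡⟨ cong (λ y → y +ᵛ a ·ᵛ D +ᵛ E) r ⟩
      q +ᵛ y′ +ᵛ a ·ᵛ D +ᵛ E   ≡⟨ S.solve 4 (λ p E x aD → (p ⊕ E) ⊕ (x ⊕ aD) ⊜ ((p ⊕ x) ⊕ aD) ⊕ E) refl q E y′ (a ·ᵛ D) ⟨
      q +ᵛ E +ᵛ (y′ +ᵛ a ·ᵛ D) ≡⟨ cong (_+ᵛ (y′ +ᵛ a ·ᵛ D)) eq ⟨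
      D +ᵛ c +ᵛ (y′ +ᵛ a ·ᵛ D) ≡⟨ S.solve 4 (λ c x D aD → c ⊕ ((x ⊕ D) ⊕ aD) ⊜ (D ⊕ c) ⊕ (x ⊕ aD)) refl c y′ D (a ·ᵛ D) ⟨
      c +ᵛ (y′ +ᵛ D +ᵛ a ·ᵛ D) ∎
    end : q +ᵛ (y′ +ᵛ D +ᵛ a ·ᵛ D) ≡ y +ᵛ (D +ᵛ a ·ᵛ D)
    end = trans (S.solve 4 (λ p x D aD → p ⊕ ((x ⊕ D) ⊕ aD) ⊜ (p ⊕ x) ⊕ (D ⊕ aD)) refl q y′ D (a ·ᵛ D))
      (cong (_+ᵛ (D +ᵛ a ·ᵛ D)) (sym r))

  -- Here `l` copies are still to be fired and `m` are done. The sum `l + m` is invariant, and each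
  -- of these summands contributes at least `1ᵛ`, which together pay for `In u`.
  iterate-middle : ∀ {u} → Bag {P} Gen u → ∀ {ρ ρ′} → 1ᵛ +ᵛ ρ +ᵛ Out u ≡ 1ᵛ +ᵛ ρ′ +ᵛ In u →
    ∀ {K} → (∀ k → K ≤ k → ∃[ z ] k ·ᵛ 1ᵛ ≡ In u +ᵛ z) → ∀ y l m → K ≤ l + m →
    Run P Moves (y +ᵛ l ·ᵛ (1ᵛ +ᵛ ρ) +ᵛ m ·ᵛ (1ᵛ +ᵛ ρ′)) (l P.· u) (y +ᵛ (l + m) ·ᵛ (1ᵛ +ᵛ ρ′))
  iterate-middle b eq fits y zero m K≤ =
    subst (λ v → Run P Moves v _ (y +ᵛ m ·ᵛ _)) (cong (_+ᵛ m ·ᵛ _) (sym (V.identityʳ y))) stop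
  iterate-middle {u} b {ρ} {ρ′} eq fits y (suc l) m K≤ with fits (suc l + m) K≤
  ... | z , fz = Run-trans
    (subst₂ (λ x y → Run P Moves x u y) start mid (bag-run b (z +ᵛ slack)))
    (subst (λ k → Run P Moves (y +ᵛ l ·ᵛ E +ᵛ suc m ·ᵛ E′) (l P.· u) (y +ᵛ k ·ᵛ E′)) (ℕₚ.+-suc l m)
      (iterate-middle b {ρ} {ρ′} eq fits y l (suc m) (ℕₚ.≤-trans K≤ (ℕₚ.≤-reflexive (sym (ℕₚ.+-suc l m))))))
    where
    open ≡-Reasoning
    E  = 1ᵛ +ᵛ ρ
    E′ = 1ᵛ +ᵛ ρ′
    slack = y +ᵛ suc l ·ᵛ ρ +ᵛ m ·ᵛ ρ′
    rest = y +ᵛ l ·ᵛ E +ᵛ m ·ᵛ E′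
    start : In u +ᵛ (z +ᵛ slack) ≡ y +ᵛ suc l ·ᵛ E +ᵛ m ·ᵛ E′
    start = begin
      In u +ᵛ (z +ᵛ slack)        ≡⟨ V.assoc (In u) z slack ⟨
      In u +ᵛ z +ᵛ slack          ≡⟨ cong (_+ᵛ slack) fz ⟨
      (suc l + m) ·ᵛ 1ᵛ +ᵛ slack  ≡⟨ cong (_+ᵛ slack) (V.·-+ (suc l) m 1ᵛ) ⟩
      suc l ·ᵛ 1ᵛ +ᵛ m ·ᵛ 1ᵛ +ᵛ slack
        ≡⟨ S.solve 5 (λ a b y c e → (a ⊕ b) ⊕ ((y ⊕ c) ⊕ e) ⊜ (y ⊕ (a ⊕ c)) ⊕ (b ⊕ e)) refl
             (suc l ·ᵛ 1ᵛ) (m ·ᵛ 1ᵛ) y (suc l ·ᵛ ρ) (m ·ᵛ ρ′) ⟩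
      y +ᵛ (suc l ·ᵛ 1ᵛ +ᵛ suc l ·ᵛ ρ) +ᵛ (m ·ᵛ 1ᵛ +ᵛ m ·ᵛ ρ′)
        ≡⟨ cong₂ (λ a b → y +ᵛ a +ᵛ b) (V.·-∙ (suc l) 1ᵛ ρ) (V.·-∙ m 1ᵛ ρ′) ⟨
      y +ᵛ suc l ·ᵛ E +ᵛ m ·ᵛ E′ ∎
    mid : Out u +ᵛ (z +ᵛ slack) ≡ y +ᵛ l ·ᵛ E +ᵛ suc m ·ᵛ E′
    mid = trans (cancelˡ (In u) (begin
      In u +ᵛ (Out u +ᵛ (z +ᵛ slack))
        ≡⟨ S.solve 3 (λ i o z → i ⊕ (o ⊕ z) ⊜ o ⊕ (i ⊕ z)) refl (In u) (Out u) (z +ᵛ slack) ⟩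
      Out u +ᵛ (In u +ᵛ (z +ᵛ slack)) ≡⟨ cong (Out u +ᵛ_) start ⟩
      Out u +ᵛ (y +ᵛ (E +ᵛ l ·ᵛ E) +ᵛ m ·ᵛ E′)
        ≡⟨ S.solve 5 (λ o y e a b → o ⊕ ((y ⊕ (e ⊕ a)) ⊕ b) ⊜ (e ⊕ o) ⊕ ((y ⊕ a) ⊕ b)) refl (Out u) y E (l ·ᵛ E) (m ·ᵛ E′) ⟩
      E +ᵛ Out u +ᵛ rest              ≡⟨ cong (_+ᵛ rest) eq ⟩
      E′ +ᵛ In u +ᵛ rest              ≡⟨ S.solve 3 (λ e i r → (e ⊕ i) ⊕ r ⊜ i ⊕ (e ⊕ r)) refl E′ (In u) rest ⟩
      In u +ᵛ (E′ +ᵛ rest)            ∎))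
      (S.solve 4 (λ e y a b → e ⊕ ((y ⊕ a) ⊕ b) ⊜ (y ⊕ a) ⊕ (e ⊕ b)) refl E′ y (l ·ᵛ E) (m ·ᵛ E′))

  -- Over one period the source grows by `D`, the target by `D′`, and the Parikh vector by Δ + ψ +
  -- ψ′. Taking out the effects of both pumps leaves for `Δ` exactly the passage from `E` to `E′`.
  balance : ∀ {p c ψ c′ q ψ′ Δ D D′ E E′} → Run P Moves p ψ c → Run P Moves c′ ψ′ q →
    D +ᵛ c ≡ p +ᵛ E → D′ +ᵛ c′ ≡ q +ᵛ E′ →
    D +ᵛ Out (Δ P.∙ (ψ P.∙ ψ′)) ≡ D′ +ᵛ In (Δ P.∙ (ψ P.∙ ψ′)) → E +ᵛ Out Δ ≡ E′ +ᵛ In Δ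
  balance {p} {c} {ψ} {c′} {q} {ψ′} {Δ} {D} {D′} {E} {E′} σ τ eq eq′ fl = cancelˡ (In ψ +ᵛ Out ψ′) (begin
    In ψ +ᵛ Out ψ′ +ᵛ (E +ᵛ Out Δ)
      ≡⟨ S.solve 4 (λ i o e d → (i ⊕ o) ⊕ (e ⊕ d) ⊜ (e ⊕ i) ⊕ (o ⊕ d)) refl (In ψ) (Out ψ′) E (Out Δ) ⟩
    E +ᵛ In ψ +ᵛ (Out ψ′ +ᵛ Out Δ)      ≡⟨ cong (_+ᵛ (Out ψ′ +ᵛ Out Δ)) up ⟨
    D +ᵛ Out ψ +ᵛ (Out ψ′ +ᵛ Out Δ)
      ≡⟨ S.solve 4 (λ D o o′ d → (D ⊕ o) ⊕ (o′ ⊕ d) ⊜ D ⊕ (d ⊕ (o ⊕ o′))) refl D (Out ψ) (Out ψ′) (Out Δ) ⟩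
    D +ᵛ (Out Δ +ᵛ (Out ψ +ᵛ Out ψ′))   ≡⟨ cong (D +ᵛ_) (three Out-hom) ⟨
    D +ᵛ Out (Δ P.∙ (ψ P.∙ ψ′))         ≡⟨ fl ⟩
    D′ +ᵛ In (Δ P.∙ (ψ P.∙ ψ′))         ≡⟨ cong (D′ +ᵛ_) (three In-hom) ⟩
    D′ +ᵛ (In Δ +ᵛ (In ψ +ᵛ In ψ′))
      ≡⟨ S.solve 4 (λ D i i′ d → D ⊕ (d ⊕ (i ⊕ i′)) ⊜ (D ⊕ i′) ⊕ (i ⊕ d)) refl D′ (In ψ) (In ψ′) (In Δ) ⟩
    D′ +ᵛ In ψ′ +ᵛ (In ψ +ᵛ In Δ)       ≡⟨ cong (_+ᵛ (In ψ +ᵛ In Δ)) down ⟩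
    E′ +ᵛ Out ψ′ +ᵛ (In ψ +ᵛ In Δ)
      ≡⟨ S.solve 4 (λ i o e d → (e ⊕ o) ⊕ (i ⊕ d) ⊜ (i ⊕ o) ⊕ (e ⊕ d)) refl (In ψ) (Out ψ′) E′ (In Δ) ⟩
    In ψ +ᵛ Out ψ′ +ᵛ (E′ +ᵛ In Δ) ∎)
    where
    open ≡-Reasoning
    three : ∀ {h} → Hom P (Vecᴹ d) h → h (Δ P.∙ (ψ P.∙ ψ′)) ≡ h Δ +ᵛ (h ψ +ᵛ h ψ′)
    three {h} H = trans (hom-∙ H Δ _) (cong (h Δ +ᵛ_) (hom-∙ H ψ ψ′))
    up : D +ᵛ Out ψ ≡ E +ᵛ In ψ
    up = cancelˡ (c +ᵛ p) (begin
      c +ᵛ p +ᵛ (D +ᵛ Out ψ)  ≡⟨ S.solve 4 (λ c p D o → (c ⊕ p) ⊕ (D ⊕ o) ⊜ (D ⊕ c) ⊕ (p ⊕ o)) refl c p D (Out ψ) ⟩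
      D +ᵛ c +ᵛ (p +ᵛ Out ψ)  ≡⟨ cong₂ _+ᵛ_ eq (flow σ) ⟩
      p +ᵛ E +ᵛ (c +ᵛ In ψ)   ≡⟨ S.solve 4 (λ c p E i → (p ⊕ E) ⊕ (c ⊕ i) ⊜ (c ⊕ p) ⊕ (E ⊕ i)) refl c p E (In ψ) ⟩
      c +ᵛ p +ᵛ (E +ᵛ In ψ)   ∎)
    down : D′ +ᵛ In ψ′ ≡ E′ +ᵛ Out ψ′
    down = cancelˡ (c′ +ᵛ q) (begin
      c′ +ᵛ q +ᵛ (D′ +ᵛ In ψ′)  ≡⟨ S.solve 4 (λ c q D i → (c ⊕ q) ⊕ (D ⊕ i) ⊜ (D ⊕ c) ⊕ (q ⊕ i)) refl c′ q D′ (In ψ′) ⟩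
      D′ +ᵛ c′ +ᵛ (q +ᵛ In ψ′)  ≡⟨ cong₂ _+ᵛ_ eq′ (sym (flow τ)) ⟩
      q +ᵛ E′ +ᵛ (c′ +ᵛ Out ψ′) ≡⟨ S.solve 4 (λ c q E o → (q ⊕ E) ⊕ (c ⊕ o) ⊜ (c ⊕ q) ⊕ (E ⊕ o)) refl c′ q E′ (Out ψ′) ⟩
      c′ +ᵛ q +ᵛ (E′ +ᵛ Out ψ′) ∎)

  assemble : ∀ {p ψ c c′ ψ′ q Δ X Y x′ y′ D D′ ρ ρ′ Φ} a →
    Run P Moves p ψ c → Run P Moves c′ ψ′ q → Bag {P} Gen Δ → Bag {P} Gen Φ →
    X ≡ p +ᵛ x′ → Y ≡ q +ᵛ y′ → X +ᵛ Out Φ ≡ Y +ᵛ In Φ →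
    D +ᵛ c ≡ p +ᵛ (1ᵛ +ᵛ ρ) → D′ +ᵛ c′ ≡ q +ᵛ (1ᵛ +ᵛ ρ′) →
    D +ᵛ Out (Δ P.∙ (ψ P.∙ ψ′)) ≡ D′ +ᵛ In (Δ P.∙ (ψ P.∙ ψ′)) →
    (∀ k → a ≤ k → ∃[ z ] k ·ᵛ 1ᵛ ≡ In Δ +ᵛ z) → (∃[ z ] a ·ᵛ 1ᵛ ≡ In Φ +ᵛ z) →
    Run P Moves (X +ᵛ a ·ᵛ D) (a P.· ψ P.∙ (Φ P.∙ (a P.· Δ P.∙ a P.· ψ′))) (Y +ᵛ a ·ᵛ D′)
  assemble {ψ = ψ} {Δ = Δ} {X} {Y} {D = D} {D′} {ρ} {ρ′} {Φ} a σ τ π β qX qY fl eq eq′ fl′ fits (z , fz) =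
    Run-trans (iterate-up σ eq a qX) (Run-trans middle₁ (Run-trans middle₂ (iterate-down τ eq′ a qY)))
    where
    open ≡-Reasoning
    E  = 1ᵛ +ᵛ ρ
    E′ = 1ᵛ +ᵛ ρ′
    z′ = z +ᵛ (X +ᵛ a ·ᵛ ρ)
    start : In Φ +ᵛ z′ ≡ X +ᵛ a ·ᵛ E
    start = begin
      In Φ +ᵛ z′                       ≡⟨ V.assoc (In Φ) z _ ⟨
      In Φ +ᵛ z +ᵛ (X +ᵛ a ·ᵛ ρ)       ≡⟨ cong (_+ᵛ (X +ᵛ a ·ᵛ ρ)) fz ⟨
      a ·ᵛ 1ᵛ +ᵛ (X +ᵛ a ·ᵛ ρ)         ≡⟨ S.solve 3 (λ o x r → o ⊕ (x ⊕ r) ⊜ x ⊕ (o ⊕ r)) refl (a ·ᵛ 1ᵛ) X (a ·ᵛ ρ) ⟩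
      X +ᵛ (a ·ᵛ 1ᵛ +ᵛ a ·ᵛ ρ)         ≡⟨ cong (X +ᵛ_) (V.·-∙ a 1ᵛ ρ) ⟨
      X +ᵛ a ·ᵛ E                      ∎
    mid : Out Φ +ᵛ z′ ≡ Y +ᵛ a ·ᵛ E
    mid = cancelˡ (In Φ) (begin
      In Φ +ᵛ (Out Φ +ᵛ z′)            ≡⟨ S.solve 3 (λ i o z → i ⊕ (o ⊕ z) ⊜ o ⊕ (i ⊕ z)) refl (In Φ) (Out Φ) z′ ⟩
      Out Φ +ᵛ (In Φ +ᵛ z′)            ≡⟨ cong (Out Φ +ᵛ_) start ⟩
      Out Φ +ᵛ (X +ᵛ a ·ᵛ E)           ≡⟨ S.solve 3 (λ o x e → o ⊕ (x ⊕ e) ⊜ (x ⊕ o) ⊕ e) refl (Out Φ) X (a ·ᵛ E) ⟩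
      X +ᵛ Out Φ +ᵛ a ·ᵛ E             ≡⟨ cong (_+ᵛ a ·ᵛ E) fl ⟩
      Y +ᵛ In Φ +ᵛ a ·ᵛ E              ≡⟨ S.solve 3 (λ y i e → (y ⊕ i) ⊕ e ⊜ i ⊕ (y ⊕ e)) refl Y (In Φ) (a ·ᵛ E) ⟩
      In Φ +ᵛ (Y +ᵛ a ·ᵛ E)            ∎)
    middle₁ : Run P Moves (X +ᵛ a ·ᵛ E) Φ (Y +ᵛ a ·ᵛ E)
    middle₁ = subst₂ (λ u v → Run P Moves u Φ v) start mid (bag-run β z′)
    middle₂ : Run P Moves (Y +ᵛ a ·ᵛ E) (a P.· Δ) (Y +ᵛ a ·ᵛ E′)
    middle₂ = subst₂ (λ u k → Run P Moves u (a P.· Δ) (Y +ᵛ k ·ᵛ E′)) (V.identityʳ _) (ℕₚ.+-identityʳ a)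
      (iterate-middle π {ρ} {ρ′} (balance σ τ eq eq′ fl′) fits Y a 0 (ℕₚ.≤-reflexive (sym (ℕₚ.+-identityʳ a))))

  pumping : ∀ {X₀ dx Y₀ dy Ψ₀ dΨ p ψ c c′ ψ′ q} →
    X₀ +ᵛ Out Ψ₀ ≡ Y₀ +ᵛ In Ψ₀ → dx +ᵛ Out dΨ ≡ dy +ᵛ In dΨ →
    Run P Moves p ψ c → Run P Moves c′ ψ′ q →
    Eventually (λ k → ∃[ z ] X₀ +ᵛ k ·ᵛ dx ≡ p +ᵛ z) → Eventually (λ k → ∃[ ρ ] k ·ᵛ dx +ᵛ c ≡ p +ᵛ (1ᵛ +ᵛ ρ)) →
    Eventually (λ k → ∃[ z ] Y₀ +ᵛ k ·ᵛ dy ≡ q +ᵛ z) → Eventually (λ k → ∃[ ρ ] k ·ᵛ dy +ᵛ c′ ≡ q +ᵛ (1ᵛ +ᵛ ρ)) →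
    (∀ Φ₀ Φ₁ → Eventually (λ k → ∃[ Φ ] (Φ P.∙ Φ₁ ≡ Φ₀ P.∙ k P.· dΨ × Bag {P} Gen Φ))) →
    Eventually (λ k → Run P Moves (X₀ +ᵛ k ·ᵛ dx) (Ψ₀ P.∙ k P.· dΨ) (Y₀ +ᵛ k ·ᵛ dy))
  pumping {X₀} {dx} {Y₀} {dy} {Ψ₀} {dΨ} {ψ = ψ} {ψ′ = ψ′} fl dfl σ τ X-ev x-ev Y-ev y-ev real
    with eventually-∧ (eventually-∧ x-ev y-ev) (real P.ε (ψ P.∙ ψ′)) | eventually-∧ (eventually-∧ X-ev Y-ev) (real Ψ₀ P.ε)
  ... | K , h | r₀ , h′ with h (suc K) (ℕₚ.n≤1+n K)
  ...   | ((ρ , eq) , (ρ′ , eq′)) , (Δ , Δ-eq , π) with exceeds (In Δ) 1ᵛ positive-1ᵛ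
                                                     | maximum (λ (i : Fin (suc K)) → proj₁ (exceeds (In (Ψ₀ P.∙ (r₀ + toℕ i) P.· dΨ)) 1ᵛ positive-1ᵛ))
  -- The pumps and `π` serve a block of `suc K` periods, a nonzero divisor, so `k` is written as
  -- `r₀ + i + a * s` with `i` below `s`. The remainder `r₀ + i` determines `β`; as there are only
  -- `s` remainders, one lower bound for `a` pays for the inputs of all of them and of `π`.
  ...     | KΔ , fitsΔ | KΦ , maxΦ = r₀ + (KΔ ⊔ KΦ) * suc K , λ k le → decomposed k (quotient k le)
    where
    open ≡-Reasoning
    s = suc K
    a₀ = KΔ ⊔ KΦ
    quotient : ∀ k → r₀ + a₀ * s ≤ k → ∃[ i ] ∃[ a ] (a₀ ≤ a × k ≡ (r₀ + toℕ {s} i) + a * s)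
    quotient k le = Fin.fromℕ< (DivMod.m%n<n m s) , m DivMod./ s
      , subst (_≤ m DivMod./ s) (DivMod.m*n/n≡m a₀ s) (DivMod./-monoˡ-≤ s (ℕₚ.m+n≤o⇒m≤o∸n (a₀ * s) (subst (_≤ k) (ℕₚ.+-comm r₀ (a₀ * s)) le)))
      , (begin
          k                                          ≡⟨ ℕₚ.m+[n∸m]≡n (ℕₚ.m+n≤o⇒m≤o r₀ le) ⟨
          r₀ + m                                     ≡⟨ cong (_+_ r₀) (DivMod.m≡m%n+[m/n]*n m s) ⟩
          r₀ + (m DivMod.% s + (m DivMod./ s) * s)   ≡⟨ ℕₚ.+-assoc r₀ (m DivMod.% s) _ ⟨
          r₀ + m DivMod.% s + (m DivMod./ s) * s     ≡⟨ cong (λ j → r₀ + j + (m DivMod./ s) * s) (Finₚ.toℕ-fromℕ< (DivMod.m%n<n m s)) ⟨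
          r₀ + toℕ (Fin.fromℕ< (DivMod.m%n<n m s)) + (m DivMod./ s) * s ∎)
      where m = k ∸ r₀
    split : ∀ X (x₀ x : Car X) r a → Mon._∙_ X (Mon._∙_ X x₀ (Mon._·_ X r x)) (Mon._·_ X a (Mon._·_ X s x))
                                     ≡ Mon._∙_ X x₀ (Mon._·_ X (r + a * s) x)
    split X x₀ x r a = trans (X.assoc _ _ _) (cong (X._∙_ x₀)
      (trans (cong (X._∙_ (r X.· x)) (sym (X.·-* a s x))) (sym (X.·-+ r (a * s) x))))
      where module X = Mon X
    scaled : s ·ᵛ dx +ᵛ Out (Δ P.∙ (ψ P.∙ ψ′)) ≡ s ·ᵛ dy +ᵛ In (Δ P.∙ (ψ P.∙ ψ′))
    scaled = begin
      s ·ᵛ dx +ᵛ Out (Δ P.∙ (ψ P.∙ ψ′)) ≡⟨ cong (λ u → s ·ᵛ dx +ᵛ Out u) sdΨ ⟩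
      s ·ᵛ dx +ᵛ Out (s P.· dΨ)         ≡⟨ cong (s ·ᵛ dx +ᵛ_) (hom-· Out-hom s dΨ) ⟩
      s ·ᵛ dx +ᵛ s ·ᵛ Out dΨ            ≡⟨ V.·-∙ s dx (Out dΨ) ⟨
      s ·ᵛ (dx +ᵛ Out dΨ)               ≡⟨ cong (s ·ᵛ_) dfl ⟩
      s ·ᵛ (dy +ᵛ In dΨ)                ≡⟨ V.·-∙ s dy (In dΨ) ⟩
      s ·ᵛ dy +ᵛ s ·ᵛ In dΨ             ≡⟨ cong (s ·ᵛ dy +ᵛ_) (hom-· In-hom s dΨ) ⟨
      s ·ᵛ dy +ᵛ In (s P.· dΨ)          ≡⟨ cong (λ u → s ·ᵛ dy +ᵛ In u) sdΨ ⟨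
      s ·ᵛ dy +ᵛ In (Δ P.∙ (ψ P.∙ ψ′))  ∎
      where
      sdΨ = trans Δ-eq (P.identityˡ _)
    flow-at : ∀ r → X₀ +ᵛ r ·ᵛ dx +ᵛ Out (Ψ₀ P.∙ r P.· dΨ) ≡ Y₀ +ᵛ r ·ᵛ dy +ᵛ In (Ψ₀ P.∙ r P.· dΨ)
    flow-at r = begin
      X₀ +ᵛ r ·ᵛ dx +ᵛ Out (Ψ₀ P.∙ r P.· dΨ)        ≡⟨ cong (X₀ +ᵛ r ·ᵛ dx +ᵛ_) (linear Out-hom) ⟩
      X₀ +ᵛ r ·ᵛ dx +ᵛ (Out Ψ₀ +ᵛ r ·ᵛ Out dΨ)      ≡⟨ V.interchange X₀ _ _ _ ⟩
      X₀ +ᵛ Out Ψ₀ +ᵛ (r ·ᵛ dx +ᵛ r ·ᵛ Out dΨ)      ≡⟨ cong₂ _+ᵛ_ fl (sym (V.·-∙ r dx (Out dΨ))) ⟩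
      Y₀ +ᵛ In Ψ₀ +ᵛ r ·ᵛ (dx +ᵛ Out dΨ)            ≡⟨ cong (λ u → Y₀ +ᵛ In Ψ₀ +ᵛ r ·ᵛ u) dfl ⟩
      Y₀ +ᵛ In Ψ₀ +ᵛ r ·ᵛ (dy +ᵛ In dΨ)             ≡⟨ cong (Y₀ +ᵛ In Ψ₀ +ᵛ_) (V.·-∙ r dy (In dΨ)) ⟩
      Y₀ +ᵛ In Ψ₀ +ᵛ (r ·ᵛ dy +ᵛ r ·ᵛ In dΨ)        ≡⟨ V.interchange Y₀ _ _ _ ⟩
      Y₀ +ᵛ r ·ᵛ dy +ᵛ (In Ψ₀ +ᵛ r ·ᵛ In dΨ)        ≡⟨ cong (Y₀ +ᵛ r ·ᵛ dy +ᵛ_) (linear In-hom) ⟨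
      Y₀ +ᵛ r ·ᵛ dy +ᵛ In (Ψ₀ P.∙ r P.· dΨ)         ∎
      where
      linear : ∀ {g} → Hom P (Vecᴹ d) g → g (Ψ₀ P.∙ r P.· dΨ) ≡ g Ψ₀ +ᵛ r ·ᵛ g dΨ
      linear {g} H = trans (hom-∙ H Ψ₀ _) (cong (g Ψ₀ +ᵛ_) (hom-· H r dΨ))
    decomposed : ∀ k → ∃[ i ] ∃[ a ] (a₀ ≤ a × k ≡ (r₀ + toℕ {s} i) + a * s) →
                 Run P Moves (X₀ +ᵛ k ·ᵛ dx) (Ψ₀ P.∙ k P.· dΨ) (Y₀ +ᵛ k ·ᵛ dy)
    decomposed k (i , a , a₀≤a , refl) with h′ (r₀ + toℕ i) (ℕₚ.m≤m+n r₀ _)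
    ... | ((x′ , qX) , (y′ , qY)) , (Φ , Φ-eq , β) =
      subst₂ (λ u v → Run P Moves u (Ψ₀ P.∙ k P.· dΨ) v) (split (Vecᴹ d) X₀ dx r a) (split (Vecᴹ d) Y₀ dy r a)
        (subst (λ u → Run P Moves _ u _) weight-eq
          (assemble a σ τ π β′ qX qY (flow-at r) eq eq′ scaled
            (λ k a≤k → fitsΔ k (ℕₚ.≤-trans (ℕₚ.≤-trans (ℕₚ.m≤m⊔n KΔ KΦ) a₀≤a) a≤k))
            (proj₂ (exceeds (In (Ψ₀ P.∙ r P.· dΨ)) 1ᵛ positive-1ᵛ) a
              (ℕₚ.≤-trans (maxΦ i) (ℕₚ.≤-trans (ℕₚ.m≤n⊔m KΔ KΦ) a₀≤a)))))
      where
      r = r₀ + toℕ i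
      β′ : Bag {P} Gen (Ψ₀ P.∙ r P.· dΨ)
      β′ = subst (Bag {P} Gen) (trans (sym (P.identityʳ Φ)) Φ-eq) β
      weight-eq : a P.· ψ P.∙ (Ψ₀ P.∙ r P.· dΨ P.∙ (a P.· Δ P.∙ a P.· ψ′)) ≡ Ψ₀ P.∙ (r + a * s) P.· dΨ
      weight-eq = begin
        a P.· ψ P.∙ (Ψ₀ P.∙ r P.· dΨ P.∙ (a P.· Δ P.∙ a P.· ψ′))
          ≡⟨ PS.solve 4 (λ u v w x → u PS.⊕ (v PS.⊕ (w PS.⊕ x)) PS.⊜ v PS.⊕ (w PS.⊕ (u PS.⊕ x))) refl
               (a P.· ψ) (Ψ₀ P.∙ r P.· dΨ) (a P.· Δ) (a P.· ψ′) ⟩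
        Ψ₀ P.∙ r P.· dΨ P.∙ (a P.· Δ P.∙ (a P.· ψ P.∙ a P.· ψ′))
          ≡⟨ cong (λ u → Ψ₀ P.∙ r P.· dΨ P.∙ u) (trans (P.·-∙ a Δ _) (cong (P._∙_ (a P.· Δ)) (P.·-∙ a ψ ψ′))) ⟨
        Ψ₀ P.∙ r P.· dΨ P.∙ a P.· (Δ P.∙ (ψ P.∙ ψ′))
          ≡⟨ cong (λ u → Ψ₀ P.∙ r P.· dΨ P.∙ a P.· u) (trans Δ-eq (P.identityˡ _)) ⟩
        Ψ₀ P.∙ r P.· dΨ P.∙ a P.· (s P.· dΨ)
          ≡⟨ split P Ψ₀ dΨ r a ⟩
        Ψ₀ P.∙ (r + a * s) P.· dΨ ∎

-- The induction only passes to slices at level 0, so these are all a shape records.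
data Shape : Set where
  none : Shape
  leaf : ∀ n → (Fin n → Shape) → Shape
  both : Shape → Shape → Shape

mutual
  shape : ∀ {X R} → Good X R → Shape
  shape (empty _)           = none
  shape (piece t _ _ _)     = tree-shape t
  shape (union a b _ _ _)   = both (shape a) (shape b)

  tree-shape : ∀ {n T} → Tree n T → Shape
  tree-shape {n} (node _ _ c) = leaf n (λ p → shape (c p 0))

-- `delete` drops a piece whose uses are all bounded; `child` keeps of a piece the elements whose
-- `p`-th parameter is 0. Passing to Parikh vectors changes monoid and set but not the shape.
data _◁_ : Shape → Shape → Set where
  delete : ∀ {n c} → none ◁ leaf n c
  child  : ∀ {n c} p → c p ◁ leaf n c
  left   : ∀ {a a′ b} → a′ ◁ a → both a′ b ◁ both a b
  right  : ∀ {a b b′} → b′ ◁ b → both a b′ ◁ both a b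

◁-wellFounded : WellFounded _◁_
◁-wellFounded none       = acc λ ()
◁-wellFounded (leaf n c) = acc λ { delete → acc λ () ; (child p) → ◁-wellFounded (c p) }
◁-wellFounded (both a b) = go (◁-wellFounded a) (◁-wellFounded b)
  where
  go : ∀ {a b} → Acc _◁_ a → Acc _◁_ b → Acc _◁_ (both a b)
  go (acc p) (acc q) = acc λ { (left l) → go (p l) (acc q) ; (right r) → go (acc p) (q r) }

shape-resp : ∀ {X} {R S : Car X → Set} {to : ∀ x → R x → S x} {from : ∀ x → S x → R x} (a : Good X R) →
             shape (Good-resp {X} to from a) ≡ shape a
shape-resp (empty _)         = refl
shape-resp (piece _ _ _ _)   = refl
shape-resp (union _ _ _ _ _) = refl

shape-image : ∀ {X Y h} {R : Car X → Set} (H : Lin X Y h) (a : Good X R) → shape (Good-image {X} {Y} {h} H a) ≡ shape a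
shape-image H (empty _)         = refl
shape-image H (piece _ _ _ _)   = refl
shape-image {h = h} H (union a b _ _ _) = cong₂ both (shape-image {h = h} H a) (shape-image {h = h} H b)

shape-map : ∀ {X Y h} {R : Car X → Set} {S : Car Y → Set} (H : Lin X Y h) {to : ∀ x → R x → S (h x)}
            {from : ∀ y → S y → ∃[ x ] (R x × h x ≡ y)} (a : Good X R) → shape (Good-map {X} {Y} {h} H to from a) ≡ shape a
shape-map {X} {Y} {h} H a = trans (shape-resp (Good-image {X} {Y} {h} H a)) (shape-image {h = h} H a)

-- Generators as a Good set, and generators used boundedly often

one-affine : ∀ n → Affine (ℕᴹ ×ᴹ Vecᴹ n) (λ N → 1 , N)
one-affine n = pair-affine (const-affine ℕᴹ 1) id-affine

module _ {X Y : Mon} {R : Car X → Set} {S : Car Y → Set} where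

  LeftOrRight : Car (X ×ᴹ Y) → Set
  LeftOrRight (u , v) = (R u × v ≡ Mon.ε Y) ⊎ (u ≡ Mon.ε X × S v)

  left-affine : Lin X (X ×ᴹ Y) (λ u → u , Mon.ε Y)
  left-affine F = pair-affine F (const-affine Y (Mon.ε Y))

  right-affine : Lin Y (X ×ᴹ Y) (λ v → Mon.ε X , v)
  right-affine F = pair-affine (const-affine X (Mon.ε X)) F

  sum-good : Good X R → Good Y S → Good (X ×ᴹ Y) LeftOrRight
  sum-good a b = union (Good-image {X} {X ×ᴹ Y} {λ u → u , Mon.ε Y} left-affine a) (Good-image {Y} {X ×ᴹ Y} {λ v → Mon.ε X , v} right-affine b)
    (λ { _ (u , p , refl) → inj₁ (p , refl) }) (λ { _ (v , p , refl) → inj₂ (refl , p) })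
    (λ { (u , v) (inj₁ (p , refl)) → inj₁ (u , p , refl) ; (u , v) (inj₂ (refl , p)) → inj₂ (v , p , refl) })

  sum-shape : (a : Good X R) (b : Good Y S) → shape (sum-good a b) ≡ both (shape a) (shape b)
  sum-shape a b = cong₂ both (shape-image {h = λ u → u , Mon.ε Y} left-affine a) (shape-image {h = λ v → Mon.ε X , v} right-affine b)

generator-good : ∀ {X R} (G : Good X R) → Good (Parikhᴹ G) (Generator G)
generator-good (empty _)                   = empty (λ _ ())
generator-good (piece {n} t _ _ _)         = piece t (one-affine n) (λ _ p → refl , p) (λ { _ (refl , p) → _ , p , refl })
generator-good (union a b _ _ _)           = sum-good (generator-good a) (generator-good b)

generator-shape : ∀ {X R} (G : Good X R) → shape (generator-good G) ≡ shape G
generator-shape (empty _)         = refl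
generator-shape (piece _ _ _ _)   = refl
generator-shape (union a b _ _ _) = trans (sum-shape (generator-good a) (generator-good b))
  (cong₂ both (generator-shape a) (generator-shape b))

-- A constant coordinate κ of the Parikh vectors bounds the number of uses of the generators in Gen₁.
record Split {X R} (G : Good X R) {h} (g : Vec ℕ h → Car (Parikhᴹ G)) : Set₁ where
  field
    Gen₀ Gen₁ : Car (Parikhᴹ G) → Set
    good₀     : Good (Parikhᴹ G) Gen₀
    good₁     : Good (Parikhᴹ G) Gen₁
    smaller   : shape good₀ ◁ shape G
    cover     : ∀ u → Generator G u → Gen₀ u ⊎ Gen₁ u
    incl₀     : ∀ u → Gen₀ u → Generator G u
    incl₁     : ∀ u → Gen₁ u → Generator G u
    κ         : Car (Parikhᴹ G) → ℕ
    κ-hom     : Hom (Parikhᴹ G) ℕᴹ κ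
    κ≥1       : ∀ u → Gen₁ u → 1 ≤ κ u
    bound     : ℕ
    constant  : ∀ η → κ (g η) ≡ bound

lin-proj₁ : ∀ X Y {n} (w : Vec ℕ n) p → Mon.lin X w (map proj₁ p) ≡ proj₁ (Mon.lin (X ×ᴹ Y) w p)
lin-proj₁ X Y w p = sym (hom-lin (proj₁-hom X Y) w p)

lin-proj₂ : ∀ X Y {n} (w : Vec ℕ n) p → Mon.lin Y w (map proj₂ p) ≡ proj₂ (Mon.lin (X ×ᴹ Y) w p)
lin-proj₂ X Y w p = sym (hom-lin (proj₂-hom X Y) w p)

-- If the number of uses of a piece is constant, it bounds all its generators. If a parameter total
-- is constant, it bounds the uses with a positive value of this parameter, and the other uses
-- belong to the slice at level 0. A family with neither obstruction grows in all entries.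
split? : ∀ {X R} (G : Good X R) {h} {g : Vec ℕ h → Car (Parikhᴹ G)} (A : Affine (Parikhᴹ G) g) →
         (∀ w → Positive w → AllUsed G (Mon.lin (Parikhᴹ G) w (periods A))) ⊎ Split G g
split? (empty _) A = inj₁ (λ _ _ → tt)
split? (piece {n} {T} t@(node z full c) F s cmp) {h} {g} A = decide (constant? count) (constant-coordinate? params)
  where
  P = ℕᴹ ×ᴹ Vecᴹ n
  G = piece t F s cmp
  count  = proj₁-affine ℕᴹ (Vecᴹ n) A
  params = proj₂-affine ℕᴹ (Vecᴹ n) A
  Goal = (∀ w → Positive w → AllUsed G (Mon.lin P w (periods A))) ⊎ Split G g
  decide : (∀ t → proj₁ (g t) ≡ _) ⊎ (∀ w → Positive w → 1 ≤ Mon.lin ℕᴹ w (periods count)) →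
           ConstantOrPositive params → Goal
  decide (inj₁ const) _ = inj₂ (record
    { Gen₀ = λ _ → ⊥ ; Gen₁ = Generator G ; good₀ = empty (λ _ ()) ; good₁ = generator-good G ; smaller = delete
    ; cover = λ _ → inj₂ ; incl₀ = λ _ () ; incl₁ = λ _ p → p ; κ = proj₁ ; κ-hom = proj₁-hom ℕᴹ (Vecᴹ n)
    ; κ≥1 = λ { _ (refl , _) → ℕₚ.≤-refl } ; bound = _ ; constant = const })
  decide (inj₂ pos) (inj₂ pos′) = inj₁ (λ w p →
      subst (1 ≤_) (lin-proj₁ ℕᴹ (Vecᴹ n) w (periods A)) (pos w p)
    , subst Positive (lin-proj₂ ℕᴹ (Vecᴹ n) w (periods A)) (pos′ w p))
  decide (inj₂ _) (inj₁ (p , k , const)) = inj₂ (record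
    { Gen₀ = λ (m , N) → m ≡ 1 × (T N × lookup N p ≡ 0)
    ; Gen₁ = λ (m , N) → m ≡ 1 × (T N × (∃[ x ] lookup N p ≡ suc x))
    ; good₀ = Good-map {Vecᴹ n} {P} {h = λ N → 1 , N} (λ H → ∘-affine (one-affine n) H) (λ _ q → refl , q)
        (λ { _ (refl , q) → _ , q , refl }) (c p 0)
    ; good₁ = Good-map {Vecᴹ n ×ᴹ Vecᴹ 1} {P} {h = λ (N , x) → 1 , N}
        (λ H → ∘-affine (one-affine n) (proj₁-affine (Vecᴹ n) (Vecᴹ 1) H))
        (λ { (N , x ∷ []) ((q , _) , eq) → refl , q , x , eq })
        (λ { (_ , N) (refl , q , x , eq) → (N , x ∷ []) , ((q , tt) , eq) , refl })
        (Good-solve {Vecᴹ n ×ᴹ Vecᴹ 1} ℕˢ {u = λ (N , x) → lookup N p} {v = λ (N , x) → suc (Vec.head x)}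
          (λ H → hom-affine (lookup-hom p) (proj₁-affine (Vecᴹ n) (Vecᴹ 1) H))
          (λ H → ∙-affine ℕᴹ (const-affine ℕᴹ 1) (hom-affine head-hom (proj₂-affine (Vecᴹ n) (Vecᴹ 1) H)))
          (Good-× {R = T} (piece t id-affine (λ _ q → q) (λ u q → u , q , refl)) (full-space 1)))
    ; smaller = subst (_◁ shape G) (sym (shape-map {Vecᴹ n} {P} {h = λ N → 1 , N} (λ H → ∘-affine (one-affine n) H) (c p 0))) (child p)
    ; cover = λ { (_ , N) (refl , q) → classify N q (lookup N p) refl }
    ; incl₀ = λ { _ (e , q , _) → e , q } ; incl₁ = λ { _ (e , q , _) → e , q }
    ; κ = λ (m , N) → lookup N p ; κ-hom = ∘-hom (lookup-hom p) (proj₂-hom ℕᴹ (Vecᴹ n))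
    ; κ≥1 = λ { _ (_ , _ , x , eq) → subst (1 ≤_) (sym eq) (s≤s z≤n) } ; bound = k ; constant = const })
    where
    classify : ∀ N → T N → ∀ x → lookup N p ≡ x →
               (1 ≡ 1 × (T N × lookup N p ≡ 0)) ⊎ (1 ≡ 1 × (T N × (∃[ x ] lookup N p ≡ suc x)))
    classify N q zero    eq = inj₁ (refl , q , eq)
    classify N q (suc x) eq = inj₂ (refl , q , x , eq)
split? (union a b i j cmp) {h} {g} A = decide (split? a (proj₁-affine A₁ A₂ A)) (split? b (proj₂-affine A₁ A₂ A))
  where
  A₁ = Parikhᴹ a
  A₂ = Parikhᴹ b
  G = union a b i j cmp
  Goal = (∀ w → Positive w → AllUsed G (Mon.lin (A₁ ×ᴹ A₂) w (periods A))) ⊎ Split G g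
  decide : (∀ w → Positive w → AllUsed a (Mon.lin A₁ w (periods (proj₁-affine A₁ A₂ A)))) ⊎ Split a (proj₁ ∘ g) →
           (∀ w → Positive w → AllUsed b (Mon.lin A₂ w (periods (proj₂-affine A₁ A₂ A)))) ⊎ Split b (proj₂ ∘ g) → Goal
  decide (inj₁ p) (inj₁ q) = inj₁ (λ w pos →
      subst (AllUsed a) (lin-proj₁ A₁ A₂ w (periods A)) (p w pos)
    , subst (AllUsed b) (lin-proj₂ A₁ A₂ w (periods A)) (q w pos))
  decide (inj₂ S) _ = inj₂ (record
    { Gen₀ = LeftOrRight {A₁} {A₂} {S.Gen₀} {Generator b}
    ; Gen₁ = λ (u , v) → S.Gen₁ u × v ≡ Mon.ε A₂
    ; good₀ = sum-good S.good₀ (generator-good b)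
    ; good₁ = Good-map {A₁} {A₁ ×ᴹ A₂} {h = λ u → u , Mon.ε A₂} (left-affine {A₁} {A₂} {S.Gen₁} {Generator b}) (λ _ p → p , refl)
        (λ { (u , _) (p , refl) → u , p , refl }) S.good₁
    ; smaller = subst (_◁ shape G) (sym (trans (sum-shape S.good₀ (generator-good b)) (cong (both (shape S.good₀)) (generator-shape b))))
        (left S.smaller)
    ; cover = λ { (u , v) (inj₁ (p , e)) → [ (λ p₀ → inj₁ (inj₁ (p₀ , e))) , (λ p₁ → inj₂ (p₁ , e)) ]′ (S.cover u p)
                ; (u , v) (inj₂ q) → inj₁ (inj₂ q) }
    ; incl₀ = λ { (u , v) (inj₁ (p , e)) → inj₁ (S.incl₀ u p , e) ; (u , v) (inj₂ q) → inj₂ q }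
    ; incl₁ = λ { (u , v) (p , e) → inj₁ (S.incl₁ u p , e) }
    ; κ = S.κ ∘ proj₁ ; κ-hom = ∘-hom S.κ-hom (proj₁-hom A₁ A₂) ; κ≥1 = λ { (u , _) (p , _) → S.κ≥1 u p }
    ; bound = S.bound ; constant = S.constant })
    where module S = Split S
  decide (inj₁ _) (inj₂ S) = inj₂ (record
    { Gen₀ = LeftOrRight {A₁} {A₂} {Generator a} {S.Gen₀}
    ; Gen₁ = λ (u , v) → u ≡ Mon.ε A₁ × S.Gen₁ v
    ; good₀ = sum-good (generator-good a) S.good₀
    ; good₁ = Good-map {A₂} {A₁ ×ᴹ A₂} {h = λ v → Mon.ε A₁ , v} (right-affine {A₁} {A₂} {Generator a} {S.Gen₁}) (λ _ p → refl , p)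
        (λ { (_ , v) (refl , p) → v , p , refl }) S.good₁
    ; smaller = subst (_◁ shape G) (sym (trans (sum-shape (generator-good a) S.good₀) (cong (λ c → both c (shape S.good₀)) (generator-shape a))))
        (right S.smaller)
    ; cover = λ { (u , v) (inj₂ (e , p)) → [ (λ p₀ → inj₁ (inj₂ (e , p₀))) , (λ p₁ → inj₂ (e , p₁)) ]′ (S.cover v p)
                ; (u , v) (inj₁ q) → inj₁ (inj₁ q) }
    ; incl₀ = λ { (u , v) (inj₂ (e , p)) → inj₂ (e , S.incl₀ v p) ; (u , v) (inj₁ q) → inj₁ q }
    ; incl₁ = λ { (u , v) (e , p) → inj₂ (e , S.incl₁ v p) }
    ; κ = S.κ ∘ proj₂ ; κ-hom = ∘-hom S.κ-hom (proj₂-hom A₁ A₂) ; κ≥1 = λ { (_ , v) (_ , p) → S.κ≥1 v p }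
    ; bound = S.bound ; constant = S.constant })
    where module S = Split S

module BoundedUse {d : ℕ} (P : Mon) (M₀ M₁ : Rel d P) where
  private module P = Mon P

  AtMost : ℕ → Rel d P
  AtMost zero    x u y = Run P M₀ x u y
  AtMost (suc n) x u y = Run P M₀ x u y ⊎ Comp P (Run P M₀) (Comp P (Firing P M₁) (AtMost n)) x u y

  AtMost-good : GoodRel P (Run P M₀) → GoodRel P M₁ → ∀ n → GoodRel P (AtMost n)
  AtMost-good a b zero    = a
  AtMost-good a b (suc n) = Good-∪ a (Comp-good {W = P} a (Comp-good (Firing-good b) (AtMost-good a b n)))

  AtMost-sound : ∀ {M : Rel d P} → (∀ {x u y} → M₀ x u y → M x u y) → (∀ {x u y} → M₁ x u y → M x u y) →
                 ∀ n {x u y} → AtMost n x u y → Run P M x u y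
  AtMost-sound i j zero    r = Run-mono i r
  AtMost-sound i j (suc n) (inj₁ r) = Run-mono i r
  AtMost-sound i j (suc n) (inj₂ (comp r (comp (fire z m p q) r′ refl) refl)) =
    Run-trans (Run-mono i r) (step (fire z (j m) p q) (AtMost-sound i j n r′))

  step₀ : ∀ n {x y z u v} → Firing P M₀ x u y → AtMost n y v z → AtMost n x (u P.∙ v) z
  step₀ zero    s r        = step s r
  step₀ (suc n) s (inj₁ r) = inj₁ (step s r)
  step₀ (suc n) s (inj₂ (comp r r′ refl)) = inj₂ (comp (step s r) r′ (sym (P.assoc _ _ _)))

  -- The weight `κ` is additive along a run, and each use of `M₁` consumes at least 1 of the budget
  -- `n`.
  AtMost-complete : ∀ {M : Rel d P} {κ} → Hom P ℕᴹ κ → (∀ {x u y} → M x u y → M₀ x u y ⊎ (M₁ x u y × 1 ≤ κ u)) →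
                    ∀ n {x u y} → Run P M x u y → κ u ≤ n → AtMost n x u y
  AtMost-complete K c zero    stop _ = stop
  AtMost-complete K c (suc n) stop _ = inj₁ stop
  AtMost-complete {κ = κ} K c n (step {v = u} {w = v} (fire z m p q) r) le with c m
  ... | inj₁ m₀ = step₀ n (fire z m₀ p q) (AtMost-complete K c n r
        (ℕₚ.≤-trans (ℕₚ.m≤n+m _ (κ u)) (subst (_≤ n) (hom-∙ K u v) le)))
  AtMost-complete {κ = κ} K c zero (step {v = u} {w = v} (fire z m p q) r) le | inj₂ (_ , 1≤) =
    case ℕₚ.≤-trans 1≤ (ℕₚ.≤-trans (ℕₚ.m≤m+n _ (κ v)) (subst (_≤ 0) (hom-∙ K u v) le)) of λ ()
  AtMost-complete {κ = κ} K c (suc n) (step {v = u} {w = v} (fire z m p q) r) le | inj₂ (m₁ , 1≤) =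
    inj₂ (comp stop (comp (fire z m₁ p q) (AtMost-complete K c n r
      (ℕₚ.≤-pred (ℕₚ.≤-trans (ℕₚ.+-monoˡ-≤ (κ v) 1≤) (subst (_≤ suc n) (hom-∙ K u v) le)))) refl) (sym (P.identityˡ _)))

eventually-all : ∀ {n} {Q : Fin n → ℕ → Set} → (∀ i → Eventually (Q i)) → Eventually (λ k → ∀ i → Q i k)
eventually-all ev with maximum (proj₁ ∘ ev)
... | K , h = K , λ k le i → proj₂ (ev i) k (ℕₚ.≤-trans (h i) le)

eventually-map : ∀ {Q S : ℕ → Set} → (∀ k → Q k → S k) → Eventually Q → Eventually S
eventually-map f (K , h) = K , λ k le → f k (h k le)

-- A pump starting in the affine family x has to increase exactly the constant coordinates of x.
module PumpTarget {d h : ℕ} {x : Vec ℕ h → Vec ℕ d} (A : Affine (Vecᴹ d) x) where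

  coordinate : ∀ i → Affine ℕᴹ (λ η → lookup (x η) i)
  coordinate i = hom-affine (lookup-hom i) A

  threshold-at : ∀ {f : Vec ℕ h → ℕ} (F : Affine ℕᴹ f) →
    (∀ t → f t ≡ base F) ⊎ (∀ w → Positive w → 1 ≤ Mon.lin ℕᴹ w (periods F)) → ℕ
  threshold-at F (inj₁ _) = suc (base F)
  threshold-at F (inj₂ _) = 0

  pump-target : Vec ℕ d
  pump-target = tabulate (λ i → threshold-at (coordinate i) (constant? (coordinate i)))

  module _ (w : Vec ℕ h) (pos : Positive w) where
    direction = V.lin w (periods A)

    multiple : ∀ k i → 1 ≤ Mon.lin ℕᴹ w (periods (coordinate i)) → k ≤ lookup (k ·ᵛ direction) i
    multiple k i 1≤ = ℕₚ.≤-trans (ℕₚ.≤-reflexive (sym (ℕₚ.*-identityʳ k)))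
      (ℕₚ.≤-trans (ℕₚ.*-monoʳ-≤ k (subst (1 ≤_) (sym (lookup-lin w (periods A) i)) 1≤))
        (ℕₚ.≤-reflexive (sym (·-lookup k direction i))))

    -- Constant coordinates agree on the whole family and the others grow, so a pump found at one
    -- member `η₁` can be started far out on any ray.
    eventually-above : ∀ η η₁ → Eventually (λ k → ∃[ z ] x η +ᵛ k ·ᵛ direction ≡ x η₁ +ᵛ z)
    eventually-above η η₁ = eventually-map (λ k le → pointwise-≤ (x η₁) _ le)
      (eventually-all (λ i → at i (constant? (coordinate i))))
      where
      at : ∀ i → _ ⊎ _ → Eventually (λ k → lookup (x η₁) i ≤ lookup (x η +ᵛ k ·ᵛ direction) i)
      at i (inj₁ const) = 0 , λ k _ → ℕₚ.≤-trans (ℕₚ.≤-reflexive (trans (const η₁) (sym (const η))))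
        (ℕₚ.≤-trans (ℕₚ.m≤m+n _ _) (ℕₚ.≤-reflexive (sym (hom-∙ (lookup-hom i) (x η) (k ·ᵛ direction)))))
      at i (inj₂ 1≤) = lookup (x η₁) i , λ k le → ℕₚ.≤-trans le (ℕₚ.≤-trans (multiple k i (1≤ w pos))
        (ℕₚ.≤-trans (ℕₚ.m≤n+m _ _) (ℕₚ.≤-reflexive (sym (hom-∙ (lookup-hom i) (x η) (k ·ᵛ direction))))))

    -- In constant coordinates the target already exceeds `x η₁`; in the others any loss of the pump
    -- is made up by enough copies of `direction`.
    eventually-gain : ∀ η₁ {c z} → c ≡ pump-target +ᵛ z →
                      Eventually (λ k → ∃[ ρ ] k ·ᵛ direction +ᵛ c ≡ x η₁ +ᵛ (1ᵛ +ᵛ ρ))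
    eventually-gain η₁ {c} {z} eq = eventually-map
      (λ k le → case pointwise-≤ (x η₁ +ᵛ 1ᵛ) (k ·ᵛ direction +ᵛ c) le of λ { (ρ , e) → ρ , trans e (V.assoc (x η₁) 1ᵛ ρ) })
      (eventually-all (λ i → subst (λ y → Eventually (λ k → y ≤ _)) (sym (suc-lookup i))
        (at i (constant? (coordinate i)) (trans (cong (λ v → lookup v i) eq)
          (trans (hom-∙ (lookup-hom i) pump-target z) (cong (_+ lookup z i) (Vecₚ.lookup∘tabulate _ i)))))))
      where
      suc-lookup : ∀ i → lookup (x η₁ +ᵛ 1ᵛ) i ≡ suc (lookup (x η₁) i)
      suc-lookup i = trans (hom-∙ (lookup-hom i) (x η₁) 1ᵛ)
        (trans (cong (_+_ (lookup (x η₁) i)) (Vecₚ.lookup-replicate i 1)) (ℕₚ.+-comm _ 1))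
      sum : ∀ k i → lookup (k ·ᵛ direction +ᵛ c) i ≡ lookup (k ·ᵛ direction) i + lookup c i
      sum k i = hom-∙ (lookup-hom i) (k ·ᵛ direction) c
      at : ∀ i (dec : (∀ t → lookup (x t) i ≡ base (coordinate i)) ⊎ (∀ w → Positive w → 1 ≤ Mon.lin ℕᴹ w (periods (coordinate i)))) →
           lookup c i ≡ threshold-at (coordinate i) dec + lookup z i →
           Eventually (λ k → suc (lookup (x η₁) i) ≤ lookup (k ·ᵛ direction +ᵛ c) i)
      at i (inj₁ const) cᵢ = 0 , λ k _ → ℕₚ.≤-trans
        (ℕₚ.≤-trans (s≤s (ℕₚ.≤-reflexive (const η₁))) (ℕₚ.≤-trans (ℕₚ.m≤m+n _ _) (ℕₚ.≤-reflexive (sym cᵢ))))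
        (ℕₚ.≤-trans (ℕₚ.m≤n+m _ _) (ℕₚ.≤-reflexive (sym (sum k i))))
      at i (inj₂ 1≤) _ = suc (lookup (x η₁) i) , λ k le → ℕₚ.≤-trans le (ℕₚ.≤-trans (multiple k i (1≤ w pos))
        (ℕₚ.≤-trans (ℕₚ.m≤m+n _ _) (ℕₚ.≤-reflexive (sym (sum k i)))))

-- The induction step for sets of runs

source-hom : ∀ d W → Hom (Triple d W) (Vecᴹ d) source
source-hom d W = ∘-hom (proj₁-hom (Vecᴹ d) W) (proj₁-hom (Vecᴹ d ×ᴹ W) (Vecᴹ d))

label-hom : ∀ d W → Hom (Triple d W) W label
label-hom d W = ∘-hom (proj₂-hom (Vecᴹ d) W) (proj₁-hom (Vecᴹ d ×ᴹ W) (Vecᴹ d))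

target-hom : ∀ d W → Hom (Triple d W) (Vecᴹ d) target
target-hom d W = proj₂-hom (Vecᴹ d ×ᴹ W) (Vecᴹ d)

module Induction {d : ℕ} (dich : Dichotomy d) {W : Mon} {M : Rel d W} (G : GoodRel W M)
  (IH : ∀ {W′ : Mon} {M′ : Rel d W′} (G′ : GoodRel W′ M′) → shape G′ ◁ shape G → GoodRel W′ (Run W′ M′)) where

  private
    P = Parikhᴹ G
    module P = Mon P
    T = Triple d P
    module T = Mon T
    In Out : Car P → Vec ℕ d
    In u  = source (evaluate G u)
    Out u = target (evaluate G u)
    In-hom : Hom P (Vecᴹ d) In
    In-hom = ∘-hom (source-hom d W) (evaluate-hom G)
    Out-hom : Hom P (Vecᴹ d) Out
    Out-hom = ∘-hom (target-hom d W) (evaluate-hom G)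
    open Pumping {P = P} (Generator G) In Out In-hom Out-hom

  MovesOf : (Car P → Set) → Rel d P
  MovesOf Gen x u y = Gen u × x ≡ In u × y ≡ Out u

  triple : Car P → Car T
  triple u = (In u , u) , Out u

  triple-affine : Lin P T triple
  triple-affine F = pair-affine (pair-affine (hom-affine In-hom F) F) (hom-affine Out-hom F)

  MovesOf-good : ∀ {Gen} → Good P Gen → GoodRel P (MovesOf Gen)
  MovesOf-good = Good-map {P} {T} {triple} triple-affine
    (λ u p → p , refl , refl) (λ { _ (p , refl , refl) → _ , p , refl })

  MovesOf-shape : ∀ {Gen} (a : Good P Gen) → shape (MovesOf-good a) ≡ shape a
  MovesOf-shape a = shape-map {P} {T} {triple} triple-affine a

  Moves-good : GoodRel P Moves
  Moves-good = MovesOf-good (generator-good G)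

  RunAt : ∀ {h} → (Vec ℕ h → Car T) → Vec ℕ h → Set
  RunAt g η = Run P Moves (source (g η)) (label (g η)) (target (g η))

  Flow : Car T → Set
  Flow m = source m +ᵛ Out (label m) ≡ target m +ᵛ In (label m)

  Tˢ : Space
  Tˢ = (Vecˢ d ×ˢ Parikh G) ×ˢ Vecˢ d

  -- As `κ` is constant on the labels of the family, its runs consist of at most `bound` firings
  -- from `Gen₁` between runs with moves from `Gen₀`, to which the induction hypothesis applies.
  bounded-good : ∀ {h} {g : Vec ℕ h → Car T} → Affine T g → Split G (label ∘ g) → Good (Vecᴹ h) (RunAt g)
  bounded-good {g = g} A S = Good-resp
    (λ η → AtMost-sound (λ (p , q) → incl₀ _ p , q) (λ (p , q) → incl₁ _ p , q) bound)
    (λ η r → AtMost-complete κ-hom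
      (λ { (p , q) → [ (λ p₀ → inj₁ (p₀ , q)) , (λ p₁ → inj₂ ((p₁ , q) , κ≥1 _ p₁)) ]′ (cover _ p) })
      bound r (ℕₚ.≤-reflexive (constant η)))
    (Good-pull Tˢ A (AtMost-good (IH (MovesOf-good good₀) (subst (_◁ shape G) (sym (MovesOf-shape good₀)) smaller))
      (MovesOf-good good₁) bound))
    where
    open Split S
    open BoundedUse P (MovesOf Gen₀) (MovesOf Gen₁)

  full : ∀ {h} {g : Vec ℕ h → Car T} (A : Affine T g) → (∀ η → Flow (g η)) →
    (∀ w → Positive w → AllUsed G (Mon.lin P w (periods (label-affine d P A)))) →
    (let t  = PumpTarget.pump-target (source-affine d P A)
         t′ = PumpTarget.pump-target (target-affine d P A)) →
    (∃[ η ] Covers P Moves t (source (g η))) → (∃[ η ] Covers P (λ a u b → Moves b u a) t′ (target (g η))) →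
    Full (RunAt g)
  full {g = g} A fl used (η₁ , ψ , c , z , σ , c≡) (η₂ , ψ′ , c′ , z′ , τ , c′≡) x w pos = eventually-map
    (λ k → subst (λ m → Run P Moves (source m) (label m) (target m)) (sym (at k)))
    (pumping (fl x) increment σ (Run-converse τ)
      (subst (λ v → Eventually (λ k → ∃[ z ] source (g x) +ᵛ k ·ᵛ v ≡ source (g η₁) +ᵛ z)) (lin-source (periods A))
        (PumpTarget.eventually-above (source-affine d P A) w pos x η₁))
      (subst (λ v → Eventually (λ k → ∃[ ρ ] k ·ᵛ v +ᵛ c ≡ source (g η₁) +ᵛ (1ᵛ +ᵛ ρ))) (lin-source (periods A))
        (PumpTarget.eventually-gain (source-affine d P A) w pos η₁ c≡))
      (subst (λ v → Eventually (λ k → ∃[ z ] target (g x) +ᵛ k ·ᵛ v ≡ target (g η₂) +ᵛ z)) (lin-target (periods A))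
        (PumpTarget.eventually-above (target-affine d P A) w pos x η₂))
      (subst (λ v → Eventually (λ k → ∃[ ρ ] k ·ᵛ v +ᵛ c′ ≡ target (g η₂) +ᵛ (1ᵛ +ᵛ ρ))) (lin-target (periods A))
        (PumpTarget.eventually-gain (target-affine d P A) w pos η₂ c′≡))
      (λ Φ₀ Φ₁ → realize G Φ₀ Φ₁ (label δ) (subst (AllUsed G) (lin-label (periods A)) (used w pos))))
    where
    open ≡-Reasoning
    δ : Car T
    δ = T.lin w (periods A)
    lin-source : ∀ p → V.lin w (map proj₁ (map proj₁ p)) ≡ source (T.lin w p)
    lin-source p = trans (lin-proj₁ (Vecᴹ d) P w (map proj₁ p)) (cong proj₁ (lin-proj₁ (Vecᴹ d ×ᴹ P) (Vecᴹ d) w p))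
    lin-label : ∀ p → P.lin w (map proj₂ (map proj₁ p)) ≡ label (T.lin w p)
    lin-label p = trans (lin-proj₂ (Vecᴹ d) P w (map proj₁ p)) (cong proj₂ (lin-proj₁ (Vecᴹ d ×ᴹ P) (Vecᴹ d) w p))
    lin-target : ∀ p → V.lin w (map proj₂ p) ≡ target (T.lin w p)
    lin-target p = lin-proj₂ (Vecᴹ d ×ᴹ P) (Vecᴹ d) w p
    at : ∀ k → g (x +ᵛ k ·ᵛ w) ≡ ((source (g x) +ᵛ k ·ᵛ source δ , label (g x) P.∙ k P.· label δ) , target (g x) +ᵛ k ·ᵛ target δ)
    at k = trans (ray A x k w) (cong₂ _,_ (cong₂ _,_
      (cong (source (g x) +ᵛ_) (hom-· (source-hom d P) k δ)) (cong (label (g x) P.∙_) (hom-· (label-hom d P) k δ)))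
      (cong (target (g x) +ᵛ_) (hom-· (target-hom d P) k δ)))
    -- The flow equation holds at `x` and at `x +ᵛ w`; the difference is the homogeneous equation
    -- for the direction.
    increment : source δ +ᵛ Out (label δ) ≡ target δ +ᵛ In (label δ)
    increment = cancelˡ (source (g x) +ᵛ Out (label (g x))) (begin
      source (g x) +ᵛ Out (label (g x)) +ᵛ (source δ +ᵛ Out (label δ)) ≡⟨ V.interchange (source (g x)) _ _ _ ⟩
      source (g x) +ᵛ source δ +ᵛ (Out (label (g x)) +ᵛ Out (label δ)) ≡⟨ cong (source (g x) +ᵛ source δ +ᵛ_) (hom-∙ Out-hom (label (g x)) (label δ)) ⟨
      source (g x T.∙ δ) +ᵛ Out (label (g x T.∙ δ))                    ≡⟨ subst Flow (expand+ A x w) (fl (x +ᵛ w)) ⟩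
      target (g x T.∙ δ) +ᵛ In (label (g x T.∙ δ))                     ≡⟨ cong (target (g x) +ᵛ target δ +ᵛ_) (hom-∙ In-hom (label (g x)) (label δ)) ⟩
      target (g x) +ᵛ target δ +ᵛ (In (label (g x)) +ᵛ In (label δ))   ≡⟨ V.interchange (target (g x)) _ _ _ ⟩
      target (g x) +ᵛ In (label (g x)) +ᵛ (target δ +ᵛ In (label δ))   ≡⟨ cong (_+ᵛ (target δ +ᵛ In (label δ))) (fl x) ⟨
      source (g x) +ᵛ Out (label (g x)) +ᵛ (target δ +ᵛ In (label δ))  ∎)

  Escape : Rel d P → Vec ℕ d → ∀ {h} → (Vec ℕ h → Vec ℕ d) → Set₁
  Escape N t x = (∃[ η ] Covers P N t (x η)) ⊎
    (Σ[ Q ∈ Rel d P ] (GoodRel P Q × (∀ {v w c} → Q v w c → Run P N v w c) ×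
       (∀ η {w c} → Run P N (x η) w c → Q (x η) w c)))

  -- Recursion on the number of parameters. The slices of a full family are analysed afresh, because
  -- fixing a parameter may create new constant coordinates and thus a different case.
  runs-good : ∀ h {g : Vec ℕ h → Car T} → Affine T g → (∀ η → Flow (g η)) → Good (Vecᴹ h) (RunAt g)

  by-split : ∀ h {g : Vec ℕ h → Car T} (A : Affine T g) → (∀ η → Flow (g η)) →
    (∀ w → Positive w → AllUsed G (Mon.lin P w (periods (label-affine d P A)))) ⊎ Split G (label ∘ g) → Good (Vecᴹ h) (RunAt g)

  by-forward : ∀ h {g : Vec ℕ h → Car T} (A : Affine T g) → (∀ η → Flow (g η)) →
    (∀ w → Positive w → AllUsed G (Mon.lin P w (periods (label-affine d P A)))) →
    Escape Moves (PumpTarget.pump-target (source-affine d P A)) (source ∘ g) → Good (Vecᴹ h) (RunAt g)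

  by-backward : ∀ h {g : Vec ℕ h → Car T} (A : Affine T g) → (∀ η → Flow (g η)) →
    (∀ w → Positive w → AllUsed G (Mon.lin P w (periods (label-affine d P A)))) →
    (∃[ η ] Covers P Moves (PumpTarget.pump-target (source-affine d P A)) (source (g η))) →
    Escape (λ a u b → Moves b u a) (PumpTarget.pump-target (target-affine d P A)) (target ∘ g) → Good (Vecᴹ h) (RunAt g)

  runs-good h A fl = by-split h A fl (split? G (label-affine d P A))

  by-split h A fl (inj₁ used) = by-forward h A fl used
    (dich P Moves Moves-good (PumpTarget.pump-target (source-affine d P A)) (source-affine d P A))
  by-split h A fl (inj₂ S) = bounded-good A S

  by-forward h A fl used (inj₁ pump) = by-backward h A fl used pump
    (dich P (λ a u b → Moves b u a) (converse-good {W = P} Moves-good) (PumpTarget.pump-target (target-affine d P A)) (target-affine d P A))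
  by-forward h A fl used (inj₂ (Q , Q-good , sound , complete)) =
    Good-resp (λ η q → sound q) (λ η r → complete η r) (Good-pull Tˢ A Q-good)

  by-backward zero    A fl used pump (inj₁ pump′) = Good-full₀ (full A fl used pump pump′)
  by-backward (suc h) A fl used pump (inj₁ pump′) = Good-full (full A fl used pump pump′)
    (λ {s} S → runs-good h (∘-affine A S) (λ η → fl (s η)))
  by-backward h A fl used pump (inj₂ (Q , Q-good , sound , complete)) =
    Good-resp (λ η q → Run-converse (sound q)) (λ η r → complete η (Run-converse r))
      (Good-pull Tˢ A (converse-good {W = P} Q-good))

  -- By `flow` every run lies on one of the finitely many solution families of the flow equation.
  -- The equation does not guarantee a run, so each family is examined by `runs-good`.
  Run-Moves-good : GoodRel P (Run P Moves)
  Run-Moves-good = Good-resp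
    (λ { _ (t , _ , r , refl) → r })
    (λ { m r → case surjective π m of λ { (t , refl) → t , flow r , r , refl } })
    (SL-Good {R = RunAt (param π)} (affine π)
      (solve (Vecˢ d)
        (∙-affine (Vecᴹ d) (source-affine d P (affine π)) (hom-affine Out-hom (label-affine d P (affine π))))
        (∙-affine (Vecᴹ d) (target-affine d P (affine π)) (hom-affine In-hom (label-affine d P (affine π)))))
      (λ Γ fl → runs-good _ (∘-affine (affine π) Γ) fl))
    where
    π : Parametrized T
    π = param-× (param-× (param-Vec d) (param-Parikh G)) (param-Vec d)

  private
    weight : Car P → Car W
    weight u = label (evaluate G u)
    weight-hom : Hom P W weight
    weight-hom = ∘-hom (label-hom d W) (evaluate-hom G)

  forget-Parikh : ∀ {x u y} → Run P Moves x u y → Run W M x (weight u) y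
  forget-Parikh stop = subst (λ w → Run W M _ w _) (sym (hom-ε weight-hom)) stop
  forget-Parikh (step (fire {a} {b} z (p , refl , refl) q q′) r) = subst (λ w → Run W M _ w _) (sym (hom-∙ weight-hom _ _))
    (step (fire z (generator-sound G _ p) q q′) (forget-Parikh r))

  add-Parikh : ∀ {x w y} → Run W M x w y → ∃[ u ] (Run P Moves x u y × weight u ≡ w)
  add-Parikh stop = P.ε , stop , hom-ε weight-hom
  add-Parikh (step (fire z m q q′) r) with generator-complete G _ m | add-Parikh r
  ... | u , p , refl | v , r′ , refl = u P.∙ v , step (fire z (p , refl , refl) q q′) r′ , hom-∙ weight-hom u v

  result : GoodRel W (Run W M)
  result = Good-resp (λ { _ (u , r , refl) → forget-Parikh r }) (λ _ → add-Parikh)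
    (relabel-good {d} {P} {W} {weight} weight-hom Run-Moves-good)

-- The shape decreases while the dimension stays fixed and the label monoid varies; smaller
-- dimensions enter only through `dich`.
star-good-from : ∀ {d} → Dichotomy d → StarGood d
star-good-from {d} dich W M a = go a (◁-wellFounded (shape a))
  where
  go : ∀ {W M} (G : GoodRel {d} W M) → Acc _◁_ (shape G) → GoodRel W (Run W M)
  go {W} {M} G (acc rs) = Induction.result dich {W} {M} G (λ G′ lt → go G′ (rs lt))

-- Both statements for `d` are needed for the dichotomy in dimension `suc d`, and hence for
-- `StarGood` there, so they are carried along together.
star-and-threshold : ∀ d → StarGood d × Uncoverable d
star-and-threshold zero    = star-good-from dichotomy-zero , uncoverable-zero
star-and-threshold (suc d) with star-and-threshold d
... | star , uncov = star-good-from (dichotomy-suc star uncov) , uncoverable-suc star uncov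

star-good : ∀ d → StarGood d
star-good d = proj₁ (star-and-threshold d)

-- Reachability in a VASZ

negative positive : ℤ → ℕ
negative (+ n)    = 0
negative -[1+ n ] = suc n
positive (+ n)    = n
positive -[1+ n ] = 0

-- Since `y` is nonnegative, `x` dominates the negative part of `v`. So a letter amounts to a move
-- from the negative to the positive part, fired in a context.
displacement⁺ : ∀ {n} (x : Vec ℕ n) v y → Displ x v y → ∃[ z ] (x ≡ map negative v +ᵛ z × y ≡ map positive v +ᵛ z)
displacement⁺ []      []             []      p = [] , refl , refl
displacement⁺ (a ∷ x) (+ n ∷ v)      (b ∷ y) p with displacement⁺ x v y (p ∘ suc)
... | z , refl , refl = a ∷ z , refl , cong (_∷ _) (trans (ℤₚ.+-injective (p zero)) (ℕₚ.+-comm a n))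
displacement⁺ (a ∷ x) (-[1+ n ] ∷ v) (b ∷ y) p with displacement⁺ x v y (p ∘ suc)
... | z , refl , refl = b ∷ z , cong (_∷ _) (ℤₚ.+-injective restore) , refl
  where
  cancel : ∀ a n → a ≡ n ℤ.+ (a ℤ.+ ℤ.- n)
  cancel = ℤ-Solver.solve-∀
  restore : + a ≡ + (suc n + b)
  restore = trans (cancel (+ a) (+ suc n)) (cong (ℤ._+_ (+ suc n)) (sym (p zero)))

displacement⁻ : ∀ {n} (v : Vec ℤ n) z → Displ (map negative v +ᵛ z) v (map positive v +ᵛ z)
displacement⁻ (+ n ∷ v)      (a ∷ z) zero = cong +_ (ℕₚ.+-comm n a)
displacement⁻ (-[1+ n ] ∷ v) (a ∷ z) zero = sym (trans (ℤₚ.[1+m]⊖[1+n]≡m⊖n (n + a) n)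
  (trans (ℤₚ.⊖-≥ (ℕₚ.m≤m+n n a)) (cong +_ (ℕₚ.m+n∸m≡n n a))))
displacement⁻ (_ ∷ v)        (_ ∷ z) (suc i) = displacement⁻ v z i

point-good : ∀ X (c : Car X) → Good X (λ x → c ≡ x)
point-good X c = piece ⊤-tree (const-affine X c) (λ _ _ → refl) (λ x p → [] , tt , p)

module VASZ-Reach {d : ℕ} (V : VASZ d) where
  open VASZ V

  R : Rel (suc d) ⊤ᴹ → Rel (suc d) ⊤ᴹ
  R = Run ⊤ᴹ

  Difference : Vec ℤ (suc d) → Rel (suc d) ⊤ᴹ
  Difference v x _ y = ((map negative v , tt) , map positive v) ≡ ((x , tt) , y)

  Difference-good : ∀ v → GoodRel ⊤ᴹ (Difference v)
  Difference-good v = point-good (Triple (suc d) ⊤ᴹ) ((map negative v , tt) , map positive v)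

  -- A test does not tolerate contexts in coordinate `zero`, so it is not a move of a `Run` in
  -- dimension `suc d`. Combined with the letters up to the next test, it lives on a hyperplane,
  -- where contexts are added in the other coordinates only.
  Letters Letters★ Test Loop : Rel (suc d) ⊤ᴹ
  Letters x w y = ∃[ a ] Difference (δ a) x w y
  Letters★ = R Letters
  Test x w y = Firing ⊤ᴹ (Difference δz) x w y × lookup x zero ≡ 0
  Loop x w y = (Comp ⊤ᴹ Test Letters★ x w y × lookup x zero ≡ 0) × lookup y zero ≡ 0

  Letters★-good : GoodRel ⊤ᴹ Letters★
  Letters★-good = star-good (suc d) ⊤ᴹ Letters (Good-∃Fin (λ a → Difference-good (δ a)))

  Test-good : GoodRel ⊤ᴹ Test
  Test-good = source-level-good {W = ⊤ᴹ} {R = Firing ⊤ᴹ (Difference δz)} zero 0 (Firing-good (Difference-good δz))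

  Loop-good : GoodRel ⊤ᴹ Loop
  Loop-good = target-level-good {W = ⊤ᴹ} {R = λ x w y → Comp ⊤ᴹ Test Letters★ x w y × lookup x zero ≡ 0} zero 0
    (source-level-good {W = ⊤ᴹ} {R = Comp ⊤ᴹ Test Letters★} zero 0 (Comp-good Test-good Letters★-good))

  Loop-shift : ∀ {x w y} z → lookup z zero ≡ 0 → Loop x w y → Loop (x +ᵛ z) w (y +ᵛ z)
  Loop-shift {x} {_} {y} z p ((comp (t , q) r refl , q′) , q″) =
    (comp (Firing-shift t z , stays x q) (Run-shift r z) refl , stays x q′) , stays y q″
    where
    stays : ∀ x → lookup x zero ≡ 0 → lookup (x +ᵛ z) zero ≡ 0
    stays x q = trans (hom-∙ (lookup-hom zero) x z) (cong₂ _+_ q p)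

  open Hyperplane (star-good d) ⊤ᴹ zero 0 Loop Loop-good (λ ((_ , p) , q) → p , q) Loop-shift

  -- The last test stays outside `Iter`, because the letters after it may end anywhere.
  Arrive Tested All : Rel (suc d) ⊤ᴹ
  Arrive x w y = Letters★ x w y × lookup y zero ≡ 0
  Tested = Comp ⊤ᴹ Arrive (Comp ⊤ᴹ Iter (Comp ⊤ᴹ Test Letters★))
  All x w y = Letters★ x w y ⊎ Tested x w y

  All-good : GoodRel ⊤ᴹ All
  All-good = Good-∪ Letters★-good (Comp-good (target-level-good {W = ⊤ᴹ} {R = Letters★} zero 0 Letters★-good)
    (Comp-good Iter-good (Comp-good Test-good Letters★-good)))

  letters-reach : ∀ {x w y} → Letters★ x w y → Reach V x y
  letters-reach stop = ε★
  letters-reach (step (fire z (a , refl) refl refl) r) = letter a (displacement⁻ (δ a) z) ◅ letters-reach r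

  test-reach : ∀ {x w y} → Comp ⊤ᴹ Test Letters★ x w y → Reach V x y
  test-reach (comp (fire z refl refl refl , p) r _) = zerotest p (displacement⁻ δz z) ◅ letters-reach r

  sound : ∀ {x w y} → All x w y → Reach V x y
  sound (inj₁ r) = letters-reach r
  sound (inj₂ (comp (r , _) (comp it t _) _)) = letters-reach r ◅◅
    (Iter-elim (λ x _ y → Reach V x y) (λ _ → ε★) (λ ((t , _) , _) r → test-reach t ◅◅ r) it ◅◅ test-reach t)

  complete : ∀ {x y} → Reach V x y → All x tt y
  complete ε★ = inj₁ stop
  complete {x} (_◅_ {j = x′} (letter a p) r) with displacement⁺ x (δ a) x′ p | complete r
  ... | z , refl , refl | inj₁ r′ = inj₁ (step (fire z (a , refl) refl refl) r′)
  ... | z , refl , refl | inj₂ (comp (r′ , q) t _) = inj₂ (comp (step (fire z (a , refl) refl refl) r′ , q) t refl)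
  complete {x} (_◅_ {j = x′} (zerotest x₁≡0 p) r) with displacement⁺ x δz x′ p | complete r
  ... | z , eq , eq′ | inj₁ r′ =
    inj₂ (comp (stop , x₁≡0) (comp (Iter-stop x₁≡0) (comp (fire z refl eq eq′ , x₁≡0) r′ refl) refl) refl)
  ... | z , eq , eq′ | inj₂ (comp (r′ , q) (comp it t _) _) =
    inj₂ (comp (stop , x₁≡0) (comp (Iter-step ((comp (fire z refl eq eq′ , x₁≡0) r′ refl , x₁≡0) , q) it) t refl) refl)

  Post*-good : Good (Vecᴹ (suc d)) (Post* V)
  Post*-good = Good-map {X = Triple (suc d) ⊤ᴹ} {h = target} (target-affine (suc d) ⊤ᴹ)
    (λ { ((x , _) , y) (p , refl) → sound p })
    (λ y r → ((xin , tt) , y) , (complete r , refl) , refl)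
    (Good-solve {X = Triple (suc d) ⊤ᴹ} (Vecˢ (suc d)) {u = source} {v = λ _ → xin}
      (source-affine (suc d) ⊤ᴹ) (λ _ → const-affine (Vecᴹ (suc d)) xin) All-good)

-- Bases of downward closures

DownwardBasis : ∀ {n} → (Vec ℕ n → Set) → List (Vec ℕω n) → Set
DownwardBasis R B =
  (∀ x y → R y → x ≤ᵛ y → ∃[ b ] (b ∈ B × embed x ≤ωᵛ b)) ×
  (∀ x b → b ∈ B → embed x ≤ωᵛ b → ∃[ y ] (R y × x ≤ᵛ y))

lookup-embed : ∀ {n} (x : Vec ℕ n) i → lookup (embed x) i ≡ fin (lookup x i)
lookup-embed x i = Vecₚ.lookup-map i fin x

module Ideal {n m : ℕ} {T : Vec ℕ m → Set} {f : Vec ℕ m → Vec ℕ n} (T-full : Full T) (F : Affine (Vecᴹ n) f) where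
  open PumpTarget F using (coordinate; multiple)

  Decision : Fin n → Set
  Decision i = (∀ t → lookup (f t) i ≡ base (coordinate i)) ⊎
               (∀ w → Positive w → 1 ≤ Mon.lin ℕᴹ w (periods (coordinate i)))

  limit-at : ∀ i → Decision i → ℕω
  limit-at i (inj₁ _) = fin (base (coordinate i))
  limit-at i (inj₂ _) = ω

  limit : Vec ℕω n
  limit = tabulate (λ i → limit-at i (constant? (coordinate i)))

  lookup-limit : ∀ i → lookup limit i ≡ limit-at i (constant? (coordinate i))
  lookup-limit i = Vecₚ.lookup∘tabulate _ i

  below-limit : ∀ x t → x ≤ᵛ f t → embed x ≤ωᵛ limit
  below-limit x t le i = subst₂ _≤ω_ (sym (lookup-embed x i)) (sym (lookup-limit i)) (at (constant? (coordinate i)))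
    where
    at : (c : Decision i) → fin (lookup x i) ≤ω limit-at i c
    at (inj₁ const) = fin≤fin (subst (lookup x i ≤_) (const t) (le i))
    at (inj₂ _)     = ≤ω-top

  -- One point far out on the ray in direction `1ᵛ` is enough: it lies in `T`, and all nonconstant
  -- coordinates of `f` grow along this ray.
  approximate : ∀ x → embed x ≤ωᵛ limit → ∃[ t ] (T t × x ≤ᵛ f t)
  approximate x le with eventually-∧ (T-full 0ᵛ 1ᵛ positive-1ᵛ) (eventually-all (λ i → at i (constant? (coordinate i))
                          (subst₂ _≤ω_ (lookup-embed x i) (lookup-limit i) (le i))))
    where
    at : ∀ i (c : Decision i) → fin (lookup x i) ≤ω limit-at i c →
         Eventually (λ k → lookup x i ≤ lookup (f (0ᵛ +ᵛ k ·ᵛ 1ᵛ)) i)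
    at i (inj₁ const) (fin≤fin p) = 0 , λ k _ → ℕₚ.≤-trans p (ℕₚ.≤-reflexive (sym (const _)))
    at i (inj₂ 1≤) _ = lookup x i , λ k le′ → ℕₚ.≤-trans le′ (ℕₚ.≤-trans (multiple 1ᵛ positive-1ᵛ k i (1≤ 1ᵛ positive-1ᵛ))
      (ℕₚ.≤-trans (ℕₚ.m≤n+m _ _) (ℕₚ.≤-reflexive (sym (trans (cong (λ v → lookup v i) (ray F 0ᵛ k 1ᵛ))
        (hom-∙ (lookup-hom i) (f 0ᵛ) _))))))
  ... | K , h = 0ᵛ +ᵛ K ·ᵛ 1ᵛ , proj₁ (h K ℕₚ.≤-refl) , proj₂ (h K ℕₚ.≤-refl)

downward-basis : ∀ {n} {R : Vec ℕ n → Set} → Good (Vecᴹ n) R → Σ (List (Vec ℕω n)) (DownwardBasis R)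
downward-basis (empty e) = [] , (λ x y r → ⊥-elim (e y r)) , λ x b ()
downward-basis (piece {T = T} {f = f} (node _ T-full _) F s c) = limit ∷ []
  , (λ x y r le → case c y r of λ { (t , _ , refl) → limit , Any.here refl , below-limit x t le })
  , (λ { x _ (Any.here refl) le → case approximate x le of λ { (t , p , le′) → f t , s t p , le′ } })
  where open Ideal {T = T} T-full F
downward-basis (union a b i j c) with downward-basis a | downward-basis b
... | A , up , down | B , up′ , down′ = A List.++ B
  , (λ x y r le → [ (λ p → let (b , b∈ , q) = up x y p le in b , Memₚ.∈-++⁺ˡ b∈ , q)
                  , (λ p → let (b , b∈ , q) = up′ x y p le in b , Memₚ.∈-++⁺ʳ A b∈ , q) ]′ (c y r))
  , (λ x b b∈ le → [ (λ b∈A → let (y , p , q) = down x b b∈A le in y , i y p , q)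
                   , (λ b∈B → let (y , p , q) = down′ x b b∈B le in y , j y p , q) ]′ (Memₚ.∈-++⁻ A b∈))

fin-injective : ∀ {m n} → fin m ≡ fin n → m ≡ n
fin-injective refl = refl

exceeding : ℕω → ℕ
exceeding (fin m) = suc m
-- Entries ω put no condition on the bound for the finite entries.
exceeding ω       = 0

finite-bound : ∀ {n} (B : List (Vec ℕω n)) → ∃[ N ] (∀ b i m → b ∈ B → lookup b i ≡ fin m → m < N)
finite-bound [] = 0 , λ b i m ()
finite-bound {n} (b ∷ B) with maximum (λ i → exceeding (lookup b i)) | finite-bound B
... | K , p | N , q = K ⊔ N , λ
  { _ i m (Any.here refl) eq → ℕₚ.≤-trans (subst (λ x → exceeding x ≤ K) eq (p i)) (ℕₚ.m≤m⊔n K N)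
  ; b′ i m (Any.there b∈) eq → ℕₚ.≤-trans (q b′ i m b∈ eq) (ℕₚ.m≤n⊔m K N) }

converging-coordinate : ∀ N (s : ℕ → ℕω) x → (∀ j → ∃[ m ] s j ≡ fin m) → Converges s x →
  Eventually (λ j → ∀ m → s j ≡ fin m → x ≡ fin m ⊎ (x ≡ ω × N ≤ m))
converging-coordinate N s x finite (inj₁ (M , const)) = M , λ j le m eq → inj₁ (trans (sym (const j le)) eq)
converging-coordinate N s x finite (inj₂ (refl , _ , diverges)) with diverges N
... | M , large = M , λ j le m eq → inj₂ (refl , large j m le eq)

-- With `N` above all finite entries of `B`, a single late term of the sequence decides: it agrees
-- with `x` at finite entries and is at least `N` where `x` is ω, so any element of `B` above this
-- term has ω there.
Lim-below : ∀ {n} {D : Vec ℕ n → Set} (B : List (Vec ℕω n)) →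
  (∀ x → D x → ∃[ b ] (b ∈ B × embed x ≤ωᵛ b)) → ∀ x → Lim (EmbedSet D) x → ∃[ b ] (b ∈ B × x ≤ωᵛ b)
Lim-below {n} B up x (s , inD , conv) with finite-bound B
... | N , bounded with eventually-all (λ i → converging-coordinate N (λ j → lookup (s j) i) (lookup x i) (finite i) (conv i))
  where
  finite : ∀ i j → ∃[ m ] lookup (s j) i ≡ fin m
  finite i j with inD j
  ... | y , _ , eq = lookup y i , trans (cong (λ v → lookup v i) (sym eq)) (lookup-embed y i)
...   | K , h with inD K
...     | y , p , eq with up y p
...       | b , b∈ , le = b , b∈ , λ i → at i (h K ℕₚ.≤-refl i (lookup y i) (trans (cong (λ v → lookup v i) (sym eq)) (lookup-embed y i)))
  where
  y≤b : ∀ i → fin (lookup y i) ≤ω lookup b i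
  y≤b i = subst (_≤ω lookup b i) (lookup-embed y i) (le i)
  infinite : ∀ i z → fin (lookup y i) ≤ω z → N ≤ lookup y i → lookup b i ≡ z → ω ≤ω z
  infinite i ω       _           _  _  = ≤ω-top
  infinite i (fin m) (fin≤fin q) N≤ eq =
    ⊥-elim (ℕₚ.<-irrefl refl (ℕₚ.<-≤-trans (bounded b i m b∈ eq) (ℕₚ.≤-trans N≤ q)))
  at : ∀ i → lookup x i ≡ fin (lookup y i) ⊎ (lookup x i ≡ ω × N ≤ lookup y i) → lookup x i ≤ω lookup b i
  at i (inj₁ e)        = subst (_≤ω lookup b i) (sym e) (y≤b i)
  at i (inj₂ (e , N≤)) = subst (_≤ω lookup b i) (sym e) (infinite i (lookup b i) (y≤b i) N≤ refl)

-- The vectors obtained from `x` by replacing ω with `j` stay below `b` and converge to `x` as `j`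
-- grows.
below-Lim : ∀ {n} {D : Vec ℕ n → Set} b → (∀ x → embed x ≤ωᵛ b → D x) → ∀ x → x ≤ωᵛ b → Lim (EmbedSet D) x
below-Lim {n} {D} b down x le = (λ j → embed (cut j)) , (λ j → cut j , down (cut j) (cut≤b j) , refl) , conv
  where
  truncate : ℕ → ℕω → ℕ
  truncate j (fin m) = m
  truncate j ω       = j
  cut : ℕ → Vec ℕ n
  cut j = map (truncate j) x
  lookup-cut : ∀ j i → lookup (embed (cut j)) i ≡ fin (truncate j (lookup x i))
  lookup-cut j i = trans (lookup-embed (cut j) i) (cong fin (Vecₚ.lookup-map i (truncate j) x))
  truncate≤ : ∀ j {u v} → u ≤ω v → fin (truncate j u) ≤ω v
  truncate≤ j (fin≤fin p) = fin≤fin p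
  truncate≤ j ≤ω-top      = ≤ω-top
  cut≤b : ∀ j → embed (cut j) ≤ωᵛ b
  cut≤b j i = subst (_≤ω lookup b i) (sym (lookup-cut j i)) (truncate≤ j (le i))
  conv-at : ∀ (s : ℕ → ℕω) u → (∀ j → s j ≡ fin (truncate j u)) → Converges s u
  conv-at s (fin m) eq = inj₁ (0 , λ j _ → eq j)
  conv-at s ω       eq = inj₂ (refl , (λ N → N , ℕₚ.≤-refl , N , eq N)
    , λ N → N , λ j m N≤j e → subst (N ≤_) (fin-injective (trans (sym (eq j)) e)) N≤j)
  conv : Convergesᵛ (λ j → embed (cut j)) x
  conv i = conv-at _ (lookup x i) (λ j → lookup-cut j i)

_≤ω?_ : ∀ x y → Dec (x ≤ω y)
x     ≤ω? ω     = yes ≤ω-top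
ω     ≤ω? fin n = no λ ()
fin m ≤ω? fin n with m ℕₚ.≤? n
... | yes p = yes (fin≤fin p)
... | no ¬p = no λ { (fin≤fin p) → ¬p p }

_≟ω_ : (x y : ℕω) → Dec (x ≡ y)
ω     ≟ω ω     = yes refl
ω     ≟ω fin n = no λ ()
fin m ≟ω ω     = no λ ()
fin m ≟ω fin n with m ℕₚ.≟ n
... | yes refl = yes refl
... | no ¬p    = no λ { refl → ¬p refl }

minimal-basis : ∀ {n} {D : Vec ℕω n → Set} B → IsBasis D B → Σ (List (Vec ℕω n)) (IsMinimalBasis D)
minimal-basis {n} B basis = filter maximal? B , B , basis , λ x →
    (λ x∈ → let (x∈B , p) = Memₚ.∈-filter⁻ maximal? x∈ in x∈B , λ b b∈ → All.lookup p b∈)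
  , (λ (x∈B , p) → Memₚ.∈-filter⁺ maximal? x∈B (All.tabulate (λ {b} b∈ → p b b∈)))
  where
  maximal? : ∀ x → Dec (All.All (λ b → x ≤ωᵛ b → x ≡ b) B)
  maximal? x = All.all? (λ b → Finₚ.all? (λ i → lookup x i ≤ω? lookup b i) →-dec Vecₚ.≡-dec _≟ω_ x b) B

cover-basis : ∀ {n} {R : Vec ℕ n → Set} → Σ (List (Vec ℕω n)) (DownwardBasis R) →
  Σ (List (Vec ℕω n)) (IsMinimalBasis (EmbedSet (λ x → ∃[ y ] (R y × x ≤ᵛ y))))
cover-basis {n} {R} (B , up , down) = minimal-basis {D = EmbedSet ↓R} B (λ x →
    Lim-below {D = ↓R} B (λ { y (z , p , le) → up y z p le }) x
  , λ { (b , b∈ , le) → below-Lim {D = ↓R} b (λ y → down y b b∈) x le })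
  where
  ↓R : Vec ℕ n → Set
  ↓R x = ∃[ y ] (R y × x ≤ᵛ y)

theorem6p6 : ∀ (d : ℕ) (V : VASZ d) →
    Σ (List (Vec ℕω (suc d))) (λ B → IsMinimalBasis (EmbedSet (Cover V)) B)
theorem6p6 d V = cover-basis (downward-basis (VASZ-Reach.Post*-good V))
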